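{- There exists a deterministic online bipartite edge-coloring algorithm under one-sided node arrivals which, for bipartite graphs whose maximum degree $\Delta$ is known in advance and satisfies $\Delta=\omega(\log n)$, is $\big(\frac{e}{e-1}+o(1)\big)$-competitive.
   Context: Online bipartite edge coloring under one-sided node arrivals: the input is a bipartite graph with $n$ offline nodes on one side, known up front, and $n$ online nodes $v_1,\dots,v_n$ on the other side. At time $t=1,\dots,n$ the online node $v_t$ is revealed together with all its edges (to its neighbors $N(v_t)$ among the offline nodes). The maximum degree $\Delta$ of the graph is known to the algorithm in advance. On arrival of each edge the algorithm must immediately and irrevocably assign it a color, such that no two edges sharing an endpoint receive the same color. A (deterministic) algorithm is $\alpha$-competitive if on every such input of maximum degree $\Delta$ it uses at most $\alpha\Delta$ colors. Asymptotic notation ($o(1)$, $\omega(\log n)$) is as $n\to\infty$. -}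

module Defs where

open import Data.Nat as ℕ using (ℕ; zero; suc; _!)
open import Data.Nat.Properties using (_!≢0)
open import Data.Nat.Logarithm using (⌊log₂_⌋)
open import Data.Fin using (Fin; toℕ)
open import Data.Fin.Subset using (Subset; _∈_; ∣_∣)
open import Data.Vec using (Vec; lookup; tabulate; toList)
open import Data.List using (List; take)
open import Data.Product using (_×_; ∃-syntax; Σ-syntax)
open import Data.Integer using (+_)
open import Relation.Binary.PropositionalEquality using (_≡_; _≢_)
open import Data.Rational using (ℚ; _+_; _-_; _*_; _<_; _≤_; _/_; 1ℚ)

-- Inputs: a bipartite graph with offline nodes Fin n and online nodes
-- v_0 … v_{n-1} (= Fin n).  The graph is the vector of neighbourhoods
-- N(v_t) ⊆ Fin n of the online nodes, in arrival order.

Graph : ℕ → Set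
Graph n = Vec (Subset n) n

onDeg : ∀ {n} → Graph n → Fin n → ℕ
onDeg G t = ∣ lookup G t ∣

offDeg : ∀ {n} → Graph n → Fin n → ℕ
offDeg G u = ∣ tabulate (λ t → lookup (lookup G t) u) ∣

MaxDegree : ∀ {n} → Graph n → ℕ → Set
MaxDegree {n} G Δ =
  (∀ t → onDeg G t ℕ.≤ Δ) × (∀ u → offDeg G u ℕ.≤ Δ) ×
  ((∃[ t ] onDeg G t ≡ Δ) Data.Sum.⊎ (∃[ u ] offDeg G u ≡ Δ))
  where import Data.Sum

-- Deterministic online algorithms.  On arrival of v_t the algorithm
-- knows n (the offline side), Δ, the whole history of previously
-- revealed neighbourhoods N(v_0),…,N(v_{t-1}) (its own earlier
-- decisions are a deterministic function of these), and N(v_t); it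
-- outputs a colour (a natural number) for each edge (v_t,u), u ∈ N(v_t)
-- (values at u ∉ N(v_t) are irrelevant).  Since the colour of an edge
-- of v_t depends only on the prefix of the input up to time t, the
-- decisions are immediate and irrevocable.

OnlineAlg : Set
OnlineAlg = (n Δ : ℕ) → List (Subset n) → Subset n → Fin n → ℕ

colour : OnlineAlg → ∀ {n} → ℕ → Graph n → Fin n → Fin n → ℕ
colour A {n} Δ G t u = A n Δ (take (toℕ t) (toList G)) (lookup G t) u

ProperColouring : ∀ {n} → (Fin n → Fin n → ℕ) → Graph n → Set
ProperColouring {n} c G =
  (∀ t u u' → u ∈ lookup G t → u' ∈ lookup G t → u ≢ u' → c t u ≢ c t u') ×
  (∀ t t' u → u ∈ lookup G t → u ∈ lookup G t' → t ≢ t' → c t u ≢ c t' u)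

-- the colouring uses at most r·Δ colours: every colour lies in
-- {0,…,K-1} for some K ≤ r·Δ, i.e. colour+1 ≤ r·Δ
ℕtoℚ : ℕ → ℚ
ℕtoℚ m = (+ m) / 1

UsesAtMost : ∀ {n} → (Fin n → Fin n → ℕ) → Graph n → ℚ → Set
UsesAtMost {n} c G bound =
  ∀ t u → u ∈ lookup G t → ℕtoℚ (suc (c t u)) ≤ bound

eApprox : ℕ → ℚ
eApprox zero    = 1ℚ
eApprox (suc k) = eApprox k + (+ 1) / (suc k !) where instance _ = (suc k) !≢0

-- e/(e-1) < r.  Since e > 1 this is  r > 1 ∧ e·(r-1) > r, and as
-- e = sup_k eApprox k this holds iff r > 1 and eApprox k · (r-1) > r
-- for some k.
e/[e-1]<_ : ℚ → Set
e/[e-1]< r = (1ℚ < r) × (∃[ k ] r < eApprox k * (r - 1ℚ))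

{-# OPTIONS --safe #-}
-- As e < 3, a palette of K ≈ 3Δ/2 colours is affordable.  Every offline node u
-- carries a weight y u c for every colour c, initially 1.  When an online node
-- with neighbourhood S arrives, call c good if its load p * ∑ y u c over u ∈ S is
-- at most 1, and let x u be y u restricted to the good colours and normalised to
-- sum 1; then x is a fractional assignment of colours to S.  If u were coloured c
-- with probability x u c, and the weights of the colours not chosen were divided
-- by 1 - x u c, then every y u c would be a martingale, every ∑ (y i) as well, and
-- every ∑ (y i * y j) a supermartingale, because distinct rows of S get distinct
-- colours.  The potential is the sum of the q-th powers of such test sums; to first
-- order its change is a sum of costs, one for each row of S and its colour.  So it
-- suffices to assign colours at a cost not above the mean cost under x, and
-- an auction finds such an assignment deterministically.  As q is a large multiple
-- of log n, a bounded potential forces ∑ (y i) ≥ (1 - ν) K and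
-- ∑ (y i * y j) ≤ (1 + ν) K for all i ≠ j.  By Chebyshev's inequality over the
-- colours few of them are then overloaded, so the good colours retain enough weight
-- and every edge is coloured from the palette.

module Submission where

open import Defs
open import Data.Nat as ℕ using (ℕ; zero; suc; _!)
import Data.Nat.DivMod as ℕ using (_/_; m/n*n≤m; m*n/n≡m; /-monoˡ-≤)
open import Data.Nat.Logarithm using (⌊log₂_⌋; ⌊log₂⌋-mono-≤; ⌊log₂[2^n]⌋≡n)
import Data.Nat.Properties as ℕₚ
import Data.Integer as ℤ
import Data.Integer.Properties as ℤₚ
open import Data.Rational
open import Data.Rational.Properties
import Data.Rational.Unnormalised as ℚᵘ
import Data.Rational.Unnormalised.Properties as ℚᵘₚ
open import Data.Bool using (Bool; true; false; if_then_else_)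
open import Data.Maybe using (Maybe; just; nothing; maybe′)
open import Data.Maybe.Properties using (just-injective)
open import Data.Fin as Fin using (Fin; zero; suc)
import Data.Fin.Properties as Finₚ
open import Data.Fin.Subset using (Subset; _∈_; _∉_) renaming (_-_ to _∖_; ∣_∣ to ∥_∥)
open import Data.Fin.Subset.Properties using (_∈?_; x∈p⇒∣p-x∣<∣p∣; x∈p∧x≢y⇒x∈p-y)
open import Data.List using (List; []; _∷_; foldl; take; length)
open import Data.Vec using (Vec; []; _∷_; lookup; tabulate; toList)
open import Data.Vec.Properties using ([]=⇒lookup; lookup⇒[]=)
open import Data.Product using (Σ; ∃-syntax; _×_; _,_; proj₁; proj₂)
open import Data.Sum using (_⊎_; inj₁; inj₂)
open import Relation.Nullary using (¬_; Dec; yes; no; contradiction; does)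
open import Relation.Nullary.Decidable using (_×-dec_; dec-true; dec-false)
open import Relation.Binary.PropositionalEquality
open import Relation.Binary.Consequences using (dec⇒weaklyDec)
open import Relation.Binary.Definitions using (Tri; tri<; tri≈; tri>)
open import Algebra.Bundles using (CommutativeRing)
open import Algebra.Properties.Semiring.Sum (CommutativeRing.semiring +-*-commutativeRing)
  using (sum; sum-cong-≗; ∑-distrib-+; ∑-comm; *-distribˡ-sum; *-distribʳ-sum)
open import Algebra.Properties.CommutativeSemiring.Exp (CommutativeRing.commutativeSemiring +-*-commutativeRing)
  using (_^_; ^-homo-*; ^-assocʳ; ^-distrib-*)
open import Data.Empty using (⊥)
open import Data.Nat.Tactic.RingSolver using () renaming (solve-∀ to ℕ-solve-∀)
open import Tactic.RingSolver using (solve-∀)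
open import Tactic.RingSolver.Core.AlmostCommutativeRing using (AlmostCommutativeRing; fromCommutativeRing)
open import Function using (_∘_)

-- All of the `n * n` tests must hold at once, and a power of a test is not linear in its change.
-- Let β = O(1/Δ) bound the change of a test in one arrival; the second-order error is then of order
-- q β² for each test whose rows are touched. So every test is lowered by τ for each edge at one of
-- its rows. As a row has at most Δ edges, these reductions stay below η when τ = η / (2Δ), and the
-- requirement q β² = O(τ) allows q to be as large as a constant times Δ. The tests are controlled
-- once (1 + η)^q exceeds n² + 1, and this is where Δ has to dominate log n.
--
-- The palette enters through p Δ < 1 < p K. While `y u c` is positive, its inverse falls by at most
-- p with each edge of u, so p Δ = 3/4 keeps all weights at most 4. The same 3/4 places the typical
-- load p * |S| at a distance of at least 1/4 below the threshold 1. Conversely, normalising must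
-- not enlarge a weight by more than the factor p that the load already counts; this needs good
-- weight at least 1/p in each row of S, and p K is about 9/8, which leaves room for the colours
-- that are not good.

ℚ-ring : AlmostCommutativeRing _ _
ℚ-ring = fromCommutativeRing +-*-commutativeRing (λ x → dec⇒weaklyDec _≟_ 0ℚ x)

-- Rational arithmetic

infixl 6 _⊞_
infixl 7 _⊠_

_⊞_ : ∀ {a b} → 0ℚ ≤ a → 0ℚ ≤ b → 0ℚ ≤ a + b
0≤a ⊞ 0≤b = +-mono-≤ 0≤a 0≤b

_⊠_ : ∀ {a b} → 0ℚ ≤ a → 0ℚ ≤ b → 0ℚ ≤ a * b
_⊠_ {a} {b} 0≤a 0≤b = nonNegative⁻¹ (a * b)
  where instance
    _ = nonNeg*nonNeg⇒nonNeg a {{nonNegative 0≤a}} b {{nonNegative 0≤b}}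

diff≥0 : ∀ {a b} → a ≤ b → 0ℚ ≤ b - a
diff≥0 {a} {b} a≤b = subst (_≤ b - a) (+-inverseʳ a) (+-monoˡ-≤ (- a) a≤b)

≤∧≢⇒< : ∀ {p q} → p ≤ q → p ≢ q → p < q
≤∧≢⇒< {p} {q} p≤q p≢q with <-cmp p q
... | tri< p<q _ _ = p<q
... | tri≈ _ p≡q _ = contradiction p≡q p≢q
... | tri> _ _ q<p = contradiction (≤-antisym p≤q (<⇒≤ q<p)) p≢q

*-zero-by : ∀ {a} → a ≡ 0ℚ → ∀ b → a * b ≡ 0ℚ
*-zero-by refl b = *-zeroˡ b

-- The pattern of most inequalities below: the ring solver writes the difference as a sum of
-- products of nonnegative factors, and `_⊞_` and `_⊠_` assemble the sign.
≤-by : ∀ {a b e} → b - a ≡ e → 0ℚ ≤ e → a ≤ b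
≤-by {a} {b} {e} eq 0≤e =
  subst₂ _≤_ (+-identityʳ a) (trans (cong (a +_) (sym eq)) (lem a b)) (+-monoʳ-≤ a 0≤e)
  where lem : ∀ a b → a + (b - a) ≡ b
        lem = solve-∀ ℚ-ring

*-monoˡ : ∀ {a b} c → 0ℚ ≤ c → a ≤ b → c * a ≤ c * b
*-monoˡ c 0≤c = *-monoˡ-≤-nonNeg c {{nonNegative 0≤c}}

*-monoʳ : ∀ {a b} c → 0ℚ ≤ c → a ≤ b → a * c ≤ b * c
*-monoʳ c 0≤c = *-monoʳ-≤-nonNeg c {{nonNegative 0≤c}}

*-mono : ∀ {a b c d} → 0ℚ ≤ a → 0ℚ ≤ d → a ≤ b → c ≤ d → a * c ≤ b * d
*-mono {a} {b} {c} {d} 0≤a 0≤d a≤b c≤d = ≤-trans (*-monoˡ a 0≤a c≤d) (*-monoʳ d 0≤d a≤b)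

square≥0 : ∀ a → 0ℚ ≤ a * a
square≥0 a with ≤-total 0ℚ a
... | inj₁ 0≤a = 0≤a ⊠ 0≤a
... | inj₂ a≤0 = subst (0ℚ ≤_) (lem a) (neg-antimono-≤ a≤0 ⊠ neg-antimono-≤ a≤0)
  where lem : ∀ a → - a * - a ≡ a * a
        lem = solve-∀ ℚ-ring

*-pos : ∀ {a b} → 0ℚ < a → 0ℚ < b → 0ℚ < a * b
*-pos {a} {b} 0<a 0<b = positive⁻¹ (a * b) where instance _ = pos*pos⇒pos a {{positive 0<a}} b {{positive 0<b}}

0≤1 : 0ℚ ≤ 1ℚ
0≤1 = <⇒≤ (positive⁻¹ 1ℚ)

p≤∣p∣ : ∀ p → p ≤ ∣ p ∣
p≤∣p∣ p with ≤-total 0ℚ p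
... | inj₁ 0≤p = ≤-reflexive (sym (0≤p⇒∣p∣≡p 0≤p))
... | inj₂ p≤0 = ≤-trans p≤0 (0≤∣p∣ p)

-- With 1/0 = 0.
opaque
  inv : ℚ → ℚ
  inv a with a ≟ 0ℚ
  ... | yes _  = 0ℚ
  ... | no a≢0 = (1/ a) {{≢-nonZero a≢0}}

  *-inv : ∀ {a} → 0ℚ < a → a * inv a ≡ 1ℚ
  *-inv {a} 0<a with a ≟ 0ℚ
  ... | yes a≡0 = contradiction (sym a≡0) (<⇒≢ 0<a)
  ... | no a≢0  = *-inverseʳ a {{≢-nonZero a≢0}}

  inv≥0 : ∀ {a} → 0ℚ ≤ a → 0ℚ ≤ inv a
  inv≥0 {a} 0≤a with a ≟ 0ℚ
  ... | yes _  = ≤-refl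
  ... | no a≢0 = <⇒≤ (positive⁻¹ ((1/ a) {{≢-nonZero a≢0}}) {{1/pos⇒pos a {{positive (≤∧≢⇒< 0≤a (a≢0 ∘ sym))}}}})

inv>0 : ∀ {a} → 0ℚ < a → 0ℚ < inv a
inv>0 {a} 0<a = ≤∧≢⇒< (inv≥0 (<⇒≤ 0<a)) λ 0≡ → 1≢0 (trans (sym (*-inv 0<a)) (trans (cong (a *_) (sym 0≡)) (*-zeroʳ a)))

inv-bound : ∀ {a b c} → 0ℚ < a → b ≤ c * a → b * inv a ≤ c
inv-bound {a} {b} {c} 0<a b≤ca = subst (b * inv a ≤_) eq (*-monoʳ (inv a) (inv≥0 (<⇒≤ 0<a)) b≤ca)
  where eq : c * a * inv a ≡ c
        eq = trans (*-assoc c a (inv a)) (trans (cong (c *_) (*-inv 0<a)) (*-identityʳ c))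

-- Natural numbers

toℚᵘ-ℕtoℚ : ∀ m → toℚᵘ (ℕtoℚ m) ℚᵘ.≃ ℚᵘ.mkℚᵘ (ℤ.+ m) 0
toℚᵘ-ℕtoℚ m = toℚᵘ-fromℚᵘ (ℚᵘ.mkℚᵘ (ℤ.+ m) 0)

ℕtoℚ-+ : ∀ a b → ℕtoℚ (a ℕ.+ b) ≡ ℕtoℚ a + ℕtoℚ b
ℕtoℚ-+ a b = toℚᵘ-injective (ℚᵘₚ.≃-trans (toℚᵘ-ℕtoℚ (a ℕ.+ b)) (ℚᵘₚ.≃-sym
  (ℚᵘₚ.≃-trans (toℚᵘ-homo-+ (ℕtoℚ a) (ℕtoℚ b))
  (ℚᵘₚ.≃-trans (ℚᵘₚ.+-cong (toℚᵘ-ℕtoℚ a) (toℚᵘ-ℕtoℚ b))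
  (ℚᵘ.*≡* (cong (ℤ._* ℤ.+ 1) (cong₂ ℤ._+_ (ℤₚ.*-identityʳ (ℤ.+ a)) (ℤₚ.*-identityʳ (ℤ.+ b)))))))))

ℕtoℚ-* : ∀ a b → ℕtoℚ (a ℕ.* b) ≡ ℕtoℚ a * ℕtoℚ b
ℕtoℚ-* a b = toℚᵘ-injective (ℚᵘₚ.≃-trans (toℚᵘ-ℕtoℚ (a ℕ.* b)) (ℚᵘₚ.≃-sym
  (ℚᵘₚ.≃-trans (toℚᵘ-homo-* (ℕtoℚ a) (ℕtoℚ b))
  (ℚᵘₚ.≃-trans (ℚᵘₚ.*-cong (toℚᵘ-ℕtoℚ a) (toℚᵘ-ℕtoℚ b))
  (ℚᵘ.*≡* (cong (ℤ._* ℤ.+ 1) (sym (ℤₚ.pos-* a b))))))))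

ℕtoℚ≥0 : ∀ m → 0ℚ ≤ ℕtoℚ m
ℕtoℚ≥0 m = nonNegative⁻¹ (ℕtoℚ m) where instance _ = normalize-nonNeg m 1

ℕtoℚ-mono : ∀ {a b} → a ℕ.≤ b → ℕtoℚ a ≤ ℕtoℚ b
ℕtoℚ-mono {a} {b} a≤b = subst (ℕtoℚ a ≤_) (trans (sym (ℕtoℚ-+ a (b ℕ.∸ a))) (cong ℕtoℚ (ℕₚ.m+[n∸m]≡n a≤b)))
  (≤-by (lem (ℕtoℚ a) (ℕtoℚ (b ℕ.∸ a))) (ℕtoℚ≥0 (b ℕ.∸ a)))
  where lem : ∀ x y → x + y - x ≡ y
        lem = solve-∀ ℚ-ring

ℕtoℚ-suc : ∀ m → ℕtoℚ (suc m) ≡ 1ℚ + ℕtoℚ m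
ℕtoℚ-suc m = ℕtoℚ-+ 1 m

ℕtoℚ-mono-< : ∀ {a b} → a ℕ.< b → ℕtoℚ a < ℕtoℚ b
ℕtoℚ-mono-< {a} {b} a<b = <-≤-trans (subst₂ _<_ (+-identityˡ _) (sym (ℕtoℚ-suc a)) (+-monoˡ-< (ℕtoℚ a) (positive⁻¹ 1ℚ))) (ℕtoℚ-mono a<b)

archimedean : ∀ p → ∃[ m ] p ≤ ℕtoℚ m
archimedean p@(mkℚ (ℤ.+ a) d _) = a , toℚᵘ-cancel-≤ (ℚᵘₚ.≤-trans (ℚᵘ.*≤* lem) (ℚᵘₚ.≤-reflexive (ℚᵘₚ.≃-sym (toℚᵘ-ℕtoℚ a))))
  where lem : ℤ.+ a ℤ.* ℤ.+ 1 ℤ.≤ ℤ.+ a ℤ.* ℤ.+ suc d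
        lem = ℤₚ.*-monoˡ-≤-nonNeg (ℤ.+ a) (ℤ.+≤+ (ℕ.s≤s ℕ.z≤n))
archimedean p@(mkℚ ℤ.-[1+ a ] d _) = 0 , ≤-trans (<⇒≤ (negative⁻¹ p)) (ℕtoℚ≥0 0)

-- Sums

opaque
  ∑ : ∀ {n} → (Fin n → ℚ) → ℚ
  ∑ = sum

opaque
  unfolding ∑

  ∑-mono : ∀ {n} {f g : Fin n → ℚ} → (∀ i → f i ≤ g i) → ∑ f ≤ ∑ g
  ∑-mono {zero}  f≤g = ≤-refl
  ∑-mono {suc n} f≤g = +-mono-≤ (f≤g zero) (∑-mono (f≤g ∘ suc))

  ∑-0 : ∀ n → ∑ {n} (λ _ → 0ℚ) ≡ 0ℚ
  ∑-0 zero    = refl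
  ∑-0 (suc n) = trans (+-identityˡ _) (∑-0 n)

  ∑-cong : ∀ {n} {f g : Fin n → ℚ} → (∀ i → f i ≡ g i) → ∑ f ≡ ∑ g
  ∑-cong = sum-cong-≗

  ∑-const : ∀ n c → ∑ {n} (λ _ → c) ≡ ℕtoℚ n * c
  ∑-const zero    c = sym (*-zeroˡ c)
  ∑-const (suc n) c = trans (cong (c +_) (∑-const n c)) (sym (trans (cong (_* c) (ℕtoℚ-suc n)) (lem (ℕtoℚ n) c)))
    where lem : ∀ n c → (1ℚ + n) * c ≡ c + n * c
          lem = solve-∀ ℚ-ring

  ∑-+ : ∀ {n} (f g : Fin n → ℚ) → ∑ (λ i → f i + g i) ≡ ∑ f + ∑ g
  ∑-+ = ∑-distrib-+

  ∑-*ˡ : ∀ {n} c (f : Fin n → ℚ) → ∑ (λ i → c * f i) ≡ c * ∑ f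
  ∑-*ˡ c f = sym (*-distribˡ-sum c f)

  ∑-*ʳ : ∀ {n} c (f : Fin n → ℚ) → ∑ (λ i → f i * c) ≡ ∑ f * c
  ∑-*ʳ c f = sym (*-distribʳ-sum c f)

  ∑-swap : ∀ {m n} (f : Fin m → Fin n → ℚ) → ∑ (λ i → ∑ (f i)) ≡ ∑ (λ j → ∑ (λ i → f i j))
  ∑-swap = ∑-comm

  ∑≥0 : ∀ {n} {f : Fin n → ℚ} → (∀ i → 0ℚ ≤ f i) → 0ℚ ≤ ∑ f
  ∑≥0 {n} {f} 0≤f = subst (_≤ ∑ f) (∑-0 n) (∑-mono 0≤f)

  ∑-term : ∀ {n} {f : Fin n → ℚ} → (∀ i → 0ℚ ≤ f i) → ∀ i → f i ≤ ∑ f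
  ∑-term {suc n} {f} 0≤f zero    = subst (_≤ ∑ f) (+-identityʳ (f zero)) (+-monoʳ-≤ (f zero) (∑≥0 (0≤f ∘ suc)))
  ∑-term {suc n} {f} 0≤f (suc i) = subst (_≤ ∑ f) (+-identityˡ (f (suc i))) (+-mono-≤ (0≤f zero) (∑-term (0≤f ∘ suc) i))

∑-neg : ∀ {n} (f : Fin n → ℚ) → ∑ (λ i → - f i) ≡ - ∑ f
∑-neg f = trans (∑-cong (λ i → lem (f i))) (trans (∑-*ˡ (- 1ℚ) f) (sym (lem (∑ f))))
  where lem : ∀ a → - a ≡ - 1ℚ * a
        lem = solve-∀ ℚ-ring

∑-- : ∀ {n} (f g : Fin n → ℚ) → ∑ (λ i → f i - g i) ≡ ∑ f - ∑ g
∑-- f g = trans (∑-+ f (λ i → - g i)) (cong (∑ f +_) (∑-neg g))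

∑-bound : ∀ {n} {f : Fin n → ℚ} {c} → (∀ i → f i ≤ c) → ∑ f ≤ ℕtoℚ n * c
∑-bound {n} {f} {c} f≤c = subst (∑ f ≤_) (∑-const n c) (∑-mono f≤c)

∑∑-cong : ∀ {m n} {f g : Fin m → Fin n → ℚ} → (∀ i j → f i j ≡ g i j) → ∑ (λ i → ∑ (f i)) ≡ ∑ (λ i → ∑ (g i))
∑∑-cong f≡g = ∑-cong (λ i → ∑-cong (f≡g i))

∑∑-mono : ∀ {m n} {f g : Fin m → Fin n → ℚ} → (∀ i j → f i j ≤ g i j) → ∑ (λ i → ∑ (f i)) ≤ ∑ (λ i → ∑ (g i))
∑∑-mono f≤g = ∑-mono (λ i → ∑-mono (f≤g i))

-- Powers

^-pos : ∀ {a} n → 0ℚ < a → 0ℚ < a ^ n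
^-pos zero    0<a = positive⁻¹ 1ℚ
^-pos (suc n) 0<a = *-pos 0<a (^-pos n 0<a)

^≥0 : ∀ {a} n → 0ℚ ≤ a → 0ℚ ≤ a ^ n
^≥0 zero    0≤a = 0≤1
^≥0 (suc n) 0≤a = 0≤a ⊠ ^≥0 n 0≤a

^-mono : ∀ {a b} n → 0ℚ ≤ a → a ≤ b → a ^ n ≤ b ^ n
^-mono zero    0≤a a≤b = ≤-refl
^-mono (suc n) 0≤a a≤b = *-mono 0≤a (^≥0 n (≤-trans 0≤a a≤b)) a≤b (^-mono n 0≤a a≤b)

1^ : ∀ n → 1ℚ ^ n ≡ 1ℚ
1^ zero    = refl
1^ (suc n) = trans (*-identityˡ _) (1^ n)

^-mono-exp : ∀ {a m n} → 1ℚ ≤ a → m ℕ.≤ n → a ^ m ≤ a ^ n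
^-mono-exp {a} {m} {n} 1≤a m≤n = subst₂ _≤_ (*-identityʳ (a ^ m)) eq
  (*-monoˡ (a ^ m) (^≥0 m (≤-trans 0≤1 1≤a)) (subst (_≤ a ^ (n ℕ.∸ m)) (1^ (n ℕ.∸ m)) (^-mono (n ℕ.∸ m) 0≤1 1≤a)))
  where eq : a ^ m * a ^ (n ℕ.∸ m) ≡ a ^ n
        eq = trans (sym (^-homo-* a m (n ℕ.∸ m))) (cong (a ^_) (ℕₚ.m+[n∸m]≡n m≤n))

bernoulli : ∀ n {a} → 0ℚ ≤ a → 1ℚ + ℕtoℚ n * a ≤ (1ℚ + a) ^ n
bernoulli zero    {a} 0≤a = ≤-reflexive (lem a)
  where lem : ∀ a → 1ℚ + 0ℚ * a ≡ 1ℚ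
        lem = solve-∀ ℚ-ring
bernoulli (suc n) {a} 0≤a = ≤-trans
  (≤-by (trans (cong (λ m → (1ℚ + a) * (1ℚ + ℕtoℚ n * a) - (1ℚ + m * a)) (ℕtoℚ-suc n)) (lem a (ℕtoℚ n))) (ℕtoℚ≥0 n ⊠ square≥0 a))
  (*-monoˡ (1ℚ + a) (0≤1 ⊞ 0≤a) (bernoulli n 0≤a))
  where lem : ∀ a n → (1ℚ + a) * (1ℚ + n * a) - (1ℚ + (1ℚ + n) * a) ≡ n * (a * a)
        lem = solve-∀ ℚ-ring

-- By induction; the step leaves the surplus `a * a * (1 + n * (1 - n * a))`. The sign of `a` is
-- arbitrary, and the nonnegative `b` above it lets the last hypothesis pass to smaller exponents
-- without a case distinction.
power-upper : ∀ n {a b} → 0ℚ ≤ 1ℚ + a → a ≤ b → 0ℚ ≤ b → ℕtoℚ n * b ≤ 1ℚ →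
              (1ℚ + a) ^ n ≤ 1ℚ + ℕtoℚ n * a + (ℕtoℚ n * a) * (ℕtoℚ n * a)
power-upper zero    {a} _ _ _ _ = ≤-reflexive (lem a)
  where lem : ∀ a → 1ℚ ≡ 1ℚ + 0ℚ * a + (0ℚ * a) * (0ℚ * a)
        lem = solve-∀ ℚ-ring
power-upper (suc n) {a} {b} 0≤1+a a≤b 0≤b sn*b≤1 = ≤-trans
  (*-monoˡ (1ℚ + a) 0≤1+a (power-upper n 0≤1+a a≤b 0≤b n*b≤1))
  (≤-by (trans (cong (λ m → (1ℚ + m * a + (m * a) * (m * a)) - (1ℚ + a) * (1ℚ + ℕtoℚ n * a + (ℕtoℚ n * a) * (ℕtoℚ n * a))) (ℕtoℚ-suc n)) (lem a (ℕtoℚ n)))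
        (square≥0 a ⊠ (0≤1 ⊞ ℕtoℚ≥0 n ⊠ diff≥0 n*a≤1)))
  where
  n*b≤1 : ℕtoℚ n * b ≤ 1ℚ
  n*b≤1 = ≤-trans (*-monoʳ b 0≤b (ℕtoℚ-mono (ℕₚ.n≤1+n n))) sn*b≤1
  n*a≤1 : ℕtoℚ n * a ≤ 1ℚ
  n*a≤1 = ≤-trans (*-monoˡ (ℕtoℚ n) (ℕtoℚ≥0 n) a≤b) n*b≤1
  lem : ∀ a n → (1ℚ + (1ℚ + n) * a + ((1ℚ + n) * a) * ((1ℚ + n) * a)) - (1ℚ + a) * (1ℚ + n * a + (n * a) * (n * a))
              ≡ a * a * (1ℚ + n * (1ℚ - n * a))
  lem = solve-∀ ℚ-ring

-- Indicators and finite choices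

⟦_⟧ : Bool → ℚ
⟦ b ⟧ = if b then 1ℚ else 0ℚ

⟦_⟧≥0 : ∀ b → 0ℚ ≤ ⟦ b ⟧
⟦ true  ⟧≥0 = 0≤1
⟦ false ⟧≥0 = ≤-refl

⟦_⟧≤1 : ∀ b → ⟦ b ⟧ ≤ 1ℚ
⟦ true  ⟧≤1 = ≤-refl
⟦ false ⟧≤1 = 0≤1

indicator : ∀ {P : Set} (A : ℚ → Set) (d : Dec P) → (P → A 1ℚ) → (¬ P → A 0ℚ) → A ⟦ does d ⟧
indicator A (yes p) yes′ _ = yes′ p
indicator A (no ¬p) _ no′  = no′ ¬p

δ : ∀ {n} → Fin n → Fin n → ℚ
δ i j = ⟦ does (i Fin.≟ j) ⟧

δ-refl : ∀ {n} (i : Fin n) → δ i i ≡ 1ℚ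
δ-refl i = cong ⟦_⟧ (dec-true (i Fin.≟ i) refl)

δ-≢ : ∀ {n} {i j : Fin n} → i ≢ j → δ i j ≡ 0ℚ
δ-≢ {i = i} {j} i≢j = cong ⟦_⟧ (dec-false (i Fin.≟ j) i≢j)

δ-suc : ∀ {n} (i j : Fin n) → δ (suc i) (suc j) ≡ δ i j
δ-suc i j with i Fin.≟ j
... | yes _ = refl
... | no _  = refl

opaque
  unfolding ∑

  ∑-δ : ∀ {n} (f : Fin n → ℚ) j → ∑ (λ i → δ i j * f i) ≡ f j
  ∑-δ {suc n} f zero = trans (cong₂ _+_ (*-identityˡ (f zero)) (trans (∑-cong (λ i → *-zeroˡ (f (suc i)))) (∑-0 n))) (+-identityʳ _)
  ∑-δ {suc n} f (suc j) = trans (cong₂ _+_ (*-zeroˡ (f zero)) (trans (∑-cong (λ i → cong (_* f (suc i)) (δ-suc i j))) (∑-δ (f ∘ suc) j))) (+-identityˡ _)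

opaque
  χ : ∀ {n} → Subset n → Fin n → ℚ
  χ S u = ⟦ lookup S u ⟧

  χ≥0 : ∀ {n} (S : Subset n) u → 0ℚ ≤ χ S u
  χ≥0 S u = ⟦ lookup S u ⟧≥0

  χ≤1 : ∀ {n} (S : Subset n) u → χ S u ≤ 1ℚ
  χ≤1 S u = ⟦ lookup S u ⟧≤1

  χ-∈ : ∀ {n} {u : Fin n} {S} → u ∈ S → χ S u ≡ 1ℚ
  χ-∈ u∈S = cong ⟦_⟧ ([]=⇒lookup u∈S)

  χ-∉ : ∀ {n} {u : Fin n} {S} → u ∉ S → χ S u ≡ 0ℚ
  χ-∉ {u = u} {S} u∉S with lookup S u in eq
  ... | true  = contradiction (lookup⇒[]= u S eq) u∉S
  ... | false = refl

injection-≤ : ∀ {n} k (S : Subset n) (f : Fin k → Fin n) → (∀ i → f i ∈ S) →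
              (∀ i j → f i ≡ f j → i ≡ j) → k ℕ.≤ ∥ S ∥
injection-≤ zero    S f f∈S inj = ℕ.z≤n
injection-≤ (suc k) S f f∈S inj = ℕₚ.≤-trans
  (ℕ.s≤s (injection-≤ k (S ∖ f zero) (f ∘ suc)
    (λ i → x∈p∧x≢y⇒x∈p-y (f∈S (suc i)) (λ eq → contradiction (inj (suc i) zero eq) λ ()))
    (λ i j eq → Finₚ.suc-injective (inj (suc i) (suc j) eq))))
  (x∈p⇒∣p-x∣<∣p∣ (f∈S zero))

argmin : ∀ {k} → Fin k → (f : Fin k → ℚ) → ∃[ c ] ∀ c′ → f c ≤ f c′
argmin {suc zero}    _ f = zero , λ { zero → ≤-refl }
argmin {suc (suc k)} _ f with argmin zero (f ∘ suc)
... | c , min with ≤-total (f zero) (f (suc c))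
... | inj₁ f0≤ = zero , λ { zero → ≤-refl ; (suc c′) → ≤-trans f0≤ (min c′) }
... | inj₂ ≤f0 = suc c , λ { zero → ≤f0 ; (suc c′) → min c′ }

-- Near-optimal assignments

-- Bertsekas' auction: an unassigned row takes the column of least cost plus
-- price, raises its price by ε and evicts the previous owner.  A column that
-- was never taken has price 0, which bounds all prices.
module Auction {n K : ℕ} (S : Subset n) (∣S∣<K : ∥ S ∥ ℕ.< K)
               (w : Fin n → Fin K → ℚ) {ε : ℚ} (0<ε : 0ℚ < ε) where

  -- The auction after `t` bids. `slack` is complementary slackness up to ε, with the prices as dual
  -- variables. `owner` persists because a column, once taken, only passes from one row to another.
  -- `total` and `bounded` conflict when `t` is large, which is what makes the auction stop.
  record State (t : ℕ) : Set where
    field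
      owned   : Fin n → Maybe (Fin K)
      price   : Fin K → ℚ
      within  : ∀ {u c} → owned u ≡ just c → u ∈ S
      unique  : ∀ {u u′ c} → owned u ≡ just c → owned u′ ≡ just c → u ≡ u′
      price≥0 : ∀ c → 0ℚ ≤ price c
      owner   : ∀ c → price c ≢ 0ℚ → ∃[ u ] owned u ≡ just c
      slack   : ∀ {u c} → owned u ≡ just c → ∀ c′ → w u c + price c ≤ w u c′ + price c′ + ε
      total   : ∑ price ≡ ℕtoℚ t * ε
      bounded : ∀ c → price c ≤ ∑ (λ u → ∑ (λ c → ∣ w u c ∣)) + ∑ (λ u → ∑ (λ c → ∣ w u c ∣)) + ε

  private
    W : ℚ
    W = ∑ (λ u → ∑ (λ c → ∣ w u c ∣))

    W≥0 : 0ℚ ≤ W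
    W≥0 = ∑≥0 (λ u → ∑≥0 (λ c → 0≤∣p∣ (w u c)))

    ∣w∣≤W : ∀ u c → ∣ w u c ∣ ≤ W
    ∣w∣≤W u c = ≤-trans (∑-term (λ c → 0≤∣p∣ (w u c)) c) (∑-term (λ u → ∑≥0 (λ c → 0≤∣p∣ (w u c))) u)

    w-diff : ∀ u c c′ → w u c′ - w u c ≤ W + W
    w-diff u c c′ = +-mono-≤ (≤-trans (p≤∣p∣ _) (∣w∣≤W u c′))
      (≤-trans (p≤∣p∣ _) (subst (_≤ W) (sym (∣-p∣≡∣p∣ (w u c))) (∣w∣≤W u c)))

    c₀ : Fin K
    c₀ = Fin.fromℕ< ∣S∣<K

    0≤ε : 0ℚ ≤ ε
    0≤ε = <⇒≤ 0<ε

  init : State 0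
  init = record
    { owned = λ _ → nothing ; price = λ _ → 0ℚ ; within = λ () ; unique = λ () ; price≥0 = λ _ → ≤-refl
    ; owner = λ c 0≢0 → contradiction refl 0≢0 ; slack = λ ()
    ; total = trans (∑-0 K) (sym (*-zeroˡ ε)) ; bounded = λ _ → W≥0 ⊞ W≥0 ⊞ 0≤ε }

  free : ∀ {t} (σ : State t) → ∃[ c ] State.price σ c ≡ 0ℚ
  free σ with Finₚ.any? (λ c → State.price σ c ≟ 0ℚ)
  ... | yes found = found
  -- If all prices were nonzero, the owners would inject the `K` columns into `S`.
  ... | no none   = contradiction
    (injection-≤ K S (proj₁ ∘ own) (within ∘ proj₂ ∘ own)
      (λ c c′ eq → just-injective (trans (sym (proj₂ (own c))) (trans (cong owned eq) (proj₂ (own c′))))))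
    (ℕₚ.<⇒≱ ∣S∣<K)
    where
    open State σ
    own : ∀ c → ∃[ u ] owned u ≡ just c
    own c = owner c (λ eq → none (c , eq))

  module Bid {t : ℕ} (σ : State t) {u : Fin n} (u∈S : u ∈ S) (un : State.owned σ u ≡ nothing) where
    open State σ

    best : ∃[ c ] ∀ c′ → w u c + price c ≤ w u c′ + price c′
    best = argmin c₀ (λ c → w u c + price c)

    c⁺ : Fin K
    c⁺ = proj₁ best

    owned′ : Fin n → Maybe (Fin K)
    owned′ v with v Fin.≟ u
    ... | yes _ = just c⁺
    ... | no _ with owned v
    ...   | nothing = nothing
    ...   | just c with c Fin.≟ c⁺
    ...     | yes _ = nothing
    ...     | no _  = just c

    owned′-just : ∀ {v c} → owned′ v ≡ just c → (v ≡ u × c ≡ c⁺) ⊎ (owned v ≡ just c × c ≢ c⁺)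
    owned′-just {v} eq with v Fin.≟ u
    owned′-just {v} refl | yes v≡u = inj₁ (v≡u , refl)
    ... | no _ with owned v
    ...   | just c with c Fin.≟ c⁺
    owned′-just {v} refl | no _ | just c | no c≢c⁺ = inj₂ (refl , c≢c⁺)

    owned′-u : owned′ u ≡ just c⁺
    owned′-u with u Fin.≟ u
    ... | yes _   = refl
    ... | no u≢u = contradiction refl u≢u

    owned′-keep : ∀ {v c} → c ≢ c⁺ → owned v ≡ just c → owned′ v ≡ just c
    owned′-keep {v} c≢c⁺ eq with v Fin.≟ u
    ... | yes refl with () ← trans (sym un) eq
    owned′-keep {v} c≢c⁺ eq | no _ with owned v
    owned′-keep {v} c≢c⁺ refl | no _ | just c with c Fin.≟ c⁺
    ...   | yes c≡c⁺ = contradiction c≡c⁺ c≢c⁺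
    ...   | no _     = refl

    price′ : Fin K → ℚ
    price′ c = price c + δ c c⁺ * ε

    price≤price′ : ∀ c → price c ≤ price′ c
    price≤price′ c = ≤-by (lem (price c) _) (⟦ does (c Fin.≟ c⁺) ⟧≥0 ⊠ 0≤ε)
      where lem : ∀ p d → p + d - p ≡ d
            lem = solve-∀ ℚ-ring

    price′-c⁺ : price′ c⁺ ≡ price c⁺ + ε
    price′-c⁺ = cong (price c⁺ +_) (trans (cong (_* ε) (δ-refl c⁺)) (*-identityˡ ε))

    price′-≢ : ∀ {c} → c ≢ c⁺ → price′ c ≡ price c
    price′-≢ {c} c≢ = trans (cong (price c +_) (trans (cong (_* ε) (δ-≢ c≢)) (*-zeroˡ ε))) (+-identityʳ _)

    owner′ : ∀ c → price′ c ≢ 0ℚ → ∃[ v ] owned′ v ≡ just c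
    owner′ c p≢0 with c Fin.≟ c⁺
    ... | yes refl = u , owned′-u
    ... | no c≢ with owner c (λ eq → p≢0 (trans (cong (price c +_) (*-zeroˡ ε)) (trans (+-identityʳ _) eq)))
    ...   | v , eq = v , owned′-keep c≢ eq

    unique′ : ∀ {v v′ c} → owned′ v ≡ just c → owned′ v′ ≡ just c → v ≡ v′
    unique′ {v} {v′} eq eq′ with owned′-just {v} eq | owned′-just {v′} eq′
    ... | inj₁ (v≡u , _)     | inj₁ (v′≡u , _)    = trans v≡u (sym v′≡u)
    ... | inj₁ (_ , c≡c⁺)    | inj₂ (_ , c≢c⁺)    = contradiction c≡c⁺ c≢c⁺
    ... | inj₂ (_ , c≢c⁺)    | inj₁ (_ , c≡c⁺)    = contradiction c≡c⁺ c≢c⁺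
    ... | inj₂ (ow , _)      | inj₂ (ow′ , _)     = unique ow ow′

    within′ : ∀ {v c} → owned′ v ≡ just c → v ∈ S
    within′ {v} eq with owned′-just {v} eq
    ... | inj₁ (refl , _) = u∈S
    ... | inj₂ (ow , _)   = within ow

    -- The bidder takes a minimiser, so raising its price by ε uses exactly the permitted slack. For
    -- every other owner the own price is unchanged and the competing prices can only have risen.
    slack′ : ∀ {v c} → owned′ v ≡ just c → ∀ c′ → w v c + price′ c ≤ w v c′ + price′ c′ + ε
    slack′ {v} {c} eq c′ with owned′-just {v} eq
    ... | inj₁ (refl , refl) = begin
          w u c⁺ + price′ c⁺       ≡⟨ cong (w u c⁺ +_) price′-c⁺ ⟩
          w u c⁺ + (price c⁺ + ε)  ≡⟨ sym (+-assoc (w u c⁺) (price c⁺) ε) ⟩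
          w u c⁺ + price c⁺ + ε    ≤⟨ +-monoˡ-≤ ε (proj₂ best c′) ⟩
          w u c′ + price c′ + ε    ≤⟨ +-monoˡ-≤ ε (+-monoʳ-≤ (w u c′) (price≤price′ c′)) ⟩
          w u c′ + price′ c′ + ε   ∎
      where open ≤-Reasoning
    ... | inj₂ (ow , c≢) = begin
          w v c + price′ c         ≡⟨ cong (w v c +_) (price′-≢ c≢) ⟩
          w v c + price c          ≤⟨ slack ow c′ ⟩
          w v c′ + price c′ + ε    ≤⟨ +-monoˡ-≤ ε (+-monoʳ-≤ (w v c′) (price≤price′ c′)) ⟩
          w v c′ + price′ c′ + ε   ∎
      where open ≤-Reasoning

    total′ : ∑ price′ ≡ ℕtoℚ (suc t) * ε
    total′ = begin
      ∑ price′                                ≡⟨ ∑-+ price (λ c → δ c c⁺ * ε) ⟩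
      ∑ price + ∑ (λ c → δ c c⁺ * ε)          ≡⟨ cong₂ _+_ total (∑-δ (λ _ → ε) c⁺) ⟩
      ℕtoℚ t * ε + ε                          ≡⟨ lem (ℕtoℚ t) ε ⟩
      (1ℚ + ℕtoℚ t) * ε                       ≡⟨ cong (_* ε) (sym (ℕtoℚ-suc t)) ⟩
      ℕtoℚ (suc t) * ε                        ∎
      where
      open ≡-Reasoning
      lem : ∀ t ε → t * ε + ε ≡ (1ℚ + t) * ε
      lem = solve-∀ ℚ-ring

    bounded′ : ∀ c → price′ c ≤ W + W + ε
    bounded′ c with c Fin.≟ c⁺ | free σ
    ... | no _ | _ = subst (_≤ W + W + ε) (sym (trans (cong (price c +_) (*-zeroˡ ε)) (+-identityʳ _))) (bounded c)
    ... | yes refl | c₁ , p≡0 = +-mono-≤ {price c} {W + W} {1ℚ * ε} {ε} price≤ (≤-reflexive (*-identityˡ ε))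
      where
      lem : ∀ a b c d → c + d - a - b ≡ (c - a) + d - b
      lem = solve-∀ ℚ-ring
      lem₂ : ∀ a b p → (b - a) - p ≡ b + 0ℚ - (a + p)
      lem₂ = solve-∀ ℚ-ring
      -- The free column `c₁` was a possible choice at price 0, so the old price of the chosen
      -- column is at most a difference of two costs.
      price≤ : price c⁺ ≤ W + W
      price≤ = ≤-trans (≤-by (trans (lem₂ (w u c⁺) (w u c₁) (price c⁺)) (cong (λ p → w u c₁ + p - (w u c⁺ + price c⁺)) (sym p≡0))) (diff≥0 (proj₂ best c₁))) (w-diff u c⁺ c₁)

    next : State (suc t)
    next = record
      { owned = owned′ ; price = price′ ; within = within′ ; unique = λ {u} {u′} → unique′ {u} {u′}
      ; price≥0 = λ c → ≤-trans (price≥0 c) (price≤price′ c)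
      ; owner = owner′ ; slack = λ {u} → slack′ {u} ; total = total′ ; bounded = bounded′ }

  Complete : ∀ {t} → State t → Set
  Complete σ = ∀ {u} → u ∈ S → ∃[ c ] State.owned σ u ≡ just c

  private
    -- After `t` bids the prices sum to `t * ε`, and they never exceed `K * (W + W + ε)` in total.
    -- The additional `+ ε` turns this into the strict contradiction of `t<limit`.
    limit : ∃[ T ] (ℕtoℚ K * (W + W + ε) + ε) * inv ε ≤ ℕtoℚ T
    limit = archimedean _

    nothing? : (m : Maybe (Fin K)) → Dec (m ≡ nothing)
    nothing? nothing  = yes refl
    nothing? (just _) = no λ ()

  t<limit : ∀ {t} → State t → t ℕ.< proj₁ limit
  t<limit {t} σ with t ℕ.<? proj₁ limit
  ... | yes t<T = t<T
  ... | no t≮T = contradiction (begin-strict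
    ∑ price                                     ≤⟨ ∑-bound bounded ⟩
    ℕtoℚ K * (W + W + ε)                        <⟨ subst (_< ℕtoℚ K * (W + W + ε) + ε) (+-identityʳ _) (+-monoʳ-< (ℕtoℚ K * (W + W + ε)) 0<ε) ⟩
    ℕtoℚ K * (W + W + ε) + ε                    ≡⟨ lem _ ⟩
    (ℕtoℚ K * (W + W + ε) + ε) * inv ε * ε      ≤⟨ *-monoʳ ε 0≤ε (≤-trans (proj₂ limit) (ℕtoℚ-mono (ℕₚ.≮⇒≥ t≮T))) ⟩
    ℕtoℚ t * ε                                  ≡⟨ sym total ⟩
    ∑ price                                     ∎) (<-irrefl refl)
    where
    open State σ
    open ≤-Reasoning
    lem : ∀ a → a ≡ a * inv ε * ε
    lem a = sym (trans (*-assoc a (inv ε) ε) (trans (cong (a *_) (trans (*-comm (inv ε) ε) (*-inv 0<ε))) (*-identityʳ a)))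

  run : ∀ fuel {t} → State t → proj₁ limit ℕ.≤ fuel ℕ.+ t → ∃[ t ] Σ (State t) Complete
  run zero    σ T≤t = contradiction T≤t (ℕₚ.<⇒≱ (t<limit σ))
  run (suc fuel) {t} σ T≤ with Finₚ.any? (λ u → (u ∈? S) ×-dec nothing? (State.owned σ u))
  ... | yes (u , u∈S , un) = run fuel (Bid.next σ u∈S un) (subst (proj₁ limit ℕ.≤_) (sym (ℕₚ.+-suc fuel t)) T≤)
  ... | no none = t , σ , complete
    where
    complete : Complete σ
    complete {u} u∈S with State.owned σ u in eq
    ... | just c  = c , refl
    ... | nothing = contradiction (u , u∈S , eq) none

  final : ∃[ t ] Σ (State t) Complete
  final = run (proj₁ limit) init (ℕₚ.m≤m+n _ 0)

  open State (proj₁ (proj₂ final))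

  match : Fin n → Fin K
  match u with owned u
  ... | just c  = c
  ... | nothing = c₀

  owned-match : ∀ {u} → u ∈ S → owned u ≡ just (match u)
  owned-match {u} u∈S with owned u | proj₂ (proj₂ final) u∈S
  ... | just c | _ = refl

  match-injective : ∀ {u u′} → u ∈ S → u′ ∈ S → match u ≡ match u′ → u ≡ u′
  match-injective u∈S u′∈S eq = unique (owned-match u∈S) (trans (owned-match u′∈S) (cong just (sym eq)))

  module _ (x : Fin n → Fin K → ℚ) (x≥0 : ∀ u c → 0ℚ ≤ x u c)
           (rows : ∀ u → ∑ (x u) ≡ χ S u) (columns : ∀ c → ∑ (λ u → x u c) ≤ 1ℚ) where

    private
      s : Fin n → ℚ
      s u = χ S u

      zero-row : ∀ {u} → u ∉ S → ∀ c → x u c ≡ 0ℚ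
      zero-row {u} u∉S c = ≤-antisym (subst (x u c ≤_) (trans (rows u) (χ-∉ u∉S)) (∑-term (x≥0 u) c)) (x≥0 u c)

      row : ∀ u → s u * (w u (match u) + price (match u)) ≤ ∑ (λ c → x u c * (w u c + price c + ε))
      row u = subst (_≤ ∑ (λ c → x u c * (w u c + price c + ε)))
        (trans (∑-*ʳ (w u (match u) + price (match u)) (x u)) (cong (_* _) (rows u)))
        (∑-mono go)
        where
        go : ∀ c → x u c * (w u (match u) + price (match u)) ≤ x u c * (w u c + price c + ε)
        go c with u ∈? S
        ... | yes u∈S = *-monoˡ (x u c) (x≥0 u c) (slack (owned-match u∈S) c)
        ... | no u∉S rewrite zero-row u∉S c = ≤-reflexive (trans (*-zeroˡ (w u (match u) + price (match u))) (sym (*-zeroˡ (w u c + price c + ε))))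

      paid : ∑ price ≤ ∑ (λ u → s u * price (match u))
      paid = begin
        ∑ price                                                     ≤⟨ ∑-mono covered ⟩
        ∑ (λ c → ∑ (λ u → δ c (match u) * (s u * price c)))         ≡⟨ ∑-swap (λ c u → δ c (match u) * (s u * price c)) ⟩
        ∑ (λ u → ∑ (λ c → δ c (match u) * (s u * price c)))         ≡⟨ ∑-cong (λ u → ∑-δ (λ c → s u * price c) (match u)) ⟩
        ∑ (λ u → s u * price (match u))                             ∎
        where
        open ≤-Reasoning
        nonneg : ∀ c u → 0ℚ ≤ δ c (match u) * (s u * price c)
        nonneg c u = ⟦ does (c Fin.≟ match u) ⟧≥0 ⊠ (χ≥0 S u ⊠ price≥0 c)
        covered : ∀ c → price c ≤ ∑ (λ u → δ c (match u) * (s u * price c))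
        covered c with price c ≟ 0ℚ
        ... | yes p≡0 = subst (_≤ ∑ (λ u → δ c (match u) * (s u * price c))) (sym p≡0) (∑≥0 (nonneg c))
        ... | no p≢0 with owner c p≢0
        ...   | u , eq = subst (_≤ ∑ (λ u → δ c (match u) * (s u * price c))) term (∑-term (nonneg c) u)
          where
          c≡ : c ≡ match u
          c≡ = just-injective (trans (sym eq) (owned-match (within eq)))
          term : δ c (match u) * (s u * price c) ≡ price c
          term = trans (cong₂ (λ d i → d * (i * price c)) (trans (cong (δ c) (sym c≡)) (δ-refl c)) (χ-∈ (within eq)))
                       (trans (*-identityˡ (1ℚ * price c)) (*-identityˡ _))

    -- Linear programming duality. Averaging `slack` over `x` compares cost plus price row by row
    -- (`row`). The prices then cancel up to sign: all priced columns are owned by matched rows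
    -- (`paid`), while `x` loads each column at most once and so pays at most the total price
    -- (`total-price`).
    match-optimal : ∑ (λ u → s u * w u (match u)) ≤ ∑ (λ u → ∑ (λ c → x u c * w u c)) + ∑ s * ε
    match-optimal = ≤-by (lem (∑ (λ u → s u * w u (match u))) (∑ (λ u → s u * price (match u))) (∑ price) (∑ (λ u → ∑ (λ c → x u c * w u c))) (∑ (λ u → ∑ (λ c → x u c * price c))) (∑ s * ε))
      (diff≥0 total-rows ⊞ diff≥0 paid ⊞ diff≥0 total-price)
      where
      lem : ∀ a b p w q e → w + e - a ≡ (w + q + e - (a + b)) + (b - p) + (p - q)
      lem = solve-∀ ℚ-ring
      total-price : ∑ (λ u → ∑ (λ c → x u c * price c)) ≤ ∑ price
      total-price = begin
        ∑ (λ u → ∑ (λ c → x u c * price c))  ≡⟨ ∑-swap (λ u c → x u c * price c) ⟩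
        ∑ (λ c → ∑ (λ u → x u c * price c))  ≡⟨ ∑-cong (λ c → ∑-*ʳ (price c) (λ u → x u c)) ⟩
        ∑ (λ c → ∑ (λ u → x u c) * price c)  ≤⟨ ∑-mono (λ c → subst (∑ (λ u → x u c) * price c ≤_) (*-identityˡ (price c)) (*-monoʳ (price c) (price≥0 c) (columns c))) ⟩
        ∑ price                              ∎
        where open ≤-Reasoning
      dist : ∀ x a b e → x * (a + b + e) ≡ x * a + x * b + x * e
      dist = solve-∀ ℚ-ring
      total-rows : ∑ (λ u → s u * w u (match u)) + ∑ (λ u → s u * price (match u))
                 ≤ ∑ (λ u → ∑ (λ c → x u c * w u c)) + ∑ (λ u → ∑ (λ c → x u c * price c)) + ∑ s * ε
      total-rows = begin
        ∑ (λ u → s u * w u (match u)) + ∑ (λ u → s u * price (match u))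
          ≡⟨ sym (∑-+ (λ u → s u * w u (match u)) (λ u → s u * price (match u))) ⟩
        ∑ (λ u → s u * w u (match u) + s u * price (match u))
          ≡⟨ ∑-cong (λ u → sym (*-distribˡ-+ (s u) (w u (match u)) (price (match u)))) ⟩
        ∑ (λ u → s u * (w u (match u) + price (match u)))
          ≤⟨ ∑-mono row ⟩
        ∑ (λ u → ∑ (λ c → x u c * (w u c + price c + ε)))
          ≡⟨ ∑-cong (λ u → trans (∑-cong (λ c → dist (x u c) (w u c) (price c) ε))
               (trans (∑-+ (λ c → x u c * w u c + x u c * price c) (λ c → x u c * ε))
                 (cong₂ _+_ (∑-+ (λ c → x u c * w u c) (λ c → x u c * price c))
                            (trans (∑-*ʳ ε (x u)) (cong (_* ε) (rows u)))))) ⟩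
        ∑ (λ u → ∑ (λ c → x u c * w u c) + ∑ (λ c → x u c * price c) + s u * ε)
          ≡⟨ trans (∑-+ (λ u → ∑ (λ c → x u c * w u c) + ∑ (λ c → x u c * price c)) (λ u → s u * ε))
               (cong₂ _+_ (∑-+ (λ u → ∑ (λ c → x u c * w u c)) (λ u → ∑ (λ c → x u c * price c))) (∑-*ʳ ε s)) ⟩
        ∑ (λ u → ∑ (λ c → x u c * w u c)) + ∑ (λ u → ∑ (λ c → x u c * price c)) + ∑ s * ε ∎
        where open ≤-Reasoning

-- One step of the potential

¼ ⅛ 4ℚ 8ℚ : ℚ
¼ = ℤ.+ 1 / 4
⅛ = ℤ.+ 1 / 8
4ℚ = ℤ.+ 4 / 1
8ℚ = ℤ.+ 8 / 1

inv-¼ : ∀ {a} → ¼ ≤ a → inv a ≤ 4ℚ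
inv-¼ {a} ¼≤a = subst (_≤ 4ℚ) (*-identityˡ (inv a)) (inv-bound {a} {1ℚ} (<-≤-trans (positive⁻¹ ¼) ¼≤a) (*-monoˡ 4ℚ (nonNegative⁻¹ 4ℚ) ¼≤a))

-- `power-upper` for `1 + D / Y` and the bound `4 * β`, after factoring out `Y ^ q`. The coefficient
-- `q * Y ^ q * inv Y` is the derivative of the power. The parameter `t` records whether the test is
-- touched, so that an untouched test incurs no second-order term.
power-step : ∀ q {Y D β t} → ¼ ≤ Y → D ≤ β → - β ≤ D → 0ℚ ≤ β → β ≤ ¼ → ℕtoℚ q * β ≤ ¼ →
             D * D ≤ β * β * t →
             (Y + D) ^ q ≤ Y ^ q + ℕtoℚ q * Y ^ q * inv Y * (D + 4ℚ * ℕtoℚ q * (β * β) * t)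
power-step q {Y} {D} {β} {t} ¼≤Y D≤β -β≤D 0≤β β≤¼ qβ≤¼ D²≤ = begin
  (Y + D) ^ q                               ≡⟨ cong (_^ q) Y+D≡ ⟩
  (Y * (1ℚ + a)) ^ q                        ≡⟨ ^-distrib-* Y (1ℚ + a) q ⟩
  Y ^ q * (1ℚ + a) ^ q                      ≤⟨ *-monoˡ (Y ^ q) V≥0 (power-upper q 0≤1+a a≤b 0≤b qb≤1) ⟩
  Y ^ q * (1ℚ + m * a + (m * a) * (m * a))  ≤⟨ ≤-by (lem (Y ^ q) m D i β t) (m≥0 ⊠ V≥0 ⊠ i≥0 ⊠ m≥0 ⊠ (diff≥0 D²≤ ⊠ (nonNegative⁻¹ 4ℚ) ⊞ square≥0 D ⊠ diff≥0 (inv-¼ ¼≤Y))) ⟩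
  Y ^ q + m * Y ^ q * i * (D + 4ℚ * m * (β * β) * t) ∎
  where
  open ≤-Reasoning
  m = ℕtoℚ q
  i = inv Y
  a = D * i
  b = 4ℚ * β
  0<Y : 0ℚ < Y
  0<Y = <-≤-trans (positive⁻¹ ¼) ¼≤Y
  V≥0 : 0ℚ ≤ Y ^ q
  V≥0 = ^≥0 q (<⇒≤ 0<Y)
  i≥0 : 0ℚ ≤ i
  i≥0 = inv≥0 (<⇒≤ 0<Y)
  m≥0 : 0ℚ ≤ m
  m≥0 = ℕtoℚ≥0 q
  0≤b : 0ℚ ≤ b
  0≤b = nonNegative⁻¹ 4ℚ ⊠ 0≤β
  Y+D≡ : Y + D ≡ Y * (1ℚ + a)
  Y+D≡ = sym (trans (lem′ Y D i) (trans (cong (λ z → Y + D * z) (*-inv 0<Y)) (cong (Y +_) (*-identityʳ D))))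
    where lem′ : ∀ Y D i → Y * (1ℚ + D * i) ≡ Y + D * (Y * i)
          lem′ = solve-∀ ℚ-ring
  a≤b : a ≤ b
  a≤b = ≤-trans (*-monoʳ i i≥0 D≤β) (subst (β * i ≤_) (*-comm β 4ℚ) (*-monoˡ β 0≤β (inv-¼ ¼≤Y)))
  0≤1+a : 0ℚ ≤ 1ℚ + a
  0≤1+a = subst (0ℚ ≤_) (lem′ D β i) ((diff≥0 -β≤D ⊠ i≥0) ⊞ diff≥0 {β * i} {1ℚ} (≤-trans (*-mono 0≤β (nonNegative⁻¹ 4ℚ) β≤¼ (inv-¼ ¼≤Y)) (≤-reflexive refl)))
    where lem′ : ∀ D β i → (D - - β) * i + (1ℚ - β * i) ≡ 1ℚ + D * i
          lem′ = solve-∀ ℚ-ring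
  qb≤1 : m * b ≤ 1ℚ
  qb≤1 = ≤-by (lem′ m β) (nonNegative⁻¹ 4ℚ ⊠ diff≥0 qβ≤¼)
    where lem′ : ∀ m β → 1ℚ - m * (4ℚ * β) ≡ 4ℚ * (¼ - m * β)
          lem′ = solve-∀ ℚ-ring
  lem : ∀ V m D i β t → V + m * V * i * (D + 4ℚ * m * (β * β) * t) - V * (1ℚ + m * (D * i) + (m * (D * i)) * (m * (D * i)))
                      ≡ m * V * i * m * ((β * β * t - D * D) * 4ℚ + D * D * (4ℚ - i))
  lem = solve-∀ ℚ-ring

-- Test `(i , j)` changes by `e i j` whatever the colours are, by `d₁ i j c` if row `i` receives
-- `c`, and by `d₂ i j c` if row `j` does. With `rate` the derivative of the `q`-th power,
-- `weight u c` is the first-order growth of the potential caused by giving `u` the colour `c`.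
module PotentialStep {n K : ℕ} (S : Subset n) (Y e : Fin n → Fin n → ℚ) (d₁ d₂ : Fin n → Fin n → Fin K → ℚ) (q : ℕ) where

  rate : Fin n → Fin n → ℚ
  rate i j = ℕtoℚ q * Y i j ^ q * inv (Y i j)

  weight : Fin n → Fin K → ℚ
  weight u c = ∑ (λ j → rate u j * d₁ u j c) + ∑ (λ i → rate i u * d₂ i u c)

  change : (Fin n → Fin K) → Fin n → Fin n → ℚ
  change M i j = e i j + (χ S i * d₁ i j (M i) + χ S j * d₂ i j (M j))

  mean : (Fin n → Fin K → ℚ) → Fin n → Fin n → ℚ
  mean x i j = ∑ (λ c → x i c * d₁ i j c) + ∑ (λ c → x j c * d₂ i j c)

  weight-mean : ∀ x → ∑ (λ u → ∑ (λ c → x u c * weight u c)) ≡ ∑ (λ i → ∑ (λ j → rate i j * mean x i j))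
  weight-mean x = begin
    ∑ (λ u → ∑ (λ c → x u c * weight u c))
      ≡⟨ ∑-cong (λ u → trans (∑-cong (λ c → trans (*-distribˡ-+ (x u c) _ _) (cong₂ _+_ (sym (∑-*ˡ (x u c) _)) (sym (∑-*ˡ (x u c) _)))))
          (trans (∑-+ (λ c → ∑ (λ j → x u c * (rate u j * d₁ u j c))) (λ c → ∑ (λ i → x u c * (rate i u * d₂ i u c))))
            (cong₂ _+_ (∑-swap (λ c j → x u c * (rate u j * d₁ u j c))) (∑-swap (λ c i → x u c * (rate i u * d₂ i u c)))))) ⟩
    ∑ (λ u → ∑ (λ j → ∑ (λ c → x u c * (rate u j * d₁ u j c))) + ∑ (λ i → ∑ (λ c → x u c * (rate i u * d₂ i u c))))
      ≡⟨ ∑-cong (λ u → cong₂ _+_ (∑-cong (λ j → pull (rate u j) (x u) (d₁ u j))) (∑-cong (λ i → pull (rate i u) (x u) (d₂ i u)))) ⟩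
    ∑ (λ u → ∑ (λ j → rate u j * ∑ (λ c → x u c * d₁ u j c)) + ∑ (λ i → rate i u * ∑ (λ c → x u c * d₂ i u c)))
      ≡⟨ ∑-+ (λ u → ∑ (λ j → rate u j * ∑ (λ c → x u c * d₁ u j c))) (λ u → ∑ (λ i → rate i u * ∑ (λ c → x u c * d₂ i u c))) ⟩
    ∑ (λ u → ∑ (λ j → rate u j * ∑ (λ c → x u c * d₁ u j c))) + ∑ (λ u → ∑ (λ i → rate i u * ∑ (λ c → x u c * d₂ i u c)))
      ≡⟨ cong (∑ (λ u → ∑ (λ j → rate u j * ∑ (λ c → x u c * d₁ u j c))) +_) (∑-swap (λ u i → rate i u * ∑ (λ c → x u c * d₂ i u c))) ⟩
    ∑ (λ u → ∑ (λ j → rate u j * ∑ (λ c → x u c * d₁ u j c))) + ∑ (λ i → ∑ (λ u → rate i u * ∑ (λ c → x u c * d₂ i u c)))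
      ≡⟨ sym (∑-+ (λ u → ∑ (λ j → rate u j * ∑ (λ c → x u c * d₁ u j c))) (λ i → ∑ (λ u → rate i u * ∑ (λ c → x u c * d₂ i u c)))) ⟩
    ∑ (λ i → ∑ (λ j → rate i j * ∑ (λ c → x i c * d₁ i j c)) + ∑ (λ j → rate i j * ∑ (λ c → x j c * d₂ i j c)))
      ≡⟨ ∑-cong (λ i → trans (sym (∑-+ (λ j → rate i j * ∑ (λ c → x i c * d₁ i j c)) (λ j → rate i j * ∑ (λ c → x j c * d₂ i j c))))
           (∑-cong (λ j → sym (*-distribˡ-+ (rate i j) _ _)))) ⟩
    ∑ (λ i → ∑ (λ j → rate i j * mean x i j)) ∎
    where
    open ≡-Reasoning
    pull : ∀ r (x : Fin K → ℚ) d → ∑ (λ c → x c * (r * d c)) ≡ r * ∑ (λ c → x c * d c)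
    pull r x d = trans (∑-cong (λ c → lem (x c) r (d c))) (∑-*ˡ r (λ c → x c * d c))
      where lem : ∀ x r d → x * (r * d) ≡ r * (x * d)
            lem = solve-∀ ℚ-ring

  -- The case of `weight-mean` in which each row of `S` puts its whole mass on its colour under `M`.
  weight-match : ∀ M → ∑ (λ u → χ S u * weight u (M u)) ≡ ∑ (λ i → ∑ (λ j → rate i j * (change M i j - e i j)))
  weight-match M = begin
    ∑ (λ u → χ S u * weight u (M u))        ≡⟨ ∑-cong (λ u → sym (point u (weight u))) ⟩
    ∑ (λ u → ∑ (λ c → x u c * weight u c))  ≡⟨ weight-mean x ⟩
    ∑ (λ i → ∑ (λ j → rate i j * mean x i j)) ≡⟨ ∑∑-cong (λ i j → cong (rate i j *_) (trans (cong₂ _+_ (point i (d₁ i j)) (point j (d₂ i j))) (lem (e i j) _))) ⟩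
    ∑ (λ i → ∑ (λ j → rate i j * (change M i j - e i j))) ∎
    where
    open ≡-Reasoning
    x : Fin n → Fin K → ℚ
    x u c = δ c (M u) * χ S u
    point : ∀ u (f : Fin K → ℚ) → ∑ (λ c → x u c * f c) ≡ χ S u * f (M u)
    point u f = trans (∑-cong (λ c → *-assoc (δ c (M u)) (χ S u) (f c))) (∑-δ (λ c → χ S u * f c) (M u))
    lem : ∀ e t → t ≡ e + t - e
    lem = solve-∀ ℚ-ring

  module _ (x : Fin n → Fin K → ℚ) (M : Fin n → Fin K) {E β : ℚ}
           (M-good : ∑ (λ u → χ S u * weight u (M u)) ≤ ∑ (λ u → ∑ (λ c → x u c * weight u c)) + E)
           (¼≤Y : ∀ i j → ¼ ≤ Y i j)
           (upper : ∀ i j → change M i j ≤ β) (lower : ∀ i j → - β ≤ change M i j)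
           (0≤β : 0ℚ ≤ β) (β≤¼ : β ≤ ¼) (qβ≤¼ : ℕtoℚ q * β ≤ ¼)
           (square : ∀ i j → change M i j * change M i j ≤ β * β * (χ S i + χ S j))
           (drift : ∀ i j → e i j + mean x i j + 4ℚ * ℕtoℚ q * (β * β) * (χ S i + χ S j) ≤ 0ℚ) where

    -- Once every power is linearised by `power-step`, the choice of colours occurs only in a sum of
    -- weights, so `M-good` may replace the actual change by the mean under `x`, at the price `E`.
    -- What remains for each test is `rate` times the left side of `drift`.
    potential-step : ∑ (λ i → ∑ (λ j → (Y i j + change M i j) ^ q)) ≤ ∑ (λ i → ∑ (λ j → Y i j ^ q)) + E
    potential-step = begin
      ∑ (λ i → ∑ (λ j → (Y i j + change M i j) ^ q))
        ≤⟨ ∑∑-mono (λ i j → power-step q (¼≤Y i j) (upper i j) (lower i j) 0≤β β≤¼ qβ≤¼ (square i j)) ⟩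
      ∑ (λ i → ∑ (λ j → Y i j ^ q + rate i j * (change M i j + τ i j)))
        ≡⟨ ∑∑-cong (λ i j → split (Y i j ^ q) (rate i j) (change M i j) (e i j) (τ i j)) ⟩
      ∑ (λ i → ∑ (λ j → (Y i j ^ q + rate i j * (change M i j - e i j)) + rate i j * (e i j + τ i j)))
        ≡⟨ trans (∑∑-+ _ _) (cong (_+ ∑ (λ i → ∑ (λ j → rate i j * (e i j + τ i j)))) (∑∑-+ _ _)) ⟩
      V + ∑ (λ i → ∑ (λ j → rate i j * (change M i j - e i j))) + ∑ (λ i → ∑ (λ j → rate i j * (e i j + τ i j)))
        ≤⟨ +-monoˡ-≤ _ (+-monoʳ-≤ V (subst₂ _≤_ (weight-match M) (cong (_+ E) (weight-mean x)) M-good)) ⟩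
      V + (∑ (λ i → ∑ (λ j → rate i j * mean x i j)) + E) + ∑ (λ i → ∑ (λ j → rate i j * (e i j + τ i j)))
        ≡⟨ join V (∑ (λ i → ∑ (λ j → rate i j * mean x i j))) E _ ⟩
      V + E + (∑ (λ i → ∑ (λ j → rate i j * mean x i j)) + ∑ (λ i → ∑ (λ j → rate i j * (e i j + τ i j))))
        ≡⟨ cong (V + E +_) (sym (∑∑-+ (λ i j → rate i j * mean x i j) (λ i j → rate i j * (e i j + τ i j)))) ⟩
      V + E + ∑ (λ i → ∑ (λ j → rate i j * mean x i j + rate i j * (e i j + τ i j)))
        ≤⟨ +-monoʳ-≤ (V + E) (∑∑-mono (λ i j → ≤-by (gain (rate i j) (mean x i j) (e i j) (τ i j)) (rate≥0 i j ⊠ diff≥0 (drift i j)))) ⟩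
      V + E + ∑ {n} (λ i → ∑ {n} (λ j → 0ℚ))
        ≡⟨ trans (cong (V + E +_) (trans (∑-cong (λ i → ∑-0 n)) (∑-0 n))) (+-identityʳ (V + E)) ⟩
      V + E ∎
      where
      open ≤-Reasoning
      V = ∑ (λ i → ∑ (λ j → Y i j ^ q))
      τ : Fin n → Fin n → ℚ
      τ i j = 4ℚ * ℕtoℚ q * (β * β) * (χ S i + χ S j)
      ∑∑-+ : ∀ (f g : Fin n → Fin n → ℚ) → ∑ (λ i → ∑ (λ j → f i j + g i j)) ≡ ∑ (λ i → ∑ (f i)) + ∑ (λ i → ∑ (g i))
      ∑∑-+ f g = trans (∑-cong (λ i → ∑-+ (f i) (g i))) (∑-+ (λ i → ∑ (f i)) (λ i → ∑ (g i)))
      rate≥0 : ∀ i j → 0ℚ ≤ rate i j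
      rate≥0 i j = ℕtoℚ≥0 q ⊠ ^≥0 q 0≤Y ⊠ inv≥0 0≤Y
        where 0≤Y = ≤-trans (nonNegative⁻¹ ¼) (¼≤Y i j)
      split : ∀ v r c e t → v + r * (c + t) ≡ (v + r * (c - e)) + r * (e + t)
      split = solve-∀ ℚ-ring
      join : ∀ v m E r → v + (m + E) + r ≡ v + E + (m + r)
      join = solve-∀ ℚ-ring
      gain : ∀ r m e t → 0ℚ - (r * m + r * (e + t)) ≡ r * (0ℚ - (e + m + t))
      gain = solve-∀ ℚ-ring

-- The penalty on the zeros of x keeps the assignment inside the support of x.
module Rounding {n K : ℕ} (S : Subset n) (∣S∣<K : ∥ S ∥ ℕ.< K)
                (x w : Fin n → Fin K → ℚ) {ε : ℚ} (0<ε : 0ℚ < ε) where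

  zero? : Fin n → Fin K → ℚ
  zero? u c = ⟦ does (x u c ≟ 0ℚ) ⟧

  -- The costs `w` of two assignments, fractional or not, differ by at most `size + size`. The
  -- penalty exceeds this and the auction's error together by 1, so taking a single zero of `x`
  -- would already refute near-optimality.
  size penalty : ℚ
  size = ∑ (λ u → ∑ (λ c → ∣ w u c ∣))
  penalty = 1ℚ + (size + size + ∑ (χ S) * ε)

  cost : Fin n → Fin K → ℚ
  cost u c = w u c + penalty * zero? u c

  open Auction S ∣S∣<K cost 0<ε public using (match; match-injective)

  private
    s : Fin n → ℚ
    s = χ S

    s≥0 : ∀ u → 0ℚ ≤ s u
    s≥0 u = χ≥0 S u

    s≤1 : ∀ u → s u ≤ 1ℚ
    s≤1 u = χ≤1 S u

    slack≥0 : 0ℚ ≤ ∑ s * ε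
    slack≥0 = ∑≥0 s≥0 ⊠ <⇒≤ 0<ε

    size≥0 : 0ℚ ≤ size
    size≥0 = ∑≥0 (λ u → ∑≥0 (λ c → 0≤∣p∣ (w u c)))

    penalty≥0 : 0ℚ ≤ penalty
    penalty≥0 = 0≤1 ⊞ (size≥0 ⊞ size≥0 ⊞ slack≥0)

    x*zero? : ∀ u c → x u c * zero? u c ≡ 0ℚ
    x*zero? u c with x u c ≟ 0ℚ
    ... | yes x≡0 = trans (cong (_* 1ℚ) x≡0) (*-zeroˡ 1ℚ)
    ... | no _    = *-zeroʳ (x u c)

    scaled≤ : ∀ {a b} → 0ℚ ≤ a → a ≤ 1ℚ → a * b ≤ ∣ b ∣
    scaled≤ {a} {b} 0≤a a≤1 = ≤-trans (*-monoˡ a 0≤a (p≤∣p∣ b))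
      (subst (a * ∣ b ∣ ≤_) (*-identityˡ ∣ b ∣) (*-monoʳ ∣ b ∣ (0≤∣p∣ b) a≤1))

    neg-scaled≤ : ∀ {a b} → 0ℚ ≤ a → a ≤ 1ℚ → - (a * b) ≤ ∣ b ∣
    neg-scaled≤ {a} {b} 0≤a a≤1 = subst₂ _≤_ (sym (neg-distribʳ-* a b)) (∣-p∣≡∣p∣ b) (scaled≤ 0≤a a≤1)

  module _ (x≥0 : ∀ u c → 0ℚ ≤ x u c) (rows : ∀ u → ∑ (x u) ≡ s u)
           (columns : ∀ c → ∑ (λ u → x u c) ≤ 1ℚ) where

    private
      penalties : ℚ
      penalties = ∑ (λ u → s u * (penalty * zero? u (match u)))

      penalties≥0 : ∀ u → 0ℚ ≤ s u * (penalty * zero? u (match u))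
      penalties≥0 u = s≥0 u ⊠ (penalty≥0 ⊠ ⟦ does (x u (match u) ≟ 0ℚ) ⟧≥0)

      -- `x` has no mass on its own zeros and pays no penalty, so the auction's bound holds with the
      -- penalties on the left side only.
      paid : ∑ (λ u → s u * w u (match u)) + penalties ≤ ∑ (λ u → ∑ (λ c → x u c * w u c)) + ∑ s * ε
      paid = subst₂ _≤_
        (trans (∑-cong (λ u → *-distribˡ-+ (s u) (w u (match u)) _)) (∑-+ (λ u → s u * w u (match u)) _))
        (cong (_+ ∑ s * ε) (∑∑-cong (λ u c → begin
          x u c * cost u c                             ≡⟨ lem (x u c) (w u c) penalty (zero? u c) ⟩
          x u c * w u c + penalty * (x u c * zero? u c) ≡⟨ cong (λ z → x u c * w u c + penalty * z) (x*zero? u c) ⟩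
          x u c * w u c + penalty * 0ℚ                 ≡⟨ cong (x u c * w u c +_) (*-zeroʳ penalty) ⟩
          x u c * w u c + 0ℚ                           ≡⟨ +-identityʳ _ ⟩
          x u c * w u c                                ∎)))
        (Auction.match-optimal S ∣S∣<K cost 0<ε x x≥0 rows columns)
        where
        open ≡-Reasoning
        lem : ∀ x w P z → x * (w + P * z) ≡ x * w + P * (x * z)
        lem = solve-∀ ℚ-ring

      x≤1 : ∀ u c → x u c ≤ 1ℚ
      x≤1 u c = ≤-trans (≤-trans (∑-term (x≥0 u) c) (≤-reflexive (rows u))) (s≤1 u)

    match-cost : ∑ (λ u → s u * w u (match u)) ≤ ∑ (λ u → ∑ (λ c → x u c * w u c)) + ∑ s * ε
    match-cost = ≤-trans (≤-by (lem (∑ (λ u → s u * w u (match u))) penalties) (∑≥0 penalties≥0)) paid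
      where lem : ∀ a b → a + b - a ≡ b
            lem = solve-∀ ℚ-ring

    match-support : ∀ {u} → u ∈ S → x u (match u) ≢ 0ℚ
    match-support {u} u∈S x≡0 = contradiction (begin-strict
      penalty                                                        ≡⟨ sym full ⟩
      s u * (penalty * zero? u (match u))                            ≤⟨ ∑-term penalties≥0 u ⟩
      penalties                                                      ≤⟨ ≤-by (lem (∑ (λ u → s u * w u (match u))) penalties (∑ (λ u → ∑ (λ c → x u c * w u c))) (∑ s * ε)) (diff≥0 paid) ⟩
      ∑ (λ u → ∑ (λ c → x u c * w u c)) + (- ∑ (λ u → s u * w u (match u))) + ∑ s * ε
        ≤⟨ +-monoˡ-≤ (∑ s * ε) (+-mono-≤ (∑∑-mono (λ u c → scaled≤ (x≥0 u c) (x≤1 u c))) neg-total) ⟩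
      size + size + ∑ s * ε                                          <⟨ subst (_< 1ℚ + (size + size + ∑ s * ε)) (+-identityˡ (size + size + ∑ s * ε)) (+-monoˡ-< (size + size + ∑ s * ε) (positive⁻¹ 1ℚ)) ⟩
      penalty                                                        ∎) (<-irrefl refl)
      where
      open ≤-Reasoning
      lem : ∀ a p m e → m + - a + e - p ≡ m + e - (a + p)
      lem = solve-∀ ℚ-ring
      full : s u * (penalty * zero? u (match u)) ≡ penalty
      full = trans (cong₂ (λ a b → a * (penalty * b)) (χ-∈ u∈S) (cong ⟦_⟧ (dec-true (x u (match u) ≟ 0ℚ) x≡0)))
                   (trans (*-identityˡ (penalty * 1ℚ)) (*-identityʳ penalty))
      neg-total : - ∑ (λ u → s u * w u (match u)) ≤ size
      neg-total = subst (_≤ size) (∑-neg (λ u → s u * w u (match u)))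
        (∑-mono (λ u → ≤-trans (neg-scaled≤ (s≥0 u) (s≤1 u)) (∑-term (λ c → 0≤∣p∣ (w u c)) (match u))))

-- Fractional colourings

-- y u c is 0 once u has used c, and otherwise the inverse of the probability
-- that c is still unused at u; each y u c is a martingale.
record State (n K : ℕ) : Set where
  field
    y   : Fin n → Fin K → ℚ
    age : Fin n → ℕ

open State

initial : ∀ {n K} → State n K
initial = record { y = λ _ _ → 1ℚ ; age = λ _ → 0 }

module Arrival {n K : ℕ} (p : ℚ) (σ : State n K) (S : Subset n) where

  load : Fin K → ℚ
  load c = p * ∑ (λ u → χ S u * y σ u c)

  opaque
    good : Fin K → ℚ
    good c = ⟦ does (load c ≤? 1ℚ) ⟧

    good-cases : ∀ (A : ℚ → Set) c → (load c ≤ 1ℚ → A 1ℚ) → (¬ (load c ≤ 1ℚ) → A 0ℚ) → A (good c)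
    good-cases A c = indicator A (load c ≤? 1ℚ)

  mass : Fin n → ℚ
  mass u = ∑ (λ c → good c * y σ u c)

  x y° : Fin n → Fin K → ℚ
  x u c = χ S u * (good c * y σ u c * inv (mass u))
  y° u c = y σ u c * inv (1ℚ - x u c)

  update : (Fin n → Fin K) → State n K
  update M = record
    { y   = λ u c → y° u c * (1ℚ - χ S u * δ c (M u))
    ; age = λ u → age σ u ℕ.+ (if lookup S u then 1 else 0) }

ageℚ : ∀ {n K} → State n K → Fin n → ℚ
ageℚ σ u = ℕtoℚ (age σ u)

opaque
  unfolding χ

  ageℚ-update : ∀ {n K} p (σ : State n K) S M u → ageℚ (Arrival.update p σ S M) u ≡ ageℚ σ u + χ S u
  ageℚ-update p σ S M u = trans (ℕtoℚ-+ (age σ u) _) (cong (ageℚ σ u +_) (lem (lookup S u)))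
    where lem : ∀ b → ℕtoℚ (if b then 1 else 0) ≡ ⟦ b ⟧
          lem true  = refl
          lem false = refl

invK : ℕ → ℚ
invK K = inv (ℕtoℚ K)

-- The tests: a diagonal test (i , i) bounds ∑ (y i) from below, an off-diagonal
-- test (i , j) bounds ∑ (y i * y j) from above.
base : Bool → ∀ {n K} → State n K → Fin n → Fin n → ℚ
base true  {K = K} σ i j = 1ℚ + (1ℚ - ∑ (y σ i) * invK K) * ⅛
base false {K = K} σ i j = 1ℚ + (∑ (λ c → y σ i c * y σ j c) * invK K - 1ℚ) * ½

-- The age term is a compensator: it falls only when an edge arrives at row `i` or `j`, and by
-- enough to absorb the second-order error of `power-step`.
test : ∀ {n K} → ℚ → State n K → Fin n → Fin n → ℚ
test τ σ i j = base (does (i Fin.≟ j)) σ i j - τ * (ageℚ σ i + ageℚ σ j)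

-- The change of the tests in one arrival

∑-drop : ∀ {n} (f : Fin n → ℚ) s m → ∑ (λ c → f c * (1ℚ - s * δ c m)) ≡ ∑ f - s * f m
∑-drop f s m = begin
  ∑ (λ c → f c * (1ℚ - s * δ c m))           ≡⟨ ∑-cong (λ c → lem (f c) s (δ c m)) ⟩
  ∑ (λ c → f c - s * (δ c m * f c))          ≡⟨ ∑-- f (λ c → s * (δ c m * f c)) ⟩
  ∑ f - ∑ (λ c → s * (δ c m * f c))          ≡⟨ cong (λ z → ∑ f - z) (trans (∑-*ˡ s (λ c → δ c m * f c)) (cong (s *_) (∑-δ f m))) ⟩
  ∑ f - s * f m                              ∎
  where
  open ≡-Reasoning
  lem : ∀ f s d → f * (1ℚ - s * d) ≡ f - s * (d * f)
  lem = solve-∀ ℚ-ring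

module ArrivalStep {n K : ℕ} (p τ : ℚ) (q : ℕ) (σ : State n K) (S : Subset n) where

  open Arrival p σ S public

  private
    iK : ℚ
    iK = invK K
    s : Fin n → ℚ
    s = χ S

  -- The update is taken in two stages: `y` becomes `y°`, which does not depend on the choice and
  -- gives `shift`; then the entries of the chosen colours are deleted, which gives `d₁ᵇ` and `d₂ᵇ`.
  -- A diagonal test concerns one row, so its deletion is counted in `d₁ᵇ` alone.
  shift : Bool → Fin n → Fin n → ℚ
  shift true  i j = (∑ (y σ i) - ∑ (y° i)) * iK * ⅛
  shift false i j = (∑ (λ c → y° i c * y° j c) - ∑ (λ c → y σ i c * y σ j c)) * iK * ½

  d₁ᵇ d₂ᵇ : Bool → Fin n → Fin n → Fin K → ℚ
  d₁ᵇ true  i j c = y° i c * iK * ⅛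
  d₁ᵇ false i j c = - (y° i c * y° j c) * iK * ½
  d₂ᵇ true  i j c = 0ℚ
  d₂ᵇ false i j c = - (y° i c * y° j c) * iK * ½

  e : Fin n → Fin n → ℚ
  e i j = shift (does (i Fin.≟ j)) i j - τ * (s i + s j)

  d₁ d₂ : Fin n → Fin n → Fin K → ℚ
  d₁ i j = d₁ᵇ (does (i Fin.≟ j)) i j
  d₂ i j = d₂ᵇ (does (i Fin.≟ j)) i j

  open PotentialStep S (test τ σ) e d₁ d₂ q public

  module _ (M : Fin n → Fin K) (M-injective : ∀ {u u′} → u ∈ S → u′ ∈ S → M u ≡ M u′ → u ≡ u′) where

    private
      σ′ : State n K
      σ′ = update M

      -- Distinct rows never lose the same colour, so deleting two entries has no cross term. This
      -- is what makes the change of a pair test a sum of separate contributions of its two rows,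
      -- and hence an assignment problem.
      disjoint : ∀ {i j} → i ≢ j → ∀ c → (s i * δ c (M i)) * (s j * δ c (M j)) ≡ 0ℚ
      disjoint {i} {j} i≢j c = cases (i ∈? S) (j ∈? S) (c Fin.≟ M i) (c Fin.≟ M j)
        where
        a₁ = s i
        a₂ = δ c (M i)
        a₃ = s j
        a₄ = δ c (M j)
        lem₁ : ∀ a b d → 0ℚ * a * (b * d) ≡ 0ℚ
        lem₁ = solve-∀ ℚ-ring
        lem₂ : ∀ a b d → a * 0ℚ * (b * d) ≡ 0ℚ
        lem₂ = solve-∀ ℚ-ring
        lem₃ : ∀ a b d → a * b * (0ℚ * d) ≡ 0ℚ
        lem₃ = solve-∀ ℚ-ring
        lem₄ : ∀ a b d → a * b * (d * 0ℚ) ≡ 0ℚ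
        lem₄ = solve-∀ ℚ-ring
        cases : Dec (i ∈ S) → Dec (j ∈ S) → Dec (c ≡ M i) → Dec (c ≡ M j) → a₁ * a₂ * (a₃ * a₄) ≡ 0ℚ
        cases (no i∉)  _        _         _         = trans (cong (λ z → z * a₂ * (a₃ * a₄)) (χ-∉ i∉)) (lem₁ a₂ a₃ a₄)
        cases (yes _)  (no j∉)  _         _         = trans (cong (λ z → a₁ * a₂ * (z * a₄)) (χ-∉ j∉)) (lem₃ a₁ a₂ a₄)
        cases (yes _)  (yes _)  (no c≢)   _         = trans (cong (λ z → a₁ * z * (a₃ * a₄)) (δ-≢ c≢)) (lem₂ a₁ a₃ a₄)
        cases (yes _)  (yes _)  (yes _)   (no c≢)   = trans (cong (λ z → a₁ * a₂ * (a₃ * z)) (δ-≢ c≢)) (lem₄ a₁ a₂ a₃)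
        cases (yes i∈) (yes j∈) (yes c≡i) (yes c≡j) = contradiction (M-injective i∈ j∈ (trans (sym c≡i) c≡j)) i≢j

      base-update : ∀ b i j → (b ≡ false → i ≢ j) →
        base b σ′ i j ≡ base b σ i j + shift b i j + (s i * d₁ᵇ b i j (M i) + s j * d₂ᵇ b i j (M j))
      base-update true i j _ = trans
        (cong (λ z → 1ℚ + (1ℚ - z * iK) * ⅛) (∑-drop (y° i) (s i) (M i)))
        (lem (∑ (y σ i)) (∑ (y° i)) (s i) (y° i (M i)) iK (s j))
        where lem : ∀ t t° s d k s′ → 1ℚ + (1ℚ - (t° - s * d) * k) * ⅛
                    ≡ 1ℚ + (1ℚ - t * k) * ⅛ + (t - t°) * k * ⅛ + (s * (d * k * ⅛) + s′ * 0ℚ)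
              lem = solve-∀ ℚ-ring
      base-update false i j i≢j = trans
        (cong (λ z → 1ℚ + (z * iK - 1ℚ) * ½) (begin
          ∑ (λ c → y° i c * (1ℚ - s i * δ c (M i)) * (y° j c * (1ℚ - s j * δ c (M j))))
            ≡⟨ ∑-cong (λ c → trans (lem₁ (y° i c) (y° j c) (s i * δ c (M i)) (s j * δ c (M j)))
                 (trans (cong (λ z → f c * (1ℚ - s i * δ c (M i)) + (f c * (1ℚ - s j * δ c (M j)) - f c) + f c * z) (disjoint (i≢j refl) c))
                   (lem₂ (f c * (1ℚ - s i * δ c (M i))) _ (f c)))) ⟩
          ∑ (λ c → f c * (1ℚ - s i * δ c (M i)) + (f c * (1ℚ - s j * δ c (M j)) - f c))
            ≡⟨ trans (∑-+ (λ c → f c * (1ℚ - s i * δ c (M i))) (λ c → f c * (1ℚ - s j * δ c (M j)) - f c))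
                 (cong₂ _+_ (∑-drop f (s i) (M i)) (trans (∑-- (λ c → f c * (1ℚ - s j * δ c (M j))) f) (cong (_- ∑ f) (∑-drop f (s j) (M j))))) ⟩
          ∑ f - s i * f (M i) + (∑ f - s j * f (M j) - ∑ f) ∎))
        (lem (∑ (λ c → y σ i c * y σ j c)) (∑ f) (s i) (f (M i)) iK (s j) (f (M j)))
        where
        open ≡-Reasoning
        f : Fin K → ℚ
        f c = y° i c * y° j c
        lem₁ : ∀ a b r t → a * (1ℚ - r) * (b * (1ℚ - t)) ≡ a * b * (1ℚ - r) + (a * b * (1ℚ - t) - a * b) + a * b * (r * t)
        lem₁ = solve-∀ ℚ-ring
        lem₂ : ∀ a b f → a + b + f * 0ℚ ≡ a + b
        lem₂ = solve-∀ ℚ-ring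
        lem : ∀ t t° s d k s′ d′ → 1ℚ + ((t° - s * d + (t° - s′ * d′ - t°)) * k - 1ℚ) * ½
              ≡ 1ℚ + (t * k - 1ℚ) * ½ + (t° - t) * k * ½ + (s * (- d * k * ½) + s′ * (- d′ * k * ½))
        lem = solve-∀ ℚ-ring

    test-update : ∀ i j → test τ σ′ i j ≡ test τ σ i j + change M i j
    test-update i j = trans
      (cong₂ (λ b a → b - τ * a) (base-update (does (i Fin.≟ j)) i j (λ ≡f i≡j → true≢false (trans (sym (dec-true (i Fin.≟ j) i≡j)) ≡f)))
        (cong₂ _+_ (ageℚ-update p σ S M i) (ageℚ-update p σ S M j)))
      (lem (base (does (i Fin.≟ j)) σ i j) (shift (does (i Fin.≟ j)) i j) (s i * d₁ i j (M i) + s j * d₂ i j (M j)) τ (ageℚ σ i) (ageℚ σ j) (s i) (s j))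
      where true≢false : true ≢ false
            true≢false ()
            lem : ∀ b h d τ a a′ s s′ → b + h + d - τ * (a + s + (a′ + s′)) ≡ b - τ * (a + a′) + (h - τ * (s + s′) + d)
            lem = solve-∀ ℚ-ring

-- Size and mean of the changes in one arrival

module ArrivalBounds {n K : ℕ} (p τ : ℚ) (q : ℕ) (σ : State n K) (S : Subset n)
  (0≤p : 0ℚ ≤ p) (8p≤1 : 8ℚ * p ≤ 1ℚ) (0<K : 0ℚ < ℕtoℚ K) (0≤τ : 0ℚ ≤ τ)
  (y≥0 : ∀ u c → 0ℚ ≤ y σ u c) (y≤4 : ∀ u c → y σ u c ≤ 4ℚ)
  (heavy : ∀ {u} → u ∈ S → 1ℚ ≤ p * Arrival.mass p σ S u) where

  open ArrivalStep p τ q σ S public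

  private
    iK : ℚ
    iK = invK K

    iK≥0 : 0ℚ ≤ iK
    iK≥0 = inv≥0 (<⇒≤ 0<K)

    s : Fin n → ℚ
    s = χ S

    s≥0 : ∀ u → 0ℚ ≤ s u
    s≥0 u = χ≥0 S u

    s≤1 : ∀ u → s u ≤ 1ℚ
    s≤1 u = χ≤1 S u

    good≥0 : ∀ c → 0ℚ ≤ good c
    good≥0 c = good-cases (0ℚ ≤_) c (λ _ → 0≤1) (λ _ → ≤-refl)

    good≤1 : ∀ c → good c ≤ 1ℚ
    good≤1 c = good-cases (_≤ 1ℚ) c (λ _ → ≤-refl) (λ _ → 0≤1)

    mass≥0 : ∀ u → 0ℚ ≤ mass u
    mass≥0 u = ∑≥0 (λ c → good≥0 c ⊠ y≥0 u c)

    mass>0 : ∀ {u} → u ∈ S → 0ℚ < mass u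
    mass>0 {u} u∈S with mass u ≤? 0ℚ
    ... | no m≰0  = ≰⇒> m≰0
    ... | yes m≤0 = contradiction (≤-trans (heavy u∈S) (≤-trans (*-monoˡ p 0≤p m≤0) (≤-reflexive (*-zeroʳ p)))) (<⇒≱ (positive⁻¹ 1ℚ))
      where <⇒≱ : ∀ {a b} → a < b → ¬ (b ≤ a)
            <⇒≱ a<b b≤a = <-irrefl refl (<-≤-trans a<b b≤a)

    inv-mass≤p : ∀ {u} → u ∈ S → inv (mass u) ≤ p
    inv-mass≤p {u} u∈S = subst (_≤ p) (*-identityˡ _) (inv-bound (mass>0 u∈S) (heavy u∈S))

  x-∉ : ∀ {u} → u ∉ S → ∀ c → x u c ≡ 0ℚ
  x-∉ {u} u∉S c = *-zero-by (χ-∉ u∉S) (good c * y σ u c * inv (mass u))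

  x≥0 : ∀ u c → 0ℚ ≤ x u c
  x≥0 u c = s≥0 u ⊠ (good≥0 c ⊠ y≥0 u c ⊠ inv≥0 (mass≥0 u))

  x≤s*good*y*p : ∀ u c → x u c ≤ s u * (good c * y σ u c * p)
  x≤s*good*y*p u c with u ∈? S
  ... | yes u∈S = *-monoˡ (s u) (s≥0 u) (*-monoˡ (good c * y σ u c) (good≥0 c ⊠ y≥0 u c) (inv-mass≤p u∈S))
  ... | no u∉S  = ≤-reflexive (trans (x-∉ u∉S c) (sym (*-zero-by (χ-∉ u∉S) (good c * y σ u c * p))))

  x≤py : ∀ u c → x u c ≤ p * y σ u c
  x≤py u c = ≤-trans (x≤s*good*y*p u c) (≤-by (lem (s u) (good c) (y σ u c) p)
    ((0≤p ⊠ y≥0 u c) ⊠ (diff≥0 (s≤1 u) ⊞ s≥0 u ⊠ diff≥0 (good≤1 c))))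
    where lem : ∀ s g y p → p * y - s * (g * y * p) ≡ p * y * ((1ℚ - s) + s * (1ℚ - g))
          lem = solve-∀ ℚ-ring

  x≤4p : ∀ u c → x u c ≤ 4ℚ * p
  x≤4p u c = ≤-trans (x≤py u c) (subst (p * y σ u c ≤_) (*-comm p 4ℚ) (*-monoˡ p 0≤p (y≤4 u c)))

  rows : ∀ u → ∑ (x u) ≡ s u
  rows u with u ∈? S
  ... | yes u∈S = trans (∑-*ˡ (s u) (λ c → good c * y σ u c * inv (mass u)))
    (trans (cong (s u *_) (trans (∑-*ʳ (inv (mass u)) (λ c → good c * y σ u c)) (*-inv (mass>0 u∈S)))) (*-identityʳ (s u)))
  ... | no u∉S  = trans (∑-cong (x-∉ u∉S)) (trans (∑-0 K) (sym (χ-∉ u∉S)))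

  -- As `inv (mass u)` is at most `p` on `S`, the column sum is at most `good c * load c`: zero for
  -- a bad colour, at most 1 for a good one.
  columns : ∀ c → ∑ (λ u → x u c) ≤ 1ℚ
  columns c = ≤-trans (∑-mono (λ u → x≤s*good*y*p u c))
    (subst (_≤ 1ℚ) (sym (trans (∑-cong (λ u → lem (s u) (good c) (y σ u c) p))
      (trans (∑-*ˡ (good c) (λ u → p * (s u * y σ u c))) (cong (good c *_) (∑-*ˡ p (λ u → s u * y σ u c)))))) bound)
    where
    lem : ∀ s g y p → s * (g * y * p) ≡ g * (p * (s * y))
    lem = solve-∀ ℚ-ring
    bound : good c * load c ≤ 1ℚ
    bound = good-cases (λ g → g * load c ≤ 1ℚ) c
      (λ l≤1 → subst (_≤ 1ℚ) (sym (*-identityˡ (load c))) l≤1)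
      (λ _ → subst (_≤ 1ℚ) (sym (*-zeroˡ (load c))) 0≤1)

  x≤spy : ∀ u c → x u c ≤ s u * (y σ u c * p)
  x≤spy u c = ≤-trans (x≤s*good*y*p u c) (≤-by (lem (s u) (good c) (y σ u c) p) (s≥0 u ⊠ (y≥0 u c ⊠ 0≤p) ⊠ diff≥0 (good≤1 c)))
    where lem : ∀ s g y p → s * (y * p) - s * (g * y * p) ≡ s * (y * p) * (1ℚ - g)
          lem = solve-∀ ℚ-ring

  private
    ½≤1-x : ∀ u c → ½ ≤ 1ℚ - x u c
    ½≤1-x u c = ≤-by (lem (x u c) p) (diff≥0 (x≤4p u c) ⊞ diff≥0 8p≤1 ⊠ nonNegative⁻¹ ½)
      where lem : ∀ x p → 1ℚ - x - ½ ≡ (4ℚ * p - x) + (1ℚ - 8ℚ * p) * ½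
            lem = solve-∀ ℚ-ring

  0<1-x : ∀ u c → 0ℚ < 1ℚ - x u c
  0<1-x u c = <-≤-trans (positive⁻¹ ½) (½≤1-x u c)

  y°-y : ∀ u c → y° u c * (1ℚ - x u c) ≡ y σ u c
  y°-y u c = trans (*-assoc (y σ u c) _ _) (trans (cong (y σ u c *_) (trans (*-comm _ (1ℚ - x u c)) (*-inv (0<1-x u c)))) (*-identityʳ _))

  y°≥0 : ∀ u c → 0ℚ ≤ y° u c
  y°≥0 u c = y≥0 u c ⊠ inv≥0 (<⇒≤ (0<1-x u c))

  y°≤8 : ∀ u c → y° u c ≤ 8ℚ
  y°≤8 u c = inv-bound (0<1-x u c) (≤-trans (y≤4 u c) (*-monoˡ 8ℚ (nonNegative⁻¹ 8ℚ) (½≤1-x u c)))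

  private
    gain : ∀ u c → y° u c - y σ u c ≡ x u c * y° u c
    gain u c = trans (cong (λ z → y° u c - z) (sym (y°-y u c))) (lem (y° u c) (x u c))
      where lem : ∀ a x → a - a * (1ℚ - x) ≡ x * a
            lem = solve-∀ ℚ-ring

    y≤y° : ∀ u c → y σ u c ≤ y° u c
    y≤y° u c = ≤-by (gain u c) (x≥0 u c ⊠ y°≥0 u c)

    gain≤ : ∀ u c → y° u c - y σ u c ≤ ℕtoℚ 32 * p
    gain≤ u c = subst₂ _≤_ (sym (gain u c)) (lem p) (*-mono (x≥0 u c) (nonNegative⁻¹ 8ℚ) (x≤4p u c) (y°≤8 u c))
      where lem : ∀ p → 4ℚ * p * 8ℚ ≡ ℕtoℚ 32 * p
            lem = solve-∀ ℚ-ring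

    y°-∉ : ∀ {u} → u ∉ S → ∀ c → y° u c ≡ y σ u c
    y°-∉ {u} u∉S c = trans (lem₁ (y° u c)) (trans (cong (λ z → y° u c * (1ℚ - z)) (sym (x-∉ u∉S c))) (y°-y u c))
      where lem₁ : ∀ a → a ≡ a * (1ℚ - 0ℚ)
            lem₁ = solve-∀ ℚ-ring

    average≥0 : ∀ (f g : Fin K → ℚ) → (∀ c → f c ≤ g c) → 0ℚ ≤ (∑ g - ∑ f) * iK
    average≥0 f g f≤g = diff≥0 (∑-mono f≤g) ⊠ iK≥0

    average≤ : ∀ (f g : Fin K → ℚ) {b} → (∀ c → g c - f c ≤ b) → (∑ g - ∑ f) * iK ≤ b
    average≤ f g {b} h = inv-bound 0<K (subst₂ _≤_ (∑-- g f) (*-comm (ℕtoℚ K) b) (∑-bound h))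

    pair-mono : ∀ i j c → y σ i c * y σ j c ≤ y° i c * y° j c
    pair-mono i j c = *-mono (y≥0 i c) (y°≥0 j c) (y≤y° i c) (y≤y° j c)

    -- From `a * b - c * d = (a - c) * b + (b - d) * c` with `b ≤ 8`, `c ≤
    -- 4` and both gains at most `32 * p`; 384 is `8 * 32 + 4 * 32`.
    pair-gain : ∀ i j c → y° i c * y° j c - y σ i c * y σ j c ≤ ℕtoℚ 384 * p
    pair-gain i j c = ≤-by (lem (y° i c) (y° j c) (y σ i c) (y σ j c) p)
      ((nonNegative⁻¹ 8ℚ ⊠ diff≥0 (gain≤ i c)) ⊞ (diff≥0 (y≤y° i c) ⊠ diff≥0 (y°≤8 j c)) ⊞ (nonNegative⁻¹ 4ℚ ⊠ diff≥0 (gain≤ j c)) ⊞ (diff≥0 (y≤y° j c) ⊠ diff≥0 (y≤4 i c)))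
      where lem : ∀ a b c d p → ℕtoℚ 384 * p - (a * b - c * d)
                  ≡ 8ℚ * (ℕtoℚ 32 * p - (a - c)) + (a - c) * (8ℚ - b) + 4ℚ * (ℕtoℚ 32 * p - (b - d)) + (b - d) * (4ℚ - c)
            lem = solve-∀ ℚ-ring

    shift≤ : ∀ b i j → shift b i j ≤ ℕtoℚ 192 * p
    shift≤ true i j = ≤-by (lem (∑ (y σ i)) (∑ (y° i)) iK p)
      ((average≥0 (y σ i) (y° i) (y≤y° i) ⊠ nonNegative⁻¹ ⅛) ⊞ (ℕtoℚ≥0 192 ⊠ 0≤p))
      where lem : ∀ t t° k p → ℕtoℚ 192 * p - (t - t°) * k * ⅛ ≡ (t° - t) * k * ⅛ + ℕtoℚ 192 * p
            lem = solve-∀ ℚ-ring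
    shift≤ false i j = ≤-by (lem (∑ (λ c → y σ i c * y σ j c)) (∑ (λ c → y° i c * y° j c)) iK p)
      (diff≥0 (average≤ (λ c → y σ i c * y σ j c) (λ c → y° i c * y° j c) (pair-gain i j)) ⊠ nonNegative⁻¹ ½)
      where lem : ∀ t t° k p → ℕtoℚ 192 * p - (t° - t) * k * ½ ≡ (ℕtoℚ 384 * p - (t° - t) * k) * ½
            lem = solve-∀ ℚ-ring

    ≤shift : ∀ b i j → - (ℕtoℚ 192 * p) ≤ shift b i j
    ≤shift true i j = ≤-by (lem (∑ (y σ i)) (∑ (y° i)) iK p)
      ((diff≥0 (average≤ (y σ i) (y° i) (gain≤ i)) ⊠ nonNegative⁻¹ ⅛) ⊞ (ℕtoℚ≥0 188 ⊠ 0≤p))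
      where lem : ∀ t t° k p → (t - t°) * k * ⅛ - - (ℕtoℚ 192 * p) ≡ (ℕtoℚ 32 * p - (t° - t) * k) * ⅛ + ℕtoℚ 188 * p
            lem = solve-∀ ℚ-ring
    ≤shift false i j = ≤-by (lem (∑ (λ c → y σ i c * y σ j c)) (∑ (λ c → y° i c * y° j c)) iK p)
      ((average≥0 (λ c → y σ i c * y σ j c) (λ c → y° i c * y° j c) (pair-mono i j) ⊠ nonNegative⁻¹ ½) ⊞ (ℕtoℚ≥0 192 ⊠ 0≤p))
      where lem : ∀ t t° k p → (t° - t) * k * ½ - - (ℕtoℚ 192 * p) ≡ (t° - t) * k * ½ + ℕtoℚ 192 * p
            lem = solve-∀ ℚ-ring

    shift-∉ : ∀ b {i j} → i ∉ S → j ∉ S → shift b i j ≡ 0ℚ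
    shift-∉ true {i} i∉ _ = trans (cong (λ z → (∑ (y σ i) - z) * iK * ⅛) (∑-cong (y°-∉ i∉))) (lem (∑ (y σ i)) iK)
      where lem : ∀ a k → (a - a) * k * ⅛ ≡ 0ℚ
            lem = solve-∀ ℚ-ring
    shift-∉ false {i} {j} i∉ j∉ = trans
      (cong (λ z → (z - ∑ (λ c → y σ i c * y σ j c)) * iK * ½) (∑-cong (λ c → cong₂ _*_ (y°-∉ i∉ c) (y°-∉ j∉ c)))) (lem (∑ (λ c → y σ i c * y σ j c)) iK)
      where lem : ∀ a k → (a - a) * k * ½ ≡ 0ℚ
            lem = solve-∀ ℚ-ring

    Small : ℚ → Set
    Small d = - (ℕtoℚ 32 * iK) ≤ d × d ≤ ℕtoℚ 32 * iK

    pair-small : ∀ i j c → Small (- (y° i c * y° j c) * iK * ½)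
    pair-small i j c =
      ≤-by (lem₁ (y° i c) (y° j c) iK) ((nonNegative⁻¹ ½ ⊠ iK≥0) ⊠ (diff≥0 (*-mono (y°≥0 i c) (nonNegative⁻¹ 8ℚ) (y°≤8 i c) (y°≤8 j c)))) ,
      ≤-by (lem₂ (y° i c) (y° j c) iK) ((ℕtoℚ≥0 32 ⊠ iK≥0) ⊞ (y°≥0 i c ⊠ y°≥0 j c) ⊠ iK≥0 ⊠ nonNegative⁻¹ ½)
      where
      lem₁ : ∀ a b k → - (a * b) * k * ½ - - (ℕtoℚ 32 * k) ≡ ½ * k * (8ℚ * 8ℚ - a * b)
      lem₁ = solve-∀ ℚ-ring
      lem₂ : ∀ a b k → ℕtoℚ 32 * k - - (a * b) * k * ½ ≡ ℕtoℚ 32 * k + a * b * k * ½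
      lem₂ = solve-∀ ℚ-ring

    d₁-small : ∀ b i j c → Small (d₁ᵇ b i j c)
    d₁-small true i j c =
      ≤-by (lem₁ (y° i c) iK) ((ℕtoℚ≥0 32 ⊠ iK≥0) ⊞ y°≥0 i c ⊠ iK≥0 ⊠ nonNegative⁻¹ ⅛) ,
      ≤-by (lem₂ (y° i c) iK) ((iK≥0 ⊠ nonNegative⁻¹ ⅛ ⊠ diff≥0 (y°≤8 i c)) ⊞ ℕtoℚ≥0 31 ⊠ iK≥0)
      where
      lem₁ : ∀ a k → a * k * ⅛ - - (ℕtoℚ 32 * k) ≡ ℕtoℚ 32 * k + a * k * ⅛
      lem₁ = solve-∀ ℚ-ring
      lem₂ : ∀ a k → ℕtoℚ 32 * k - a * k * ⅛ ≡ k * ⅛ * (8ℚ - a) + ℕtoℚ 31 * k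
      lem₂ = solve-∀ ℚ-ring
    d₁-small false i j c = pair-small i j c

    d₂-small : ∀ b i j c → Small (d₂ᵇ b i j c)
    d₂-small true i j c = neg-antimono-≤ (ℕtoℚ≥0 32 ⊠ iK≥0) , ℕtoℚ≥0 32 ⊠ iK≥0
    d₂-small false i j c = pair-small i j c

    scaled-small : ∀ u {d} → Small d → Small (s u * d)
    scaled-small u {d} (lo , hi) =
      ≤-by (lem₁ (s u) d (ℕtoℚ 32 * iK)) ((s≥0 u ⊠ diff≥0 lo) ⊞ diff≥0 (s≤1 u) ⊠ (ℕtoℚ≥0 32 ⊠ iK≥0)) ,
      ≤-by (lem₂ (s u) d (ℕtoℚ 32 * iK)) ((s≥0 u ⊠ diff≥0 hi) ⊞ diff≥0 (s≤1 u) ⊠ (ℕtoℚ≥0 32 ⊠ iK≥0))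
      where
      lem₁ : ∀ s d b → s * d - - b ≡ s * (d - - b) + (1ℚ - s) * b
      lem₁ = solve-∀ ℚ-ring
      lem₂ : ∀ s d b → b - s * d ≡ s * (b - d) + (1ℚ - s) * b
      lem₂ = solve-∀ ℚ-ring

  -- The contributions are `192 * p` for `shift`, `32 / K` for each of the two deleted entries, and
  -- `2 * τ` for the ages.
  β : ℚ
  β = ℕtoℚ 192 * p + ℕtoℚ 64 * iK + ℕtoℚ 2 * τ

  β≥0 : 0ℚ ≤ β
  β≥0 = (ℕtoℚ≥0 192 ⊠ 0≤p) ⊞ (ℕtoℚ≥0 64 ⊠ iK≥0) ⊞ (ℕtoℚ≥0 2 ⊠ 0≤τ)

  module _ (M : Fin n → Fin K) where

    private
      small₁ : ∀ i j → Small (s i * d₁ i j (M i))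
      small₁ i j = scaled-small i (d₁-small (does (i Fin.≟ j)) i j (M i))
      small₂ : ∀ i j → Small (s j * d₂ i j (M j))
      small₂ i j = scaled-small j (d₂-small (does (i Fin.≟ j)) i j (M j))

    change≤β : ∀ i j → change M i j ≤ β
    change≤β i j = ≤-by (lem (shift (does (i Fin.≟ j)) i j) τ (s i) (s j) (s i * d₁ i j (M i)) (s j * d₂ i j (M j)) p iK)
      (diff≥0 (shift≤ (does (i Fin.≟ j)) i j) ⊞ diff≥0 (proj₂ (small₁ i j)) ⊞ diff≥0 (proj₂ (small₂ i j)) ⊞ (0≤τ ⊠ (s≥0 i ⊞ s≥0 j)) ⊞ (ℕtoℚ≥0 2 ⊠ 0≤τ))
      where lem : ∀ h τ s s′ d d′ p k → ℕtoℚ 192 * p + ℕtoℚ 64 * k + ℕtoℚ 2 * τ - (h - τ * (s + s′) + (d + d′))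
                  ≡ (ℕtoℚ 192 * p - h) + (ℕtoℚ 32 * k - d) + (ℕtoℚ 32 * k - d′) + τ * (s + s′) + ℕtoℚ 2 * τ
            lem = solve-∀ ℚ-ring

    -β≤change : ∀ i j → - β ≤ change M i j
    -β≤change i j = ≤-by (lem (shift (does (i Fin.≟ j)) i j) τ (s i) (s j) (s i * d₁ i j (M i)) (s j * d₂ i j (M j)) p iK)
      (diff≥0 (≤shift (does (i Fin.≟ j)) i j) ⊞ diff≥0 (proj₁ (small₁ i j)) ⊞ diff≥0 (proj₁ (small₂ i j)) ⊞ (0≤τ ⊠ (diff≥0 (s≤1 i) ⊞ diff≥0 (s≤1 j))))
      where lem : ∀ h τ s s′ d d′ p k → (h - τ * (s + s′) + (d + d′)) - - (ℕtoℚ 192 * p + ℕtoℚ 64 * k + ℕtoℚ 2 * τ)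
                  ≡ (h - - (ℕtoℚ 192 * p)) + (d - - (ℕtoℚ 32 * k)) + (d′ - - (ℕtoℚ 32 * k)) + τ * ((1ℚ - s) + (1ℚ - s′))
            lem = solve-∀ ℚ-ring

    -- A test neither of whose rows lies in `S` does not change at all. The factor `s i + s j` is
    -- the one by which the ages grow, so the second-order error can be charged to them.
    change²≤ : ∀ i j → change M i j * change M i j ≤ β * β * (s i + s j)
    change²≤ i j with i ∈? S | j ∈? S
    ... | yes i∈ | _ = ≤-by (trans (cong (λ z → β * β * (z + s j) - change M i j * change M i j) (χ-∈ i∈)) (lem β (change M i j) (s j)))
      (diff≥0 (change≤β i j) ⊠ diff≥0 (-β≤change i j) ⊞ β≥0 ⊠ β≥0 ⊠ s≥0 j)
      where lem : ∀ b d s → b * b * (1ℚ + s) - d * d ≡ (b - d) * (d - - b) + b * b * s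
            lem = solve-∀ ℚ-ring
    ... | no _ | yes j∈ = ≤-by (trans (cong (λ z → β * β * (s i + z) - change M i j * change M i j) (χ-∈ j∈)) (lem β (change M i j) (s i)))
      (diff≥0 (change≤β i j) ⊠ diff≥0 (-β≤change i j) ⊞ β≥0 ⊠ β≥0 ⊠ s≥0 i)
      where lem : ∀ b d s → b * b * (s + 1ℚ) - d * d ≡ (b - d) * (d - - b) + b * b * s
            lem = solve-∀ ℚ-ring
    ... | no i∉ | no j∉ = subst₂ _≤_ (sym (trans (cong₂ _*_ change≡0 change≡0) (*-zeroˡ 0ℚ)))
      (sym (trans (cong₂ (λ a b → β * β * (a + b)) (χ-∉ i∉) (χ-∉ j∉)) (*-zeroʳ (β * β)))) ≤-refl
      where
      lem : ∀ τ d d′ → 0ℚ - τ * (0ℚ + 0ℚ) + (0ℚ * d + 0ℚ * d′) ≡ 0ℚ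
      lem = solve-∀ ℚ-ring
      change≡0 : change M i j ≡ 0ℚ
      change≡0 = trans (cong₂ (λ h (a , b) → h - τ * (a + b) + (a * d₁ i j (M i) + b * d₂ i j (M j)))
        (shift-∉ (does (i Fin.≟ j)) i∉ j∉) (cong₂ _,_ (χ-∉ i∉) (χ-∉ j∉))) (lem τ (d₁ i j (M i)) (d₂ i j (M j)))

  private
    collect : ∀ (f g u v : Fin K → ℚ) k → (∑ f - ∑ g) * iK * k + (∑ u + ∑ v) ≡ ∑ (λ c → (f c - g c) * iK * k + (u c + v c))
    collect f g u v k = sym (trans (∑-+ (λ c → (f c - g c) * iK * k) (λ c → u c + v c))
      (cong₂ _+_ (trans (∑-*ʳ k (λ c → (f c - g c) * iK)) (cong (_* k) (trans (∑-*ʳ iK (λ c → f c - g c)) (cong (_* iK) (∑-- f g)))))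
        (∑-+ u v)))

    -- The (super)martingale property. Since `y = y° * (1 - x)`, the expected deletion cancels the
    -- shift of a diagonal test exactly. For a pair, distinct colours leave `1 - x - x′` of the
    -- product `y° * y°′`, whereas the old product is the fraction `(1 - x) * (1 - x′)`; the surplus
    -- is `x * x′`.
    meanᵇ : ∀ b i j → shift b i j + (∑ (λ c → x i c * d₁ᵇ b i j c) + ∑ (λ c → x j c * d₂ᵇ b i j c)) ≤ 0ℚ
    meanᵇ true i j = ≤-reflexive (trans (collect (y σ i) (y° i) (λ c → x i c * (y° i c * iK * ⅛)) (λ c → x j c * 0ℚ) ⅛)
      (trans (∑-cong (λ c → trans (cong (λ z → (z - y° i c) * iK * ⅛ + (x i c * (y° i c * iK * ⅛) + x j c * 0ℚ)) (sym (y°-y i c)))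
                                  (lem (y° i c) (x i c) iK (x j c)))) (∑-0 K)))
      where lem : ∀ a x k x′ → (a * (1ℚ - x) - a) * k * ⅛ + (x * (a * k * ⅛) + x′ * 0ℚ) ≡ 0ℚ
            lem = solve-∀ ℚ-ring
    meanᵇ false i j = subst₂ _≤_
      (sym (collect (λ c → y° i c * y° j c) (λ c → y σ i c * y σ j c) (λ c → x i c * (- (y° i c * y° j c) * iK * ½)) (λ c → x j c * (- (y° i c * y° j c) * iK * ½)) ½))
      (∑-0 K) (∑-mono (λ c → ≤-by (trans (cong₂ (λ a b → 0ℚ - ((y° i c * y° j c - a * b) * iK * ½ + (x i c * (- (y° i c * y° j c) * iK * ½) + x j c * (- (y° i c * y° j c) * iK * ½))))
                                                (sym (y°-y i c)) (sym (y°-y j c)))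
                                         (lem (y° i c) (y° j c) (x i c) (x j c) iK))
                                  (y°≥0 i c ⊠ y°≥0 j c ⊠ x≥0 i c ⊠ x≥0 j c ⊠ iK≥0 ⊠ nonNegative⁻¹ ½)))
      where lem : ∀ a b x x′ k → 0ℚ - ((a * b - a * (1ℚ - x) * (b * (1ℚ - x′))) * k * ½ + (x * (- (a * b) * k * ½) + x′ * (- (a * b) * k * ½)))
                  ≡ a * b * x * x′ * k * ½
            lem = solve-∀ ℚ-ring

  drift : 4ℚ * ℕtoℚ q * (β * β) ≤ τ → ∀ i j → e i j + mean x i j + 4ℚ * ℕtoℚ q * (β * β) * (s i + s j) ≤ 0ℚ
  drift ≤τ i j = ≤-by (lem (shift (does (i Fin.≟ j)) i j) τ (s i) (s j) (mean x i j) (4ℚ * ℕtoℚ q * (β * β)))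
    (diff≥0 (meanᵇ (does (i Fin.≟ j)) i j) ⊞ diff≥0 ≤τ ⊠ (s≥0 i ⊞ s≥0 j))
    where lem : ∀ h τ s s′ m t → 0ℚ - (h - τ * (s + s′) + m + t * (s + s′)) ≡ (0ℚ - (h + m)) + (τ - t) * (s + s′)
          lem = solve-∀ ℚ-ring

-- The weight that remains on good colours

module Concentration {n K : ℕ} (p ν : ℚ) (σ : State n K) (S : Subset n)
  (0≤p : 0ℚ ≤ p) (0≤ν : 0ℚ ≤ ν)
  (y≥0 : ∀ u c → 0ℚ ≤ y σ u c) (y≤4 : ∀ u c → y σ u c ≤ 4ℚ)
  (singles : ∀ i → ℕtoℚ K * (1ℚ - ν) ≤ ∑ (y σ i))
  (pairs : ∀ {i j} → i ≢ j → ∑ (λ c → y σ i c * y σ j c) ≤ ℕtoℚ K * (1ℚ + ν))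
  (p∣S∣≤¾ : p * ∑ (χ S) ≤ ℤ.+ 3 / 4)
  (p≤ν : ℕtoℚ 12 * p ≤ (ℤ.+ 5 / 16) * ν)
  where

  open Arrival p σ S

  private
    κ k : ℚ
    κ = ℕtoℚ K
    k = ∑ (χ S)

    s : Fin n → ℚ
    s = χ S

    s≥0 : ∀ u → 0ℚ ≤ s u
    s≥0 = χ≥0 S

    κ≥0 : 0ℚ ≤ κ
    κ≥0 = ℕtoℚ≥0 K

    k≥0 : 0ℚ ≤ k
    k≥0 = ∑≥0 s≥0

    Z : Fin K → ℚ
    Z c = ∑ (λ u → s u * y σ u c)

    G : Fin n → Fin n → ℚ
    G u w = ∑ (λ c → y σ u c * y σ w c)

    ∑Z : ∑ Z ≡ ∑ (λ u → s u * ∑ (y σ u))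
    ∑Z = trans (∑-swap (λ c u → s u * y σ u c)) (∑-cong (λ u → ∑-*ˡ (s u) (y σ u)))

    ∑Z² : ∑ (λ c → Z c * Z c) ≡ ∑ (λ u → ∑ (λ w → s u * s w * G u w))
    ∑Z² = begin
      ∑ (λ c → Z c * Z c)
        ≡⟨ ∑-cong (λ c → trans (sym (∑-*ʳ (Z c) (λ u → s u * y σ u c)))
             (∑-cong (λ u → trans (sym (∑-*ˡ (s u * y σ u c) (λ w → s w * y σ w c)))
               (∑-cong (λ w → lem (s u) (y σ u c) (s w) (y σ w c)))))) ⟩
      ∑ (λ c → ∑ (λ u → ∑ (λ w → s u * s w * (y σ u c * y σ w c))))
        ≡⟨ ∑-swap (λ c u → ∑ (λ w → s u * s w * (y σ u c * y σ w c))) ⟩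
      ∑ (λ u → ∑ (λ c → ∑ (λ w → s u * s w * (y σ u c * y σ w c))))
        ≡⟨ ∑-cong (λ u → trans (∑-swap (λ c w → s u * s w * (y σ u c * y σ w c)))
             (∑-cong (λ w → ∑-*ˡ (s u * s w) (λ c → y σ u c * y σ w c)))) ⟩
      ∑ (λ u → ∑ (λ w → s u * s w * G u w)) ∎
      where
      open ≡-Reasoning
      lem : ∀ s y s′ y′ → s * y * (s′ * y′) ≡ s * s′ * (y * y′)
      lem = solve-∀ ℚ-ring

    -- No test bounds the sum of squares in a single row, so the diagonal gets the crude bound
    -- `4 * 4` per colour. This suffices, as the diagonal contributes to the second moment only
    -- linearly in `k`.
    G≤ : ∀ u w → G u w ≤ κ * (1ℚ + ν) + δ w u * (ℕtoℚ 16 * κ)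
    G≤ u w with w Fin.≟ u
    ... | no w≢u   = subst (G u w ≤_) (sym (trans (cong (κ * (1ℚ + ν) +_) (*-zeroˡ (ℕtoℚ 16 * κ))) (+-identityʳ _))) (pairs (w≢u ∘ sym))
    ... | yes refl = ≤-trans (∑-bound (λ c → *-mono (y≥0 u c) (nonNegative⁻¹ 4ℚ) (y≤4 u c) (y≤4 u c)))
                             (≤-by (lem κ ν) (κ≥0 ⊠ (0≤1 ⊞ 0≤ν)))
      where lem : ∀ κ ν → κ * (1ℚ + ν) + 1ℚ * (ℕtoℚ 16 * κ) - κ * (4ℚ * 4ℚ) ≡ κ * (1ℚ + ν)
            lem = solve-∀ ℚ-ring

    second-moment : ∑ (λ c → Z c * Z c) ≤ k * k * (κ * (1ℚ + ν)) + ℕtoℚ 16 * κ * k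
    second-moment = begin
      ∑ (λ c → Z c * Z c)                    ≡⟨ ∑Z² ⟩
      ∑ (λ u → ∑ (λ w → s u * s w * G u w))  ≤⟨ ∑∑-mono (λ u w → *-monoˡ (s u * s w) (s≥0 u ⊠ s≥0 w) (G≤ u w)) ⟩
      ∑ (λ u → ∑ (λ w → s u * s w * (κ * (1ℚ + ν) + δ w u * (ℕtoℚ 16 * κ))))
        ≡⟨ ∑-cong (λ u → trans (∑-cong (λ w → lem₁ (s u) (s w) (κ * (1ℚ + ν)) (δ w u) (ℕtoℚ 16 * κ)))
             (trans (∑-+ (λ w → s w * (s u * (κ * (1ℚ + ν)))) (λ w → δ w u * (s u * s w * (ℕtoℚ 16 * κ))))
               (cong₂ _+_ (∑-*ʳ (s u * (κ * (1ℚ + ν))) s) (∑-δ (λ w → s u * s w * (ℕtoℚ 16 * κ)) u)))) ⟩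
      ∑ (λ u → k * (s u * (κ * (1ℚ + ν))) + s u * s u * (ℕtoℚ 16 * κ))
        ≤⟨ ∑-mono (λ u → ≤-by (lem₂ (s u) (k * (s u * (κ * (1ℚ + ν)))) (ℕtoℚ 16 * κ)) (s≥0 u ⊠ diff≥0 (χ≤1 S u) ⊠ (ℕtoℚ≥0 16 ⊠ κ≥0))) ⟩
      ∑ (λ u → k * (s u * (κ * (1ℚ + ν))) + s u * (ℕtoℚ 16 * κ))
        ≡⟨ trans (∑-+ (λ u → k * (s u * (κ * (1ℚ + ν)))) (λ u → s u * (ℕtoℚ 16 * κ)))
             (cong₂ _+_ (trans (∑-*ˡ k (λ u → s u * (κ * (1ℚ + ν)))) (cong (k *_) (∑-*ʳ (κ * (1ℚ + ν)) s))) (∑-*ʳ (ℕtoℚ 16 * κ) s)) ⟩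
      k * (k * (κ * (1ℚ + ν))) + k * (ℕtoℚ 16 * κ)
        ≡⟨ lem₃ k (κ * (1ℚ + ν)) (ℕtoℚ 16 * κ) ⟩
      k * k * (κ * (1ℚ + ν)) + ℕtoℚ 16 * κ * k ∎
      where
      open ≤-Reasoning
      lem₁ : ∀ s s′ a d b → s * s′ * (a + d * b) ≡ s′ * (s * a) + d * (s * s′ * b)
      lem₁ = solve-∀ ℚ-ring
      lem₂ : ∀ s a b → a + s * b - (a + s * s * b) ≡ s * (1ℚ - s) * b
      lem₂ = solve-∀ ℚ-ring
      lem₃ : ∀ k a b → k * (k * a) + k * b ≡ k * k * a + b * k
      lem₃ = solve-∀ ℚ-ring

    first-moment : k * (κ * (1ℚ - ν)) ≤ ∑ Z
    first-moment = subst₂ _≤_ (∑-*ʳ (κ * (1ℚ - ν)) s) (sym ∑Z) (∑-mono (λ u → *-monoˡ (s u) (s≥0 u) (singles u)))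

    -- In the expansion the coefficient of `κ * k * k` is `(1 + ν) - 2 * (1 - ν) + 1 = 3 * ν`: the
    -- pairs bound the square from above, the singles bound the mixed term. The part `16 * k` is the
    -- diagonal.
    variance : ∑ (λ c → (Z c - k) * (Z c - k)) ≤ κ * (ℕtoℚ 3 * ν * k * k + ℕtoℚ 16 * k)
    variance = subst (_≤ κ * (ℕtoℚ 3 * ν * k * k + ℕtoℚ 16 * k)) (sym expand)
      (≤-by (lem₂ (∑ (λ c → Z c * Z c)) (∑ Z) k κ ν) (diff≥0 second-moment ⊞ (k≥0 ⊞ k≥0) ⊠ diff≥0 first-moment))
      where
      lem₁ : ∀ z k → (z - k) * (z - k) ≡ z * z + ((- (k + k)) * z + k * k)
      lem₁ = solve-∀ ℚ-ring
      lem₂ : ∀ q z k κ ν → κ * (ℕtoℚ 3 * ν * k * k + ℕtoℚ 16 * k) - (q + ((- (k + k)) * z + κ * (k * k)))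
             ≡ (k * k * (κ * (1ℚ + ν)) + ℕtoℚ 16 * κ * k - q) + (k + k) * (z - k * (κ * (1ℚ - ν)))
      lem₂ = solve-∀ ℚ-ring
      expand : ∑ (λ c → (Z c - k) * (Z c - k)) ≡ ∑ (λ c → Z c * Z c) + ((- (k + k)) * ∑ Z + κ * (k * k))
      expand = trans (∑-cong (λ c → lem₁ (Z c) k))
        (trans (∑-+ (λ c → Z c * Z c) (λ c → (- (k + k)) * Z c + k * k))
          (cong (∑ (λ c → Z c * Z c) +_) (trans (∑-+ (λ c → (- (k + k)) * Z c) (λ _ → k * k))
            (cong₂ _+_ (∑-*ˡ (- (k + k)) Z) (∑-const K (k * k))))))

    -- Chebyshev, colour by colour: a bad colour has `p * Z c > 1` while `p * k ≤ 3/4`, so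
    -- `4 * p * (Z c - k)` exceeds 1.
    lost : ∀ c → 1ℚ - good c ≤ ℕtoℚ 16 * p * p * ((Z c - k) * (Z c - k))
    lost c = good-cases (λ g → 1ℚ - g ≤ ℕtoℚ 16 * p * p * ((Z c - k) * (Z c - k))) c
      (λ _ → ≤-trans (≤-reflexive (+-inverseʳ 1ℚ)) (ℕtoℚ≥0 16 ⊠ 0≤p ⊠ 0≤p ⊠ square≥0 (Z c - k)))
      (λ l≰1 → ≤-by (lem p (Z c) k) (((nonNegative⁻¹ 4ℚ ⊠ excess (≰⇒> l≰1)) ⊞ 0≤1 ⊞ 0≤1) ⊠ (nonNegative⁻¹ 4ℚ ⊠ excess (≰⇒> l≰1))))
      where
      lem : ∀ p z k → ℕtoℚ 16 * p * p * ((z - k) * (z - k)) - (1ℚ - 0ℚ) ≡ (4ℚ * (p * z - p * k - ¼) + 1ℚ + 1ℚ) * (4ℚ * (p * z - p * k - ¼))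
      lem = solve-∀ ℚ-ring
      lem₂ : ∀ a b → a - b - ¼ ≡ (a - 1ℚ) + (ℤ.+ 3 / 4 - b)
      lem₂ = solve-∀ ℚ-ring
      excess : 1ℚ < load c → 0ℚ ≤ p * Z c - p * k - ¼
      excess 1<l = subst (0ℚ ≤_) (sym (lem₂ (p * Z c) (p * k))) (diff≥0 (<⇒≤ 1<l) ⊞ diff≥0 p∣S∣≤¾)

  -- One `ν` is lost in `singles`. The bad colours carry at most 4 each, hence `64 * p * p` times
  -- the variance in total. With `p * k ≤ 3/4` this is at most `64 * κ * (27/16 * ν + 12 * p)`, and
  -- `p≤ν` makes it `128 * κ * ν`.
  mass≥ : ∀ u → κ * (1ℚ - ℕtoℚ 129 * ν) ≤ mass u
  mass≥ u = ≤-by (lem₁ κ ν (mass u) (∑ (y σ u)) W p k)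
    (diff≥0 split ⊞ diff≥0 (singles u) ⊞ ℕtoℚ≥0 64 ⊠ 0≤p ⊠ 0≤p ⊠ diff≥0 variance
      ⊞ ℕtoℚ≥0 64 ⊠ κ≥0 ⊠ ((ℕtoℚ≥0 3 ⊠ 0≤ν ⊠ diff≥0 p∣S∣≤¾ ⊠ (nonNegative⁻¹ (ℤ.+ 3 / 4) ⊞ 0≤p ⊠ k≥0)) ⊞ ℕtoℚ≥0 16 ⊠ 0≤p ⊠ diff≥0 p∣S∣≤¾ ⊞ diff≥0 p≤ν))
    where
    W = ∑ (λ c → (Z c - k) * (Z c - k))
    lem₁ : ∀ κ ν m t W p k → m - κ * (1ℚ - ℕtoℚ 129 * ν)
           ≡ (m - (t - ℕtoℚ 64 * p * p * W)) + (t - κ * (1ℚ - ν)) + ℕtoℚ 64 * p * p * (κ * (ℕtoℚ 3 * ν * k * k + ℕtoℚ 16 * k) - W)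
             + ℕtoℚ 64 * κ * (ℕtoℚ 3 * ν * (ℤ.+ 3 / 4 - p * k) * (ℤ.+ 3 / 4 + p * k) + ℕtoℚ 16 * p * (ℤ.+ 3 / 4 - p * k) + ((ℤ.+ 5 / 16) * ν - ℕtoℚ 12 * p))
    lem₁ = solve-∀ ℚ-ring
    pointwise : ∀ c → y σ u c - ℕtoℚ 64 * p * p * ((Z c - k) * (Z c - k)) ≤ good c * y σ u c
    pointwise c = ≤-by (lem₂ (good c) (y σ u c) p ((Z c - k) * (Z c - k)))
      (nonNegative⁻¹ 4ℚ ⊠ diff≥0 (lost c) ⊞ good≤1 ⊠ diff≥0 (y≤4 u c))
      where
      good≤1 : 0ℚ ≤ 1ℚ - good c
      good≤1 = good-cases (λ g → 0ℚ ≤ 1ℚ - g) c (λ _ → ≤-reflexive (sym (+-inverseʳ 1ℚ))) (λ _ → diff≥0 0≤1)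
      lem₂ : ∀ g y p w → g * y - (y - ℕtoℚ 64 * p * p * w) ≡ 4ℚ * (ℕtoℚ 16 * p * p * w - (1ℚ - g)) + (1ℚ - g) * (4ℚ - y)
      lem₂ = solve-∀ ℚ-ring
    split : ∑ (y σ u) - ℕtoℚ 64 * p * p * W ≤ mass u
    split = subst (_≤ mass u)
      (trans (∑-- (y σ u) (λ c → ℕtoℚ 64 * p * p * ((Z c - k) * (Z c - k)))) (cong (λ z → ∑ (y σ u) - z) (∑-*ˡ (ℕtoℚ 64 * p * p) (λ c → (Z c - k) * (Z c - k)))))
      (∑-mono pointwise)

-- The invariant of a run

potential : ∀ {n K} → ℚ → ℕ → State n K → ℚ
potential τ q σ = ∑ (λ i → ∑ (λ j → test τ σ i j ^ q))

-- All that is asked of the parameters. `16 * η` takes the role of `ν` in `Concentration`, so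
-- `heavy` says that the guaranteed good weight is at least `1 / p`. The repeated sum in the last β
-- conditions is `ArrivalBounds.β`.
record Numerics (n K q : ℕ) (D p τ η ε : ℚ) : Set where
  field
    0≤p   : 0ℚ ≤ p
    8p≤1  : 8ℚ * p ≤ 1ℚ
    pD≤¾  : p * D ≤ ℤ.+ 3 / 4
    0<K   : 0ℚ < ℕtoℚ K
    0≤τ   : 0ℚ ≤ τ
    2τD≤η : τ * (D + D) ≤ η
    η≤¼   : η ≤ ¼
    p≤η   : ℕtoℚ 12 * p ≤ (ℤ.+ 5 / 16) * (ℕtoℚ 16 * η)
    heavy : 1ℚ ≤ p * (ℕtoℚ K * (1ℚ - ℕtoℚ 129 * (ℕtoℚ 16 * η)))
    β≤¼   : ℕtoℚ 192 * p + ℕtoℚ 64 * invK K + ℕtoℚ 2 * τ ≤ ¼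
    qβ≤¼  : ℕtoℚ q * (ℕtoℚ 192 * p + ℕtoℚ 64 * invK K + ℕtoℚ 2 * τ) ≤ ¼
    4qβ²≤τ : 4ℚ * ℕtoℚ q * ((ℕtoℚ 192 * p + ℕtoℚ 64 * invK K + ℕtoℚ 2 * τ) * (ℕtoℚ 192 * p + ℕtoℚ 64 * invK K + ℕtoℚ 2 * τ)) ≤ τ
    growth : ℕtoℚ n * ℕtoℚ n + 1ℚ < (1ℚ + η) ^ q
    n²ε≤1 : ℕtoℚ n * (ℕtoℚ n * ε) ≤ 1ℚ

module Run {n K q : ℕ} {D p τ η ε : ℚ} (0<ε : 0ℚ < ε) (numerics : Numerics n K q D p τ η ε) where

  open Numerics numerics

  -- `cap` is `y ≤ 1 / (1 - p * age)`: an edge of `u` replaces `1 / y` by `(1 - x) / y`, which is at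
  -- least `1 / y - p` because `x ≤ p * y`. In `bound`, all `n * n` tests start at 1 and each
  -- arrival adds the auction's error, ε for each row of its neighbourhood.
  record Invariant (σ : State n K) (t : ℕ) : Set where
    field
      y≥0   : ∀ u c → 0ℚ ≤ y σ u c
      cap   : ∀ u c → y σ u c * (1ℚ - p * ageℚ σ u) ≤ 1ℚ
      bound : potential τ q σ ≤ ℕtoℚ n * ℕtoℚ n + ℕtoℚ t * (ℕtoℚ n * ε)

  private
    iK = invK K

    K*iK : ℕtoℚ K * iK ≡ 1ℚ
    K*iK = *-inv 0<K

    iK≥0 : 0ℚ ≤ iK
    iK≥0 = inv≥0 (<⇒≤ 0<K)

    2ageτ≤η : ∀ {a b} → a ≤ D → b ≤ D → τ * (a + b) ≤ η
    2ageτ≤η a≤D b≤D = ≤-trans (*-monoˡ τ 0≤τ (+-mono-≤ a≤D b≤D)) 2τD≤η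

    η≥0 : 0ℚ ≤ η
    η≥0 = ≤-by (lem η p) (nonNegative⁻¹ (ℤ.+ 1 / 5) ⊠ (diff≥0 p≤η ⊞ ℕtoℚ≥0 12 ⊠ 0≤p))
      where lem : ∀ η p → η - 0ℚ ≡ (ℤ.+ 1 / 5) * (((ℤ.+ 5 / 16) * (ℕtoℚ 16 * η) - ℕtoℚ 12 * p) + ℕtoℚ 12 * p)
            lem = solve-∀ ℚ-ring

  initially : Invariant initial 0
  initially = record
    { y≥0   = λ _ _ → 0≤1
    ; cap   = λ _ _ → ≤-reflexive (lem p)
    ; bound = ≤-reflexive (trans (∑∑-cong (λ i j → trans (cong (_^ q) (test≡1 i j)) (1^ q)))
        (trans (trans (∑-const n (∑ {n} (λ _ → 1ℚ))) (cong (ℕtoℚ n *_) (∑-const n 1ℚ))) (lem₂ (ℕtoℚ n) (ℕtoℚ n * ε)))) }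
    where
    lem : ∀ p → 1ℚ * (1ℚ - p * 0ℚ) ≡ 1ℚ
    lem = solve-∀ ℚ-ring
    lem₂ : ∀ n e → n * (n * 1ℚ) ≡ n * n + 0ℚ * e
    lem₂ = solve-∀ ℚ-ring
    full : ∑ {K} (λ _ → 1ℚ) * iK ≡ 1ℚ
    full = trans (cong (_* iK) (trans (∑-const K 1ℚ) (*-identityʳ (ℕtoℚ K)))) K*iK
    base≡1 : ∀ b i j → base b (initial {n} {K}) i j ≡ 1ℚ
    base≡1 true  i j = cong (λ z → 1ℚ + (1ℚ - z) * ⅛) full
    base≡1 false i j = cong (λ z → 1ℚ + (z - 1ℚ) * ½) (trans (cong (_* iK) (∑-cong {K} (λ _ → *-identityˡ 1ℚ))) full)
    test≡1 : ∀ i j → test τ (initial {n} {K}) i j ≡ 1ℚ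
    test≡1 i j = trans (cong (λ z → z - τ * (0ℚ + 0ℚ)) (base≡1 (does (i Fin.≟ j)) i j)) (lem₃ τ)
      where lem₃ : ∀ τ → 1ℚ - τ * (0ℚ + 0ℚ) ≡ 1ℚ
            lem₃ = solve-∀ ℚ-ring

  module Facts {σ : State n K} {t : ℕ} (inv-σ : Invariant σ t) (t≤n : t ℕ.≤ n)
               (age≤D : ∀ u → ageℚ σ u ≤ D) where

    open Invariant inv-σ public

    y≤4 : ∀ u c → y σ u c ≤ 4ℚ
    y≤4 u c = ≤-by (lem (y σ u c) (ageℚ σ u) p D)
      (nonNegative⁻¹ 4ℚ ⊠ (diff≥0 (cap u c) ⊞ y≥0 u c ⊠ (0≤p ⊠ diff≥0 (age≤D u) ⊞ diff≥0 pD≤¾)))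
      where lem : ∀ y a p D → 4ℚ - y ≡ 4ℚ * ((1ℚ - y * (1ℚ - p * a)) + y * (p * (D - a) + (ℤ.+ 3 / 4 - p * D)))
            lem = solve-∀ ℚ-ring

    private
      mean≤4 : ∀ i → ∑ (y σ i) * iK ≤ 4ℚ
      mean≤4 i = inv-bound 0<K (subst (∑ (y σ i) ≤_) (*-comm (ℕtoℚ K) 4ℚ) (∑-bound (y≤4 i)))

      -- The origin of the factors 1/8 and 1/2 in `base`: a mean weight is at most 4 and a mean
      -- product at least 0, so neither base drops below 1/2. The tests must stay away from 0
      -- because `power-step` divides by them.
      ½≤base : ∀ b i j → ½ ≤ base b σ i j
      ½≤base true i j = ≤-by (lem (∑ (y σ i) * iK)) (nonNegative⁻¹ ⅛ ⊠ diff≥0 (mean≤4 i) ⊞ nonNegative⁻¹ ⅛)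
        where lem : ∀ m → 1ℚ + (1ℚ - m) * ⅛ - ½ ≡ ⅛ * (4ℚ - m) + ⅛
              lem = solve-∀ ℚ-ring
      ½≤base false i j = ≤-by (lem (∑ (λ c → y σ i c * y σ j c) * iK)) (∑≥0 (λ c → y≥0 i c ⊠ y≥0 j c) ⊠ iK≥0 ⊠ nonNegative⁻¹ ½)
        where lem : ∀ m → 1ℚ + (m - 1ℚ) * ½ - ½ ≡ m * ½
              lem = solve-∀ ℚ-ring

    ¼≤test : ∀ i j → ¼ ≤ test τ σ i j
    ¼≤test i j = ≤-by (lem (base (does (i Fin.≟ j)) σ i j) (τ * (ageℚ σ i + ageℚ σ j)) η)
      (diff≥0 (½≤base (does (i Fin.≟ j)) i j) ⊞ diff≥0 (2ageτ≤η (age≤D i) (age≤D j)) ⊞ diff≥0 η≤¼)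
      where lem : ∀ b t η → b - t - ¼ ≡ (b - ½) + (η - t) + (¼ - η)
            lem = solve-∀ ℚ-ring

    private
      power<growth : ∀ i j → test τ σ i j ^ q < (1ℚ + η) ^ q
      power<growth i j = begin-strict
        test τ σ i j ^ q                         ≤⟨ ∑-term (λ j → V≥0 i j) j ⟩
        ∑ (λ j → test τ σ i j ^ q)               ≤⟨ ∑-term (λ i → ∑≥0 (V≥0 i)) i ⟩
        potential τ q σ                          ≤⟨ bound ⟩
        ℕtoℚ n * ℕtoℚ n + ℕtoℚ t * (ℕtoℚ n * ε)  ≤⟨ +-monoʳ-≤ (ℕtoℚ n * ℕtoℚ n) (≤-trans (*-monoʳ (ℕtoℚ n * ε) (ℕtoℚ≥0 n ⊠ <⇒≤ 0<ε) (ℕtoℚ-mono t≤n)) n²ε≤1) ⟩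
        ℕtoℚ n * ℕtoℚ n + 1ℚ                     <⟨ growth ⟩
        (1ℚ + η) ^ q                             ∎
        where
        open ≤-Reasoning
        V≥0 : ∀ i j → 0ℚ ≤ test τ σ i j ^ q
        V≥0 i j = ^≥0 q (≤-trans (nonNegative⁻¹ ¼) (¼≤test i j))

      test≤1+η : ∀ i j → test τ σ i j ≤ 1ℚ + η
      test≤1+η i j with test τ σ i j ≤? 1ℚ + η
      ... | yes ≤1+η = ≤1+η
      ... | no ≰1+η  = contradiction (<-≤-trans (power<growth i j) (^-mono q (0≤1 ⊞ η≥0) (<⇒≤ (≰⇒> ≰1+η)))) (<-irrefl refl)

      base≤ : ∀ i j → base (does (i Fin.≟ j)) σ i j ≤ 1ℚ + η + η
      base≤ i j = ≤-by (lem (base (does (i Fin.≟ j)) σ i j) (τ * (ageℚ σ i + ageℚ σ j)) η)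
        (diff≥0 (test≤1+η i j) ⊞ diff≥0 (2ageτ≤η (age≤D i) (age≤D j)))
        where lem : ∀ b t η → 1ℚ + η + η - b ≡ (1ℚ + η - (b - t)) + (η - t)
              lem = solve-∀ ℚ-ring

    -- Undoing the age term leaves a base of at most `1 + 2 * η`, and the factor 1/8 magnifies the
    -- excess to `16 * η`. For `pairs` the factor 1/2 gives `4 * η`, weakened to the same `16 * η`.
    singles : ∀ i → ℕtoℚ K * (1ℚ - ℕtoℚ 16 * η) ≤ ∑ (y σ i)
    singles i = ≤-by
      (trans (cong (λ z → z - ℕtoℚ K * (1ℚ - ℕtoℚ 16 * η)) (trans (sym (*-identityʳ (∑ (y σ i)))) (cong (∑ (y σ i) *_) (sym K*iK)))) (lem (∑ (y σ i)) (ℕtoℚ K) iK η))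
      (ℕtoℚ≥0 8 ⊠ ℕtoℚ≥0 K ⊠ diff≥0 (subst (λ b → base b σ i i ≤ 1ℚ + η + η) (dec-true (i Fin.≟ i) refl) (base≤ i i)))
      where
      lem : ∀ T κ k η → T * (κ * k) - κ * (1ℚ - ℕtoℚ 16 * η) ≡ ℕtoℚ 8 * κ * (1ℚ + η + η - (1ℚ + (1ℚ - T * k) * ⅛))
      lem = solve-∀ ℚ-ring

    pairs : ∀ {i j} → i ≢ j → ∑ (λ c → y σ i c * y σ j c) ≤ ℕtoℚ K * (1ℚ + ℕtoℚ 16 * η)
    pairs {i} {j} i≢j = ≤-by
      (trans (cong (λ z → ℕtoℚ K * (1ℚ + ℕtoℚ 16 * η) - z) (trans (sym (*-identityʳ G)) (cong (G *_) (sym K*iK)))) (lem G (ℕtoℚ K) iK η))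
      ((ℕtoℚ≥0 2 ⊠ ℕtoℚ≥0 K ⊠ diff≥0 (subst (λ b → base b σ i j ≤ 1ℚ + η + η) (dec-false (i Fin.≟ j) i≢j) (base≤ i j)))
        ⊞ ℕtoℚ≥0 12 ⊠ ℕtoℚ≥0 K ⊠ η≥0)
      where
      G = ∑ (λ c → y σ i c * y σ j c)
      lem : ∀ G κ k η → κ * (1ℚ + ℕtoℚ 16 * η) - G * (κ * k) ≡ ℕtoℚ 2 * κ * (1ℚ + η + η - (1ℚ + (G * k - 1ℚ) * ½)) + ℕtoℚ 12 * κ * η
      lem = solve-∀ ℚ-ring

  module Step {σ : State n K} {t : ℕ} (inv-σ : Invariant σ t) (t≤n : t ℕ.≤ n) (S : Subset n)
              (age≤D : ∀ u → ageℚ σ u + χ S u ≤ D) (∣S∣≤D : ∑ (χ S) ≤ D) (∣S∣<K : ∥ S ∥ ℕ.< K) where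

    private
      age≤ : ∀ u → ageℚ σ u ≤ D
      age≤ u = ≤-trans (≤-by (lem (ageℚ σ u) (χ S u)) (χ≥0 S u)) (age≤D u)
        where lem : ∀ a s → a + s - a ≡ s
              lem = solve-∀ ℚ-ring

      open Facts inv-σ t≤n age≤
      open ArrivalBounds p τ q σ S 0≤p 8p≤1 0<K 0≤τ y≥0 y≤4
        (λ {u} _ → ≤-trans heavy (*-monoˡ p 0≤p (Concentration.mass≥ p (ℕtoℚ 16 * η) σ S 0≤p (ℕtoℚ≥0 16 ⊠ η≥0) y≥0 y≤4 singles pairs
          (≤-trans (*-monoˡ p 0≤p ∣S∣≤D) pD≤¾) p≤η u)))

    open Rounding S ∣S∣<K x weight 0<ε using (match; match-injective; match-cost; match-support)

    chosen-positive : ∀ {u} → u ∈ S → 0ℚ < y σ u (match u)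
    chosen-positive {u} u∈S = ≤∧≢⇒< (y≥0 u (match u)) λ 0≡y → match-support x≥0 rows columns u∈S
      (trans (cong (λ z → χ S u * (good (match u) * z * inv (mass u))) (sym 0≡y)) (lem (χ S u) (good (match u)) (inv (mass u))))
      where lem : ∀ s g i → s * (g * 0ℚ * i) ≡ 0ℚ
            lem = solve-∀ ℚ-ring

    next : Invariant (update match) (suc t)
    next = record { y≥0 = λ u c → y°≥0 u c ⊠ keep≥0 u c ; cap = cap′ ; bound = bound′ }
      where
      δ≤1 : ∀ {m} (i j : Fin m) → δ i j ≤ 1ℚ
      δ≤1 i j = ⟦ does (i Fin.≟ j) ⟧≤1
      δ≥0 : ∀ {m} (i j : Fin m) → 0ℚ ≤ δ i j
      δ≥0 i j = ⟦ does (i Fin.≟ j) ⟧≥0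
      keep≥0 : ∀ u c → 0ℚ ≤ 1ℚ - χ S u * δ c (match u)
      keep≥0 u c = subst (0ℚ ≤_) (lem (χ S u) (δ c (match u))) (diff≥0 (χ≤1 S u) ⊞ χ≥0 S u ⊠ diff≥0 (δ≤1 c (match u)))
        where lem : ∀ s d → (1ℚ - s) + s * (1ℚ - d) ≡ 1ℚ - s * d
              lem = solve-∀ ℚ-ring
      cap′ : ∀ u c → y° u c * (1ℚ - χ S u * δ c (match u)) * (1ℚ - p * ageℚ (update match) u) ≤ 1ℚ
      cap′ u c = subst (λ a → y° u c * (1ℚ - χ S u * δ c (match u)) * (1ℚ - p * a) ≤ 1ℚ) (sym (ageℚ-update p σ S match u))
        (≤-trans (≤-by (lem₁ (y° u c) (χ S u * δ c (match u)) (1ℚ - p * (ageℚ σ u + χ S u))) (y°≥0 u c ⊠ (χ≥0 S u ⊠ δ≥0 c (match u)) ⊠ room))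
          (subst (_≤ 1ℚ) (lem₂ (y σ u c) (inv (1ℚ - x u c)) (1ℚ - p * (ageℚ σ u + χ S u)))
            (inv-bound {1ℚ - x u c} {y σ u c * (1ℚ - p * (ageℚ σ u + χ S u))} {1ℚ} (0<1-x u c)
              (≤-by (lem₃ (y σ u c) p (ageℚ σ u) (χ S u) (x u c)) (diff≥0 (cap u c) ⊞ diff≥0 (x≤spy u c))))))
        where
        lem₁ : ∀ a r m → a * m - a * (1ℚ - r) * m ≡ a * r * m
        lem₁ = solve-∀ ℚ-ring
        lem₂ : ∀ y i m → y * m * i ≡ y * i * m
        lem₂ = solve-∀ ℚ-ring
        lem₃ : ∀ y p a s x → 1ℚ * (1ℚ - x) - y * (1ℚ - p * (a + s)) ≡ (1ℚ - y * (1ℚ - p * a)) + (s * (y * p) - x)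
        lem₃ = solve-∀ ℚ-ring
        room : 0ℚ ≤ 1ℚ - p * (ageℚ σ u + χ S u)
        room = diff≥0 (≤-trans (*-monoˡ p 0≤p (age≤D u)) (≤-trans pD≤¾ (≤-by refl (nonNegative⁻¹ ¼))))
      bound′ : potential τ q (update match) ≤ ℕtoℚ n * ℕtoℚ n + ℕtoℚ (suc t) * (ℕtoℚ n * ε)
      bound′ = begin
        potential τ q (update match)
          ≡⟨ ∑∑-cong (λ i j → cong (_^ q) (test-update match match-injective i j)) ⟩
        ∑ (λ i → ∑ (λ j → (test τ σ i j + change match i j) ^ q))
          ≤⟨ potential-step x match (match-cost x≥0 rows columns) ¼≤test (change≤β match) (-β≤change match) β≥0 β≤¼ qβ≤¼ (change²≤ match) (drift 4qβ²≤τ) ⟩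
        potential τ q σ + ∑ (χ S) * ε
          ≤⟨ +-mono-≤ bound (*-monoʳ ε (<⇒≤ 0<ε) (subst (∑ (χ S) ≤_) (*-identityʳ (ℕtoℚ n)) (∑-bound (χ≤1 S)))) ⟩
        ℕtoℚ n * ℕtoℚ n + ℕtoℚ t * (ℕtoℚ n * ε) + ℕtoℚ n * ε
          ≡⟨ lem (ℕtoℚ n * ℕtoℚ n) (ℕtoℚ t) (ℕtoℚ n * ε) ⟩
        ℕtoℚ n * ℕtoℚ n + (1ℚ + ℕtoℚ t) * (ℕtoℚ n * ε)
          ≡⟨ cong (λ z → ℕtoℚ n * ℕtoℚ n + z * (ℕtoℚ n * ε)) (sym (ℕtoℚ-suc t)) ⟩
        ℕtoℚ n * ℕtoℚ n + ℕtoℚ (suc t) * (ℕtoℚ n * ε) ∎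
        where
        open ≤-Reasoning
        lem : ∀ a t e → a + t * e + e ≡ a + (1ℚ + t) * e
        lem = solve-∀ ℚ-ring

-- The algorithm

∑χ : ∀ {n} (S : Subset n) → ∑ (χ S) ≡ ℕtoℚ ∥ S ∥
∑χ S = lem S
  where
  opaque
    unfolding ∑ χ
    lem : ∀ {n} (S : Subset n) → ∑ (χ S) ≡ ℕtoℚ ∥ S ∥
    lem []          = refl
    lem (true  ∷ S) = trans (cong (1ℚ +_) (lem S)) (sym (ℕtoℚ-suc ∥ S ∥))
    lem (false ∷ S) = trans (+-identityˡ _) (lem S)

module Algorithm (n K q : ℕ) (p τ : ℚ) {ε : ℚ} (0<ε : 0ℚ < ε) where

  -- The decision is an argument so that `decide-yes` can exchange it for a given proof. The auction
  -- needs more colours than rows, hence `nothing` otherwise.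
  choose : State n K → (S : Subset n) → Dec (∥ S ∥ ℕ.< K) → Maybe (Fin n → Fin K)
  choose σ S (yes ∣S∣<K) = just (Rounding.match S ∣S∣<K (Arrival.x p σ S) (ArrivalStep.weight p τ q σ S) 0<ε)
  choose σ S (no _)      = nothing

  decide : State n K → (S : Subset n) → Maybe (Fin n → Fin K)
  decide σ S = choose σ S (∥ S ∥ ℕ.<? K)

  advance : State n K → Subset n → State n K
  advance σ S = maybe′ (Arrival.update p σ S) σ (decide σ S)

  -- Colours K, K + 1, … are spares, one per edge; they keep the colouring proper
  -- when the invariant fails (which happens only for small Δ).
  paint : State n K → Maybe (Fin n → Fin K) → ℕ → Fin n → ℕ
  paint σ nothing  spare u = K ℕ.+ spare
  paint σ (just M) spare u = pick (0ℚ <? y σ u (M u))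
    where pick : Dec (0ℚ < y σ u (M u)) → ℕ
          pick (yes _) = Fin.toℕ (M u)
          pick (no _)  = K ℕ.+ spare

  after : State n K → List (Subset n) → State n K
  after = foldl advance

  -- An `OnlineAlg` keeps no state, so the run is replayed from the history. The length of the
  -- history is the arrival time `t`, and `t * n + u` numbers the edge. Edges that share an endpoint
  -- agree in `t` or in `u`, so cancellation suffices to tell their spares apart.
  respond : List (Subset n) → Subset n → Fin n → ℕ
  respond history S u = paint (after initial history) (decide (after initial history) S) (length history ℕ.* n ℕ.+ Fin.toℕ u) u

  data Painted (σ : State n K) (S : Subset n) (spare : ℕ) (u : Fin n) (c : ℕ) : Set where
    main  : ∀ M → decide σ S ≡ just M → 0ℚ < y σ u (M u) → c ≡ Fin.toℕ (M u) → Painted σ S spare u c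
    extra : c ≡ K ℕ.+ spare → Painted σ S spare u c

  painted : ∀ σ S spare u → Painted σ S spare u (paint σ (decide σ S) spare u)
  painted σ S spare u with decide σ S in eq
  ... | nothing = extra refl
  ... | just M with 0ℚ <? y σ u (M u)
  ...   | yes 0<y = main M eq 0<y refl
  ...   | no _    = extra refl

  decide-injective : ∀ σ S {M} → decide σ S ≡ just M → ∀ {u u′} → u ∈ S → u′ ∈ S → M u ≡ M u′ → u ≡ u′
  decide-injective σ S eq with ∥ S ∥ ℕ.<? K
  decide-injective σ S refl | yes ∣S∣<K = Rounding.match-injective S ∣S∣<K (Arrival.x p σ S) (ArrivalStep.weight p τ q σ S) 0<ε

  advance-just : ∀ σ S {M} → decide σ S ≡ just M → advance σ S ≡ Arrival.update p σ S M
  advance-just σ S eq = cong (maybe′ (Arrival.update p σ S) σ) eq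

  advance-zero : ∀ σ S {u c} → y σ u c ≡ 0ℚ → y (advance σ S) u c ≡ 0ℚ
  advance-zero σ S {u} {c} y≡0 with decide σ S
  ... | nothing = y≡0
  ... | just M  = *-zero-by (*-zero-by y≡0 (inv (1ℚ - Arrival.x p σ S u c))) (1ℚ - χ S u * δ c (M u))

  after-zero : ∀ σ history {u c} → y σ u c ≡ 0ℚ → y (after σ history) u c ≡ 0ℚ
  after-zero σ []            y≡0 = y≡0
  after-zero σ (S ∷ history) {u} {c} y≡0 = after-zero (advance σ S) history (advance-zero σ S {u} {c} y≡0)

  advance-used : ∀ σ S {M u} → decide σ S ≡ just M → u ∈ S → y (advance σ S) u (M u) ≡ 0ℚ
  advance-used σ S {M} {u} eq u∈S = trans (cong (λ ρ → y ρ u (M u)) (advance-just σ S eq))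
    (trans (cong₂ (λ a b → Arrival.y° p σ S u (M u) * (1ℚ - a * b)) (χ-∈ u∈S) (δ-refl (M u))) (*-zeroʳ (Arrival.y° p σ S u (M u))))

  decide-yes : ∀ σ S (∣S∣<K : ∥ S ∥ ℕ.< K) → decide σ S ≡ choose σ S (yes ∣S∣<K)
  decide-yes σ S ∣S∣<K = choose-yes (∥ S ∥ ℕ.<? K)
    where
    choose-yes : ∀ d → choose σ S d ≡ choose σ S (yes ∣S∣<K)
    choose-yes (yes lt) = cong (λ z → choose σ S (yes z)) (ℕₚ.<-irrelevant lt ∣S∣<K)
    choose-yes (no ≮K)  = contradiction ∣S∣<K ≮K

  paint-main : ∀ σ {m M u} spare → m ≡ just M → 0ℚ < y σ u (M u) → paint σ m spare u ≡ Fin.toℕ (M u)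
  paint-main σ {M = M} {u} spare refl 0<y with 0ℚ <? y σ u (M u)
  ... | yes _  = refl
  ... | no 0≮y = contradiction 0<y 0≮y

  before : ∀ {m} → Vec (Subset n) m → State n K → Fin m → State n K
  before G σ t = after σ (take (Fin.toℕ t) (toList G))

  -- The weight becomes 0 when the colour is assigned (`advance-used`), and later updates only
  -- multiply it (`after-zero`). Properness rests on this alone, whether or not the invariant holds.
  used-before : ∀ {m} (G : Vec (Subset n) m) σ {t t′ M u} → Fin.toℕ t ℕ.< Fin.toℕ t′ → u ∈ lookup G t →
                decide (before G σ t) (lookup G t) ≡ just M → y (before G σ t′) u (M u) ≡ 0ℚ
  used-before (S ∷ G) σ {zero}  {suc t′} {M} {u} _ u∈S eq = after-zero (advance σ S) (take (Fin.toℕ t′) (toList G)) {u} {M u} (advance-used σ S eq u∈S)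
  used-before (S ∷ G) σ {suc t} {suc t′} (ℕ.s≤s t<t′) u∈S eq = used-before G (advance σ S) {t} {t′} t<t′ u∈S eq

  before-suc : ∀ {m} (G : Vec (Subset n) m) σ (t : Fin m) →
               after σ (take (suc (Fin.toℕ t)) (toList G)) ≡ advance (before G σ t) (lookup G t)
  before-suc (S ∷ G) σ zero    = refl
  before-suc (S ∷ G) σ (suc t) = before-suc G (advance σ S) t

  length-before : ∀ {m} (G : Vec (Subset n) m) (t : Fin m) → length (take (Fin.toℕ t) (toList G)) ≡ Fin.toℕ t
  length-before (S ∷ G) zero    = refl
  length-before (S ∷ G) (suc t) = cong suc (length-before G t)

  one : Bool → ℕ
  one b = if b then 1 else 0

  age-advance : ∀ σ S u → age (advance σ S) u ℕ.≤ age σ u ℕ.+ one (lookup S u)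
  age-advance σ S u with decide σ S
  ... | nothing = ℕₚ.m≤m+n _ _
  ... | just M  = ℕₚ.≤-refl

  ∥∷∥ : ∀ {m} b (S : Subset m) → ∥ b ∷ S ∥ ≡ one b ℕ.+ ∥ S ∥
  ∥∷∥ true  S = refl
  ∥∷∥ false S = refl

  -- The current edge is counted on the left because `Step` needs the degree bound for the ages
  -- after the update.
  age-before : ∀ {m} (G : Vec (Subset n) m) σ t u →
               age (before G σ t) u ℕ.+ one (lookup (lookup G t) u) ℕ.≤ age σ u ℕ.+ ∥ tabulate (λ t → lookup (lookup G t) u) ∥
  age-before (S ∷ G) σ zero u = ℕₚ.+-monoʳ-≤ (age σ u)
    (subst (one (lookup S u) ℕ.≤_) (sym (∥∷∥ (lookup S u) (tabulate (λ t → lookup (lookup G t) u)))) (ℕₚ.m≤m+n _ _))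
  age-before (S ∷ G) σ (suc t) u = begin
    age (before G (advance σ S) t) u ℕ.+ one (lookup (lookup G t) u)  ≤⟨ age-before G (advance σ S) t u ⟩
    age (advance σ S) u ℕ.+ rest                                      ≤⟨ ℕₚ.+-monoˡ-≤ rest (age-advance σ S u) ⟩
    age σ u ℕ.+ one (lookup S u) ℕ.+ rest                             ≡⟨ ℕₚ.+-assoc (age σ u) _ rest ⟩
    age σ u ℕ.+ (one (lookup S u) ℕ.+ rest)                           ≡⟨ cong (age σ u ℕ.+_) (sym (∥∷∥ (lookup S u) (tabulate (λ t → lookup (lookup G t) u)))) ⟩
    age σ u ℕ.+ ∥ lookup S u ∷ tabulate (λ t → lookup (lookup G t) u) ∥ ∎
    where
    open ℕₚ.≤-Reasoning
    rest = ∥ tabulate (λ t → lookup (lookup G t) u) ∥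

  -- Properness and the palette bound for a given graph

  module _ (G : Graph n) where

    colouring : Fin n → Fin n → ℕ
    colouring t u = respond (take (Fin.toℕ t) (toList G)) (lookup G t) u

    σₜ : Fin n → State n K
    σₜ = before G initial

    spare : Fin n → Fin n → ℕ
    spare t u = length (take (Fin.toℕ t) (toList G)) ℕ.* n ℕ.+ Fin.toℕ u

    view : ∀ t u → Painted (σₜ t) (lookup G t) (spare t u) u (colouring t u)
    view t u = painted (σₜ t) (lookup G t) (spare t u) u

    private
      main≢extra : ∀ {c c′ s} (k : Fin K) → c ≡ Fin.toℕ k → c′ ≡ K ℕ.+ s → c ≢ c′
      main≢extra {s = s} k refl refl eq = ℕₚ.<⇒≱ (Finₚ.toℕ<n k) (subst (K ℕ.≤_) (sym eq) (ℕₚ.m≤m+n K s))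

      spare-injective : ∀ {t t′ u u′} → K ℕ.+ spare t u ≡ K ℕ.+ spare t′ u′ → Fin.toℕ t ℕ.* n ℕ.+ Fin.toℕ u ≡ Fin.toℕ t′ ℕ.* n ℕ.+ Fin.toℕ u′
      spare-injective {t} {t′} {u} {u′} eq = subst₂ (λ a b → a ℕ.* n ℕ.+ Fin.toℕ u ≡ b ℕ.* n ℕ.+ Fin.toℕ u′)
        (length-before G t) (length-before G t′) (ℕₚ.+-cancelˡ-≡ K _ _ eq)

      proper-online : ∀ t u u′ → u ∈ lookup G t → u′ ∈ lookup G t → u ≢ u′ → colouring t u ≢ colouring t u′
      proper-online t u u′ u∈ u′∈ u≢u′ c≡c′ with view t u | view t u′
      ... | main M eq _ c≡ | main M′ eq′ _ c′≡ = u≢u′ (decide-injective (σₜ t) (lookup G t) eq u∈ u′∈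
              (Finₚ.toℕ-injective (trans (sym c≡) (trans c≡c′ (trans c′≡ (cong (λ f → Fin.toℕ (f u′)) (just-injective (trans (sym eq′) eq))))))))
      ... | main M _ _ c≡ | extra c′≡      = main≢extra (M u) c≡ c′≡ c≡c′
      ... | extra c≡      | main M _ _ c′≡ = main≢extra (M u′) c′≡ c≡ (sym c≡c′)
      ... | extra c≡      | extra c′≡      = u≢u′ (Finₚ.toℕ-injective (ℕₚ.+-cancelˡ-≡ (Fin.toℕ t ℕ.* n) _ _
              (spare-injective {t} {t} {u} {u′} (trans (sym c≡) (trans c≡c′ c′≡)))))

      proper-< : ∀ t t′ u → Fin.toℕ t ℕ.< Fin.toℕ t′ → u ∈ lookup G t → u ∈ lookup G t′ → colouring t u ≢ colouring t′ u
      proper-< t t′ u t<t′ u∈ u∈′ c≡c′ with view t u | view t′ u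
      ... | main M eq _ c≡ | main M′ _ 0<y c′≡ = <-irrefl refl (subst (0ℚ <_)
              (trans (cong (y (σₜ t′) u) (Finₚ.toℕ-injective (trans (sym c′≡) (trans (sym c≡c′) c≡)))) (used-before G initial {t} {t′} {M} {u} t<t′ u∈ eq)) 0<y)
      ... | main M _ _ c≡ | extra c′≡      = main≢extra (M u) c≡ c′≡ c≡c′
      ... | extra c≡      | main M _ _ c′≡ = main≢extra (M u) c′≡ c≡ (sym c≡c′)
      ... | extra c≡      | extra c′≡      = ℕₚ.<⇒≢ t<t′ (ℕₚ.*-cancelʳ-≡ _ _ n {{Finₚ.nonZeroIndex u}} (ℕₚ.+-cancelʳ-≡ (Fin.toℕ u) _ _
              (spare-injective {t} {t′} {u} {u} (trans (sym c≡) (trans c≡c′ c′≡)))))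

    proper : ProperColouring colouring G
    proper = proper-online , λ t t′ u u∈ u∈′ t≢t′ c≡c′ → case-< t t′ u u∈ u∈′ t≢t′ c≡c′ (ℕₚ.<-cmp (Fin.toℕ t) (Fin.toℕ t′))
      where
      case-< : ∀ t t′ u → u ∈ lookup G t → u ∈ lookup G t′ → t ≢ t′ → colouring t u ≡ colouring t′ u →
               Tri (Fin.toℕ t ℕ.< Fin.toℕ t′) (Fin.toℕ t ≡ Fin.toℕ t′) (Fin.toℕ t′ ℕ.< Fin.toℕ t) → ⊥
      case-< t t′ u u∈ u∈′ _    c≡c′ (tri< t<t′ _ _) = proper-< t t′ u t<t′ u∈ u∈′ c≡c′
      case-< t t′ u u∈ u∈′ t≢t′ c≡c′ (tri≈ _ t≡t′ _) = t≢t′ (Finₚ.toℕ-injective t≡t′)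
      case-< t t′ u u∈ u∈′ _    c≡c′ (tri> _ _ t′<t) = proper-< t′ t u t′<t u∈′ u∈ (sym c≡c′)

    module _ {D η : ℚ} (numerics : Numerics n K q D p τ η ε)
             (∣N∣<K : ∀ t → ∥ lookup G t ∥ ℕ.< K) (∣N∣≤D : ∀ t → ℕtoℚ ∥ lookup G t ∥ ≤ D)
             (degree≤D : ∀ u → ℕtoℚ (offDeg G u) ≤ D) where

      open Run 0<ε numerics

      private
        age≤D : ∀ t u → ageℚ (σₜ t) u + χ (lookup G t) u ≤ D
        age≤D t u = ≤-trans (≤-reflexive (trans (cong (ageℚ (σₜ t) u +_) (sym (lem (lookup (lookup G t) u) _ refl))) (sym (ℕtoℚ-+ (age (σₜ t) u) _))))
          (≤-trans (ℕtoℚ-mono (age-before G initial t u)) (degree≤D u))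
          where
          lem : ∀ b z → z ≡ lookup (lookup G t) u → ℕtoℚ (one z) ≡ χ (lookup G t) u
          lem _ true  eq = sym (χ-∈ (lookup⇒[]= u (lookup G t) (sym eq)))
          lem _ false eq = sym (χ-∉ λ u∈ → false≢true (trans eq ([]=⇒lookup u∈)))
            where false≢true : false ≢ true
                  false≢true ()

        module At (t : Fin n) (inv-σ : Invariant (σₜ t) (Fin.toℕ t)) where
          open Step inv-σ (ℕₚ.<⇒≤ (Finₚ.toℕ<n t)) (lookup G t) (age≤D t)
            (≤-trans (≤-reflexive (∑χ (lookup G t))) (∣N∣≤D t)) (∣N∣<K t) public

        inv-at : ∀ k → k ℕ.≤ n → Invariant (after initial (take k (toList G))) k
        inv-at zero    _   = initially
        inv-at (suc k) k<n = subst (λ k → Invariant (after initial (take (suc k) (toList G))) (suc k)) t≡k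
          (subst (λ ρ → Invariant ρ (suc (Fin.toℕ t)))
            (sym (trans (before-suc G initial t) (advance-just (σₜ t) (lookup G t) (decide-yes (σₜ t) (lookup G t) (∣N∣<K t)))))
            (At.next t (subst (λ k → Invariant (after initial (take k (toList G))) k) (sym t≡k) (inv-at k (ℕₚ.<⇒≤ k<n)))))
          where
          t : Fin n
          t = Fin.fromℕ< k<n
          t≡k : Fin.toℕ t ≡ k
          t≡k = Finₚ.toℕ-fromℕ< k<n

      colouring<K : ∀ t u → u ∈ lookup G t → colouring t u ℕ.< K
      colouring<K t u u∈ = subst (ℕ._< K)
        (sym (paint-main (σₜ t) (spare t u) (decide-yes (σₜ t) (lookup G t) (∣N∣<K t))
          (At.chosen-positive t (inv-at (Fin.toℕ t) (ℕₚ.<⇒≤ (Finₚ.toℕ<n t))) u∈)))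
        (Finₚ.toℕ<n _)

-- Constants

-- The steps of the tests are at most 209 / Δ, see β≤209i.  As 174724 = 4 * 209 ^ 2 and
-- 160000 = 2 / η, an exponent q ≤ Δ / width makes 4 * q * (209 / Δ) ^ 2 at most drift Δ.
-- Since doubling * η = 1, Bernoulli's inequality gives (1 + η) ^ doubling ≥ 2.

opaque
  width doubling : ℕ
  width = 174724 ℕ.* 160000
  doubling = 80000

opaque
  unfolding width doubling

  width-def : width ≡ 174724 ℕ.* 160000
  width-def = refl

  width-nonZero : ℕ.NonZero width
  width-nonZero = _

  width*doubling≥144000 : 144000 ℕ.≤ width ℕ.* doubling
  width*doubling≥144000 = ℕₚ.≤ᵇ⇒≤ 144000 (width ℕ.* doubling) _

  doubling-def : doubling ≡ 80000
  doubling-def = refl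

-- Small enough for `heavy`: `p * K` is at least `3/4 * 7/5 = 21/20`, and
-- `21/20 * (1 - 129 * 16 * η)` still exceeds 1.
η : ℚ
η = ℤ.+ 1 / 80000

palette exponent : ℕ → ℕ
palette Δ  = Δ ℕ.+ ℕ.⌊ Δ /2⌋
exponent Δ = (Δ ℕ./ width) {{width-nonZero}}

-- The values of `p` and `τ`, which make `p * Δ = 3/4` and `2 * τ * Δ = η` exact.
rate drift : ℕ → ℚ
rate Δ  = (ℤ.+ 3 / 4) * inv (ℕtoℚ Δ)
drift Δ = η * ½ * inv (ℕtoℚ Δ)

tolerance : ℕ → ℚ
tolerance n = inv (ℕtoℚ (suc n) * ℕtoℚ (suc n))

ℕtoℚ-suc>0 : ∀ n → 0ℚ < ℕtoℚ (suc n)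
ℕtoℚ-suc>0 n = ℕtoℚ-mono-< {0} {suc n} (ℕ.s≤s ℕ.z≤n)

tolerance>0 : ∀ n → 0ℚ < tolerance n
tolerance>0 n = inv>0 (*-pos (ℕtoℚ-suc>0 n) (ℕtoℚ-suc>0 n))

palette≤ : ∀ Δ → ℕtoℚ (palette Δ) ≤ (ℤ.+ 3 / 2) * ℕtoℚ Δ
palette≤ Δ = subst (_≤ (ℤ.+ 3 / 2) * ℕtoℚ Δ) (sym (ℕtoℚ-+ Δ ℕ.⌊ Δ /2⌋))
  (≤-by (lem (ℕtoℚ Δ) (ℕtoℚ ℕ.⌊ Δ /2⌋)) (nonNegative⁻¹ ½ ⊠ diff≥0 2half≤))
  where
  lem : ∀ D f → (ℤ.+ 3 / 2) * D - (D + f) ≡ ½ * (D - (f + f))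
  lem = solve-∀ ℚ-ring
  2half≤ : ℕtoℚ ℕ.⌊ Δ /2⌋ + ℕtoℚ ℕ.⌊ Δ /2⌋ ≤ ℕtoℚ Δ
  2half≤ = subst (_≤ ℕtoℚ Δ) (ℕtoℚ-+ ℕ.⌊ Δ /2⌋ ℕ.⌊ Δ /2⌋)
    (ℕtoℚ-mono (ℕₚ.≤-trans (ℕₚ.+-monoʳ-≤ ℕ.⌊ Δ /2⌋ (ℕₚ.⌊n/2⌋≤⌈n/2⌉ Δ)) (ℕₚ.≤-reflexive (ℕₚ.⌊n/2⌋+⌈n/2⌉≡n Δ))))

-- Rounding `Δ / 2` down costs at most 1/2, which the gap `Δ / 10` between 3/2 and 7/5 covers from
-- `Δ = 5` on.
≤palette : ∀ {Δ} → 5 ℕ.≤ Δ → (ℤ.+ 7 / 5) * ℕtoℚ Δ ≤ ℕtoℚ (palette Δ)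
≤palette {Δ} 5≤Δ = subst ((ℤ.+ 7 / 5) * ℕtoℚ Δ ≤_) (sym (ℕtoℚ-+ Δ ℕ.⌊ Δ /2⌋))
  (≤-by (lem (ℕtoℚ Δ) (ℕtoℚ ℕ.⌊ Δ /2⌋)) (nonNegative⁻¹ ½ ⊠ diff≥0 Δ≤ ⊞ nonNegative⁻¹ (ℤ.+ 1 / 10) ⊠ diff≥0 (ℕtoℚ-mono 5≤Δ)))
  where
  lem : ∀ D f → D + f - (ℤ.+ 7 / 5) * D ≡ ½ * (f + (1ℚ + f) - D) + (ℤ.+ 1 / 10) * (D - ℕtoℚ 5)
  lem = solve-∀ ℚ-ring
  Δ≤ : ℕtoℚ Δ ≤ ℕtoℚ ℕ.⌊ Δ /2⌋ + (1ℚ + ℕtoℚ ℕ.⌊ Δ /2⌋)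
  Δ≤ = subst (ℕtoℚ Δ ≤_) (trans (ℕtoℚ-+ ℕ.⌊ Δ /2⌋ (suc ℕ.⌊ Δ /2⌋)) (cong (ℕtoℚ ℕ.⌊ Δ /2⌋ +_) (ℕtoℚ-suc ℕ.⌊ Δ /2⌋)))
    (ℕtoℚ-mono (ℕₚ.≤-trans (ℕₚ.≤-reflexive (sym (ℕₚ.⌊n/2⌋+⌈n/2⌉≡n Δ))) (ℕₚ.+-monoʳ-≤ ℕ.⌊ Δ /2⌋ (ℕₚ.⌊n/2⌋-mono (ℕₚ.n≤1+n (suc Δ))))))

-- The threshold comes from `p≤η`, which reads `9 / Δ ≤ 5 * η = 1/16000`.
numerics : ∀ n Δ → 144000 ℕ.≤ Δ → ℕtoℚ n * ℕtoℚ n + 1ℚ < (1ℚ + η) ^ exponent Δ →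
           Numerics n (palette Δ) (exponent Δ) (ℕtoℚ Δ) (rate Δ) (drift Δ) η (tolerance n)
numerics n Δ big growth = record
  { 0≤p    = 0≤p
  ; 8p≤1   = ≤-by (lem₁ i) (diff≥0 144000i≤1 ⊞ ℕtoℚ≥0 143994 ⊠ i≥0)
  ; pD≤¾   = ≤-reflexive (trans (lem₂ D i) (trans (cong (ℤ.+ 3 / 4 *_) Di≡1) (*-identityʳ (ℤ.+ 3 / 4))))
  ; 0<K    = 0<κ
  ; 0≤τ    = nonNegative⁻¹ (η * ½) ⊠ i≥0
  ; 2τD≤η  = ≤-reflexive (trans (lem₃ η D i) (trans (cong (η *_) Di≡1) (*-identityʳ η)))
  ; η≤¼    = ≤-by refl (nonNegative⁻¹ (¼ - η))
  ; p≤η    = ≤-by (lem₄ i) (nonNegative⁻¹ (ℤ.+ 1 / 16000) ⊠ diff≥0 144000i≤1)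
  ; heavy  = ≤-by (trans (lem₅ D i κ) (cong (λ z → (ℤ.+ 3 / 4) * c * i * (κ - (ℤ.+ 7 / 5) * D) + ((ℤ.+ 21 / 20) * c * z - 1ℚ)) Di≡1))
                  ((nonNegative⁻¹ ((ℤ.+ 3 / 4) * c) ⊠ i≥0 ⊠ diff≥0 7/5D≤κ) ⊞ nonNegative⁻¹ ((ℤ.+ 21 / 20) * c * 1ℚ - 1ℚ))
  ; β≤¼    = ≤-trans β≤209i (≤-by (lem₇ i) (nonNegative⁻¹ ¼ ⊠ diff≥0 144000i≤1 ⊞ ℕtoℚ≥0 35791 ⊠ i≥0))
  ; qβ≤¼   = ≤-trans (*-monoˡ Q Q≥0 β≤209i) (≤-by (lem₈ Q i) (nonNegative⁻¹ ¼ ⊠ diff≥0 Qi≤ ⊞ nonNegative⁻¹ ((ℕtoℚ 174724 * ℕtoℚ 160000) * ¼ - ℕtoℚ 209) ⊠ (Q≥0 ⊠ i≥0)))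
  ; 4qβ²≤τ = ≤-trans (*-monoˡ (4ℚ * Q) (nonNegative⁻¹ 4ℚ ⊠ Q≥0) (*-mono β≥0 (ℕtoℚ≥0 209 ⊠ i≥0) β≤209i β≤209i))
                     (≤-by (lem₉ Q i) (nonNegative⁻¹ (ℤ.+ 1 / 160000) ⊠ i≥0 ⊠ diff≥0 Qi≤))
  ; growth = growth
  ; n²ε≤1  = n²ε≤1
  }
  where
  D i κ Q c iK : ℚ
  D  = ℕtoℚ Δ
  i  = inv D
  κ  = ℕtoℚ (palette Δ)
  Q  = ℕtoℚ (exponent Δ)
  c  = 1ℚ - ℕtoℚ 129 * (ℕtoℚ 16 * η)
  iK = invK (palette Δ)
  lem₁ : ∀ i → 1ℚ - 8ℚ * ((ℤ.+ 3 / 4) * i) ≡ (1ℚ - ℕtoℚ 144000 * i) + ℕtoℚ 143994 * i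
  lem₁ = solve-∀ ℚ-ring
  lem₂ : ∀ D i → (ℤ.+ 3 / 4) * i * D ≡ (ℤ.+ 3 / 4) * (D * i)
  lem₂ = solve-∀ ℚ-ring
  lem₃ : ∀ h D i → h * ½ * i * (D + D) ≡ h * (D * i)
  lem₃ = solve-∀ ℚ-ring
  lem₄ : ∀ i → (ℤ.+ 5 / 16) * (ℕtoℚ 16 * (ℤ.+ 1 / 80000)) - ℕtoℚ 12 * ((ℤ.+ 3 / 4) * i) ≡ (ℤ.+ 1 / 16000) * (1ℚ - ℕtoℚ 144000 * i)
  lem₄ = solve-∀ ℚ-ring
  lem₅ : ∀ D i κ → (ℤ.+ 3 / 4) * i * (κ * c) - 1ℚ ≡ (ℤ.+ 3 / 4) * c * i * (κ - (ℤ.+ 7 / 5) * D) + ((ℤ.+ 21 / 20) * c * (D * i) - 1ℚ)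
  lem₅ D i κ = lem c D i κ
    where lem : ∀ c D i κ → (ℤ.+ 3 / 4) * i * (κ * c) - 1ℚ ≡ (ℤ.+ 3 / 4) * c * i * (κ - (ℤ.+ 7 / 5) * D) + ((ℤ.+ 21 / 20) * c * (D * i) - 1ℚ)
          lem = solve-∀ ℚ-ring
  lem₆ : ∀ h i iK → ℕtoℚ 209 * i - (ℕtoℚ 192 * ((ℤ.+ 3 / 4) * i) + ℕtoℚ 64 * iK + ℕtoℚ 2 * (h * ½ * i)) ≡ ℕtoℚ 64 * (i - iK) + (1ℚ - h) * i
  lem₆ = solve-∀ ℚ-ring
  lem₇ : ∀ i → ¼ - ℕtoℚ 209 * i ≡ ¼ * (1ℚ - ℕtoℚ 144000 * i) + ℕtoℚ 35791 * i
  lem₇ = solve-∀ ℚ-ring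
  lem₈ : ∀ Q i → ¼ - Q * (ℕtoℚ 209 * i) ≡ ¼ * (1ℚ - Q * (ℕtoℚ 174724 * ℕtoℚ 160000) * i) + ((ℕtoℚ 174724 * ℕtoℚ 160000) * ¼ - ℕtoℚ 209) * (Q * i)
  lem₈ = solve-∀ ℚ-ring
  lem₉ : ∀ Q i → (ℤ.+ 1 / 80000) * ½ * i - 4ℚ * Q * (ℕtoℚ 209 * i * (ℕtoℚ 209 * i)) ≡ (ℤ.+ 1 / 160000) * i * (1ℚ - Q * (ℕtoℚ 174724 * ℕtoℚ 160000) * i)
  lem₉ = solve-∀ ℚ-ring
  D≥ : ℕtoℚ 144000 ≤ D
  D≥ = ℕtoℚ-mono big
  0<D : 0ℚ < D
  0<D = <-≤-trans (positive⁻¹ (ℕtoℚ 144000)) D≥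
  i≥0 : 0ℚ ≤ i
  i≥0 = inv≥0 (<⇒≤ 0<D)
  Di≡1 : D * i ≡ 1ℚ
  Di≡1 = *-inv 0<D
  144000i≤1 : ℕtoℚ 144000 * i ≤ 1ℚ
  144000i≤1 = inv-bound 0<D (subst (ℕtoℚ 144000 ≤_) (sym (*-identityˡ D)) D≥)
  0≤p : 0ℚ ≤ (ℤ.+ 3 / 4) * i
  0≤p = nonNegative⁻¹ (ℤ.+ 3 / 4) ⊠ i≥0
  7/5D≤κ : (ℤ.+ 7 / 5) * D ≤ κ
  7/5D≤κ = ≤palette (ℕₚ.≤-trans (ℕₚ.≤ᵇ⇒≤ 5 144000 _) big)
  D≤κ : D ≤ κ
  D≤κ = ≤-by (lem D κ) (diff≥0 7/5D≤κ ⊞ nonNegative⁻¹ (ℤ.+ 2 / 5) ⊠ <⇒≤ 0<D)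
    where lem : ∀ D κ → κ - D ≡ (κ - (ℤ.+ 7 / 5) * D) + (ℤ.+ 2 / 5) * D
          lem = solve-∀ ℚ-ring
  0<κ : 0ℚ < κ
  0<κ = <-≤-trans 0<D D≤κ
  iK≤i : iK ≤ i
  iK≤i = subst (_≤ i) (*-identityˡ iK) (inv-bound 0<κ (subst (_≤ i * κ) (trans (*-comm i D) Di≡1) (*-monoˡ i i≥0 D≤κ)))
  -- 209 is `192 * 3/4 + 64 + 1`, using `Δ ≤ K` and `η ≤ 1`.
  β≤209i : ℕtoℚ 192 * ((ℤ.+ 3 / 4) * i) + ℕtoℚ 64 * iK + ℕtoℚ 2 * (η * ½ * i) ≤ ℕtoℚ 209 * i
  β≤209i = ≤-by (lem₆ η i iK) (ℕtoℚ≥0 64 ⊠ diff≥0 iK≤i ⊞ nonNegative⁻¹ (1ℚ - η) ⊠ i≥0)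
  β≥0 : 0ℚ ≤ ℕtoℚ 192 * ((ℤ.+ 3 / 4) * i) + ℕtoℚ 64 * iK + ℕtoℚ 2 * (η * ½ * i)
  β≥0 = ℕtoℚ≥0 192 ⊠ 0≤p ⊞ ℕtoℚ≥0 64 ⊠ inv≥0 (<⇒≤ 0<κ) ⊞ ℕtoℚ≥0 2 ⊠ (nonNegative⁻¹ (η * ½) ⊠ i≥0)
  Q≥0 : 0ℚ ≤ Q
  Q≥0 = ℕtoℚ≥0 (exponent Δ)
  Qi≤ : Q * (ℕtoℚ 174724 * ℕtoℚ 160000) * i ≤ 1ℚ
  Qi≤ = inv-bound 0<D (subst₂ _≤_
    (trans (ℕtoℚ-* (exponent Δ) width) (cong (Q *_) (trans (cong ℕtoℚ width-def) (ℕtoℚ-* 174724 160000))))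
    (sym (*-identityˡ D)) (ℕtoℚ-mono (ℕ.m/n*n≤m Δ width {{width-nonZero}})))
  n²ε≤1 : ℕtoℚ n * (ℕtoℚ n * tolerance n) ≤ 1ℚ
  n²ε≤1 = subst (_≤ 1ℚ) (*-assoc (ℕtoℚ n) (ℕtoℚ n) (tolerance n))
    (inv-bound (*-pos (ℕtoℚ-suc>0 n) (ℕtoℚ-suc>0 n)) (subst (ℕtoℚ n * ℕtoℚ n ≤_) (sym (*-identityˡ _))
      (*-mono (ℕtoℚ≥0 n) (ℕtoℚ≥0 (suc n)) (ℕtoℚ-mono (ℕₚ.n≤1+n n)) (ℕtoℚ-mono (ℕₚ.n≤1+n n)))))

<2^[1+log] : ∀ n → n ℕ.< 2 ℕ.^ suc ⌊log₂ n ⌋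
<2^[1+log] n with n ℕ.<? 2 ℕ.^ suc ⌊log₂ n ⌋
... | yes n<   = n<
... | no n≮    = contradiction (subst (ℕ._≤ ⌊log₂ n ⌋) (⌊log₂[2^n]⌋≡n (suc ⌊log₂ n ⌋)) (⌊log₂⌋-mono-≤ (ℕₚ.≮⇒≥ n≮))) (ℕₚ.<⇒≱ ℕₚ.≤-refl)

-- With `L = ⌊log₂ n ⌋` and `P = 2 ^ (L + 1)` one has `n * n + 1 < 2 * P * P = 2 ^ (2 * L + 3)`, and
-- each factor 2 costs `doubling` in the exponent. The 5 in the hypothesis covers `2 * L + 3`, as
-- `L ≥ 1`.
exponential-growth : ∀ n Δ → 2 ℕ.≤ n → width ℕ.* doubling ℕ.* 5 ℕ.* ⌊log₂ n ⌋ ℕ.≤ Δ →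
                     ℕtoℚ n * ℕtoℚ n + 1ℚ < (1ℚ + η) ^ exponent Δ
exponential-growth n Δ 2≤n Δ≥ = begin-strict
  ℕtoℚ n * ℕtoℚ n + 1ℚ        <⟨ n²+1< ⟩
  two ^ (L ℕ.+ L ℕ.+ 3)       ≤⟨ ^-mono (L ℕ.+ L ℕ.+ 3) (ℕtoℚ≥0 2) 2≤ ⟩
  ((1ℚ + η) ^ doubling) ^ (L ℕ.+ L ℕ.+ 3)  ≡⟨ ^-assocʳ (1ℚ + η) doubling (L ℕ.+ L ℕ.+ 3) ⟩
  (1ℚ + η) ^ (doubling ℕ.* (L ℕ.+ L ℕ.+ 3)) ≤⟨ ^-mono-exp {1ℚ + η} (≤-by refl (nonNegative⁻¹ (1ℚ + η - 1ℚ))) exponent≥ ⟩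
  (1ℚ + η) ^ exponent Δ ∎
  where
  open ≤-Reasoning
  L = ⌊log₂ n ⌋
  two : ℚ
  two = ℕtoℚ 2
  2≤ : two ≤ (1ℚ + η) ^ doubling
  2≤ = ≤-trans (≤-reflexive (sym (cong (1ℚ +_) (cong (λ j → ℕtoℚ j * η) doubling-def)))) (bernoulli doubling {η} (nonNegative⁻¹ η))
  1≤L : 1 ℕ.≤ L
  1≤L = ⌊log₂⌋-mono-≤ {2} {n} 2≤n
  exponent≥ : doubling ℕ.* (L ℕ.+ L ℕ.+ 3) ℕ.≤ exponent Δ
  exponent≥ = subst (ℕ._≤ exponent Δ) (ℕ.m*n/n≡m (doubling ℕ.* (L ℕ.+ L ℕ.+ 3)) width {{width-nonZero}})
    (ℕ./-monoˡ-≤ width {{width-nonZero}} (ℕₚ.≤-trans bound Δ≥))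
    where
    lem : ∀ h j l → h ℕ.* j ℕ.* 5 ℕ.* l ≡ j ℕ.* (l ℕ.+ l ℕ.+ 3 ℕ.* l) ℕ.* h
    lem = ℕ-solve-∀
    bound : doubling ℕ.* (L ℕ.+ L ℕ.+ 3) ℕ.* width ℕ.≤ width ℕ.* doubling ℕ.* 5 ℕ.* L
    bound = subst (doubling ℕ.* (L ℕ.+ L ℕ.+ 3) ℕ.* width ℕ.≤_) (sym (lem width doubling L))
      (ℕₚ.*-monoˡ-≤ width (ℕₚ.*-monoʳ-≤ doubling (ℕₚ.+-monoʳ-≤ (L ℕ.+ L) (ℕₚ.*-monoʳ-≤ 3 1≤L))))
  ℕtoℚ-^ : ∀ m → ℕtoℚ (2 ℕ.^ m) ≡ two ^ m
  ℕtoℚ-^ zero    = refl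
  ℕtoℚ-^ (suc m) = trans (ℕtoℚ-* 2 (2 ℕ.^ m)) (cong (two *_) (ℕtoℚ-^ m))
  P : ℚ
  P = two ^ suc L
  n≤P : ℕtoℚ n ≤ P
  n≤P = subst (ℕtoℚ n ≤_) (ℕtoℚ-^ (suc L)) (ℕtoℚ-mono (ℕₚ.<⇒≤ (<2^[1+log] n)))
  1≤P : 1ℚ ≤ P
  1≤P = ≤-trans (ℕtoℚ-mono (ℕₚ.≤-trans (ℕ.s≤s ℕ.z≤n) 2≤n)) n≤P
  n²+1< : ℕtoℚ n * ℕtoℚ n + 1ℚ < two ^ (L ℕ.+ L ℕ.+ 3)
  n²+1< = subst (ℕtoℚ n * ℕtoℚ n + 1ℚ <_) (trans (lem P) (trans (cong (_* two) (sym (^-homo-* two (suc L) (suc L)))) (trans (*-comm (two ^ (suc L ℕ.+ suc L)) two) (cong (two ^_) (ℕ-lem L)))))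
    (≤-<-trans (+-monoˡ-≤ 1ℚ (*-mono (ℕtoℚ≥0 n) 0≤P n≤P n≤P))
      (+-monoʳ-< (P * P) (<-≤-trans (ℕtoℚ-mono-< {1} {2} ℕₚ.≤-refl) (≤-trans (subst₂ _≤_ (*-identityʳ two) refl (*-mono {two} {P} {1ℚ} {P} (ℕtoℚ≥0 2) 0≤P 2≤P 1≤P)) ≤-refl))))
    where
    0≤P = ≤-trans 0≤1 1≤P
    2≤P : two ≤ P
    2≤P = ≤-trans (ℕtoℚ-mono 2≤n) n≤P
    lem : ∀ P → P * P + P * P ≡ P * P * (1ℚ + 1ℚ)
    lem = solve-∀ ℚ-ring
    ℕ-lem : ∀ l → suc (suc l ℕ.+ suc l) ≡ l ℕ.+ l ℕ.+ 3
    ℕ-lem l = trans (cong (λ z → suc (suc z)) (ℕₚ.+-suc l l)) (ℕₚ.+-comm 3 (l ℕ.+ l))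

-- The constant e / (e - 1) exceeds 3 / 2

*-unit : ∀ m .{{_ : ℕ.NonZero m}} → ℕtoℚ m * (ℤ.+ 1 / m) ≡ 1ℚ
*-unit (suc m) = toℚᵘ-injective (ℚᵘₚ.≃-trans (toℚᵘ-homo-* (ℕtoℚ (suc m)) (ℤ.+ 1 / suc m))
  (ℚᵘₚ.≃-trans (ℚᵘₚ.*-cong (toℚᵘ-ℕtoℚ (suc m)) (toℚᵘ-fromℚᵘ (ℚᵘ.mkℚᵘ (ℤ.+ 1) m)))
    (ℚᵘ.*≡* (cong ℤ.+_ (lem m)))))
  where
  lem : ∀ m → suc m ℕ.* 1 ℕ.* 1 ≡ 1 ℕ.* (1 ℕ.* suc m)
  lem m = trans (trans (ℕₚ.*-identityʳ (suc m ℕ.* 1)) (ℕₚ.*-identityʳ (suc m))) (sym (trans (ℕₚ.*-identityˡ (1 ℕ.* suc m)) (ℕₚ.*-identityˡ (suc m))))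

inverse : ∀ m .{{_ : ℕ.NonZero m}} → ℚ
inverse m = ℤ.+ 1 / m

inverse≥0 : ∀ m .{{_ : ℕ.NonZero m}} → 0ℚ ≤ inverse m
inverse≥0 m = nonNegative⁻¹ (inverse m) {{normalize-nonNeg 1 m}}

inverse-halves : ∀ k m .{{_ : ℕ.NonZero m}} .{{_ : ℕ.NonZero (suc (suc k) ℕ.* m)}} →
                 inverse (suc (suc k) ℕ.* m) + inverse (suc (suc k) ℕ.* m) ≤ inverse m
inverse-halves k m = ≤-by eq (ℕtoℚ≥0 k ⊠ ℕtoℚ≥0 m ⊠ inverse≥0 m ⊠ inverse≥0 m′)
  where
  m′ = suc (suc k) ℕ.* m
  lem : ∀ k m c c′ → c * ((1ℚ + (1ℚ + k)) * m * c′) - (c′ * (m * c) + c′ * (m * c)) ≡ k * m * c * c′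
  lem = solve-∀ ℚ-ring
  m′-eq : ℕtoℚ m′ ≡ (1ℚ + (1ℚ + ℕtoℚ k)) * ℕtoℚ m
  m′-eq = trans (ℕtoℚ-* (suc (suc k)) m) (cong (_* ℕtoℚ m) (trans (ℕtoℚ-suc (suc k)) (cong (1ℚ +_) (ℕtoℚ-suc k))))
  one′ : ∀ c {z} → z ≡ 1ℚ → c ≡ c * z
  one′ c refl = sym (*-identityʳ c)
  eq : inverse m - (inverse m′ + inverse m′) ≡ ℕtoℚ k * ℕtoℚ m * inverse m * inverse m′
  eq = trans (cong₂ _-_ (one′ (inverse m) (trans (cong (_* inverse m′) (sym m′-eq)) (*-unit m′)))
                        (cong₂ _+_ (one′ (inverse m′) (*-unit m)) (one′ (inverse m′) (*-unit m))))
             (lem (ℕtoℚ k) (ℕtoℚ m) (inverse m) (inverse m′))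

-- The induction closes when the last term is added once more (`strong`):
-- `2 / (k + 2)! ≤ 1 / (k + 1)!`, with equality to 3 at the start.
eApprox≤3 : ∀ k → eApprox k ≤ ℕtoℚ 3
eApprox≤3 zero    = ≤-by refl (ℕtoℚ≥0 2)
eApprox≤3 (suc k) = ≤-trans (≤-by (lem (eApprox (suc k)) _) (inverse≥0 (suc k !) {{(suc k) ℕₚ.!≢0}})) (strong k)
  where
  lem : ∀ a b → a + b - a ≡ b
  lem = solve-∀ ℚ-ring
  strong : ∀ k → eApprox (suc k) + inverse (suc k !) {{(suc k) ℕₚ.!≢0}} ≤ ℕtoℚ 3
  strong zero    = ≤-reflexive refl
  strong (suc k) = ≤-trans (subst (_≤ eApprox (suc k) + inverse (suc k !) {{(suc k) ℕₚ.!≢0}}) (sym (+-assoc (eApprox (suc k)) _ _))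
    (+-monoʳ-≤ (eApprox (suc k)) (inverse-halves k (suc k !) {{(suc k) ℕₚ.!≢0}} {{(suc (suc k)) ℕₚ.!≢0}}))) (strong k)

3/2≤e/[e-1] : ∀ r → e/[e-1]< r → ℤ.+ 3 / 2 ≤ r
3/2≤e/[e-1] r (1<r , k , r<) = ≤-by (lem r) (nonNegative⁻¹ ½ ⊠ diff≥0 r≤)
  where
  lem : ∀ r → r - ℤ.+ 3 / 2 ≡ ½ * (ℕtoℚ 3 * (r - 1ℚ) - r)
  lem = solve-∀ ℚ-ring
  r≤ : r ≤ ℕtoℚ 3 * (r - 1ℚ)
  r≤ = ≤-trans (<⇒≤ r<) (*-monoʳ (r - 1ℚ) (diff≥0 (<⇒≤ 1<r)) (eApprox≤3 k))

algorithm : OnlineAlg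
algorithm n Δ = Algorithm.respond n (palette Δ) (exponent Δ) (rate Δ) (drift Δ) (tolerance>0 n)

theorem1p1 : ∃[ A ] ((∀ (n Δ : ℕ) (G : Graph n) → MaxDegree G Δ → ProperColouring (colour A Δ G) G)
                 × (∀ (r : ℚ) → e/[e-1]< r →
                      ∃[ C ] ∃[ N ] ∀ (n Δ : ℕ) → N ℕ.≤ n → C ℕ.* ⌊log₂ n ⌋ ℕ.≤ Δ →
                        (G : Graph n) → MaxDegree G Δ →
                        UsesAtMost (colour A Δ G) G (r * ℕtoℚ Δ)))
theorem1p1 = algorithm
  , (λ n Δ G _ → Algorithm.proper n (palette Δ) (exponent Δ) (rate Δ) (drift Δ) (tolerance>0 n) G)
  -- Neither constant depends on `r`, since the one palette is within every admissible `r * Δ`. From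
  -- `n ≥ 2` the logarithm is positive, so the lower bound on `Δ` also yields `144000 ≤ Δ`.
  , λ r e/[e-1]<r → width ℕ.* doubling ℕ.* 5 , 2 , λ n Δ 2≤n large G (online≤Δ , offline≤Δ , _) t u u∈ →
      few-colours r n Δ (3/2≤e/[e-1] r e/[e-1]<r) 2≤n large G online≤Δ offline≤Δ t u u∈
  where
  few-colours : ∀ r n Δ → ℤ.+ 3 / 2 ≤ r → 2 ℕ.≤ n → width ℕ.* doubling ℕ.* 5 ℕ.* ⌊log₂ n ⌋ ℕ.≤ Δ →
                (G : Graph n) → (∀ t → onDeg G t ℕ.≤ Δ) → (∀ u → offDeg G u ℕ.≤ Δ) →
                UsesAtMost (colour algorithm Δ G) G (r * ℕtoℚ Δ)
  few-colours r n Δ 3/2≤r 2≤n large G online≤Δ offline≤Δ t u u∈ = begin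
    ℕtoℚ (suc (colour algorithm Δ G t u))  ≤⟨ ℕtoℚ-mono (colour<palette t u u∈) ⟩
    ℕtoℚ (palette Δ)                       ≤⟨ palette≤ Δ ⟩
    (ℤ.+ 3 / 2) * ℕtoℚ Δ                   ≤⟨ *-monoʳ (ℕtoℚ Δ) (ℕtoℚ≥0 Δ) 3/2≤r ⟩
    r * ℕtoℚ Δ                             ∎
    where
    open ≤-Reasoning
    144000≤Δ : 144000 ℕ.≤ Δ
    144000≤Δ = ℕₚ.≤-trans width*doubling≥144000 (ℕₚ.≤-trans (ℕₚ.m≤m*n (width ℕ.* doubling) 5)
      (ℕₚ.≤-trans (ℕₚ.m≤m*n (width ℕ.* doubling ℕ.* 5) ⌊log₂ n ⌋ {{ℕ.>-nonZero (⌊log₂⌋-mono-≤ {2} {n} 2≤n)}}) large))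
    Δ<palette : Δ ℕ.< palette Δ
    Δ<palette = ℕₚ.≤-trans (ℕₚ.≤-reflexive (ℕₚ.+-comm 1 Δ))
      (ℕₚ.+-monoʳ-≤ Δ (ℕₚ.⌊n/2⌋-mono {2} (ℕₚ.≤-trans (ℕₚ.≤ᵇ⇒≤ 2 144000 _) 144000≤Δ)))
    colour<palette = Algorithm.colouring<K n (palette Δ) (exponent Δ) (rate Δ) (drift Δ) (tolerance>0 n) G
      (numerics n Δ 144000≤Δ (exponential-growth n Δ 2≤n large))
      (λ t → ℕₚ.≤-<-trans (online≤Δ t) Δ<palette) (λ t → ℕtoℚ-mono (online≤Δ t)) (λ u → ℕtoℚ-mono (offline≤Δ u))
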